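{- Let $k\geq 5$ and $h\geq 2$ be integers, and let $\mathcal{P}_{h}$ be the set of all $k$-polycyclic chains with $h$ $k$-polygons, i.e. the set of graphs isomorphic to $P(w)$ for some $w\in\{0,1,\dots,k-4\}^{h-2}$. Then for every $G\in\mathcal{P}_h$, $$Kf(G)\leq Kf\Big(P(\underbrace{\lfloor\tfrac{k-4}{2}\rfloor,\lceil\tfrac{k-4}{2}\rceil,\lfloor\tfrac{k-4}{2}\rfloor,\lceil\tfrac{k-4}{2}\rceil,\dots}_{h-2})\Big),$$ with equality if and only if $G\cong L_h$ when $k$ is even, and $G\cong Z_h$ when $k$ is odd. Here, for $k$ even, $L_h:=P(\frac{k-4}{2},\dots,\frac{k-4}{2})$ (the linear chain), and for $k$ odd, $Z_h:=P(\lfloor\frac{k-4}{2}\rfloor,\lceil\frac{k-4}{2}\rceil,\lfloor\frac{k-4}{2}\rfloor,\lceil\frac{k-4}{2}\rceil,\dots)$ (the zigzag chain, whose entries alternate; it is isomorphic to the chain with alternating entries starting with $\lceil\frac{k-4}{2}\rceil$).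
   Context: All graphs are simple and connected. Regard each edge of a graph $G$ as a unit resistor; the resistance distance $\Omega_G(u,v)$ is the effective resistance between $u$ and $v$ in the resulting electrical network. The Kirchhoff index is $Kf(G)=\sum_{\{u,v\}\subseteq V(G)}\Omega_G(u,v)$. $k$-polycyclic chains: Let $h\geq 2$. The linear quadrilateral chain $Q_h$ has vertices $t_0,\dots,t_h,s_0,\dots,s_h$ and edges $t_{j-1}t_j$, $s_{j-1}s_j$ ($1\leq j\leq h$) and $t_js_j$ ($0\leq j\leq h$); its $i$-th square $S_i$ ($1\le i\le h$) is the 4-cycle $t_{i-1}t_is_is_{i-1}$, with top edge $t_{i-1}t_i$ and bottom edge $s_{i-1}s_i$. For $w=(w_1,\dots,w_{h-2})$ with each $w_i\in\{0,1,\dots,k-4\}$, the $k$-polycyclic chain $P(w)=P_h(w)$ is obtained from $Q_h$ by: subdividing the top edges of $S_1$ and $S_h$ with $\lceil\frac{k-4}{2}\rceil$ new vertices each and the bottom edges of $S_1$ and $S_h$ with $\lfloor\frac{k-4}{2}\rfloor$ new vertices each; and, for $1\le i\le h-2$, subdividing the top edge of $S_{i+1}$ with $w_i$ new vertices and the bottom edge of $S_{i+1}$ with $k-4-w_i$ new vertices. Thus each square becomes a $k$-cycle and consecutive polygons share the edge $t_is_i$. -}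

module Defs where

open import Data.Nat as ℕ using (ℕ; zero; suc; _∸_; _≡ᵇ_; ⌊_/2⌋; ⌈_/2⌉; _<ᵇ_)
open import Data.Bool using (Bool; true; false; if_then_else_; _∧_; _∨_; not)
open import Data.Fin using (Fin; toℕ)
open import Data.Product using (Σ; _×_; _,_)
open import Data.List using (List; []; _∷_; _++_)
open import Data.Bool.ListAction using (any)
open import Data.Vec as Vec using (Vec)
open import Data.Rational using (ℚ; 0ℚ; 1ℚ; _+_; _-_)
open import Relation.Binary.PropositionalEquality using (_≡_)
open import Function.Bundles using (_↔_; Inverse)

-- Simple graphs on vertex set Fin n, given by an edge list over ℕ labels.
-- u ~ v iff u ≠ v and {u,v} occurs (in either orientation) in the list.
-- Loops are ignored and duplicate edges collapse, so this is always a
-- simple graph.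

record Graph : Set where
  constructor graph
  field
    n : ℕ
    E : List (ℕ × ℕ)
open Graph public

adj : (G : Graph) → Fin (n G) → Fin (n G) → Bool
adj G i j =
  not (toℕ i ≡ᵇ toℕ j) ∧
  any (λ { (a , b) → ((a ≡ᵇ toℕ i) ∧ (b ≡ᵇ toℕ j)) ∨ ((a ≡ᵇ toℕ j) ∧ (b ≡ᵇ toℕ i)) }) (E G)

_≅_ : Graph → Graph → Set
G ≅ H = Σ (Fin (n G) ↔ Fin (n H)) λ f →
  ∀ i j → adj G i j ≡ adj H (Inverse.to f i) (Inverse.to f j)

sumFin : (m : ℕ) → (Fin m → ℚ) → ℚ
sumFin zero f = 0ℚ
sumFin (suc m) f = f Fin.zero + sumFin m (λ i → f (Fin.suc i))

[_] : Bool → ℚ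
[ true ] = 1ℚ
[ false ] = 0ℚ

laplacian : (G : Graph) → (Fin (n G) → ℚ) → Fin (n G) → ℚ
laplacian G x i = sumFin (n G) (λ j → if adj G i j then x i - x j else 0ℚ)

δ : {m : ℕ} → Fin m → Fin m → ℚ
δ i u = [ toℕ i ≡ᵇ toℕ u ]

-- r is the effective resistance between u and v: a unit current is injected
-- at u and extracted at v (Kirchhoff + Ohm with unit resistors give
-- L x = e_u - e_v for the potential x), and r is the potential difference.
IsResistance : (G : Graph) → Fin (n G) → Fin (n G) → ℚ → Set
IsResistance G u v r =
  Σ (Fin (n G) → ℚ) λ x →
    (∀ i → laplacian G x i ≡ δ i u - δ i v) × (r ≡ x u - x v)

IsKirchhoff : Graph → ℚ → Set
IsKirchhoff G K =
  Σ (Fin (n G) → Fin (n G) → ℚ) λ Ω →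
    (∀ u v → IsResistance G u v (Ω u v)) ×
    (K ≡ sumFin (n G) (λ u → sumFin (n G) (λ v →
            if toℕ u <ᵇ toℕ v then Ω u v else 0ℚ)))

-- k-polycyclic chains.
-- Vertex labels: t_j = j, s_j = h+1+j (0 ≤ j ≤ h); subdivision vertices
-- are numbered consecutively from 2h+2.  Total: h(k-2)+2 vertices.

pathE : ℕ → ℕ → ℕ → ℕ → List (ℕ × ℕ)
pathE x y base zero = (x , y) ∷ []
pathE x y base (suc m) = (x , base) ∷ pathE base y (suc base) m

module _ (h : ℕ) where
  tV : ℕ → ℕ
  tV j = j
  sV : ℕ → ℕ
  sV j = suc (h ℕ.+ j)

  squaresE : ℕ → ℕ → List (ℕ × ℕ) → List (ℕ × ℕ)
  squaresE i base [] = []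
  squaresE i base ((a , b) ∷ rest) =
    pathE (tV i) (tV (suc i)) base a ++
    pathE (sV i) (sV (suc i)) (base ℕ.+ a) b ++
    squaresE (suc i) (base ℕ.+ a ℕ.+ b) rest

  rungsE : ℕ → List (ℕ × ℕ)
  rungsE zero = (tV 0 , sV 0) ∷ []
  rungsE (suc j) = (tV (suc j) , sV (suc j)) ∷ rungsE j

P : (k h : ℕ) → Vec ℕ (h ∸ 2) → Graph
P k h w = graph (h ℕ.* (k ∸ 2) ℕ.+ 2)
  (rungsE h h ++ squaresE h 0 (2 ℕ.* h ℕ.+ 2) sq)
  where
  c = k ∸ 4
  end = ⌈ c /2⌉ , ⌊ c /2⌋
  sq = end ∷ (Data.List.map (λ wi → wi , c ∸ wi) (Vec.toList w) ++ end ∷ [])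

altSeq : (k m : ℕ) → Vec ℕ m
altSeq k m = Vec.tabulate (λ i →
  if toℕ i ℕ.% 2 ≡ᵇ 0 then ⌊ (k ∸ 4) /2⌋ else ⌈ (k ∸ 4) /2⌉)

Lchain : (k h : ℕ) → Graph
Lchain k h = P k h (Vec.replicate (h ∸ 2) ((k ∸ 4) ℕ./ 2))

Zchain : (k h : ℕ) → Graph
Zchain k h = P k h (altSeq k (h ∸ 2))

-- Cutting a chain at a rung splits it into a left part and a chain with fewer polygons, so the Green's function of
-- the chain, grounded symmetrically at the two ends t, s of its first rung, is given by an explicit recursion over
-- the polygons. Summing it, the Kirchhoff index is a quantity depending only on k and h minus a quadratic form in
-- the offsets dᵢ = (bᵢ − aᵢ) / 2 of the polygons, where aᵢ and bᵢ count the subdivision vertices on top and bottom.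
-- Completing squares turns the form into Σ γᵢ dᵢ² plus a form in the sums dᵢ + dᵢ₊₁, both over the inner polygons,
-- with γᵢ > 0 and the second form positive definite. Hence it is smallest exactly when every |dᵢ| is as small as
-- parity allows and the signs alternate. This leaves one word for even k, and for odd k two words, which are
-- exchanged by turning the chain upside down.
module Submission where

open import Defs
open import Data.Nat as ℕ using (ℕ; zero; suc; _≤_; _∸_; _%_; s≤s; _≡ᵇ_; _<ᵇ_; ⌊_/2⌋; ⌈_/2⌉)
import Data.Nat.Properties as ℕₚ
import Data.Nat.DivMod as DivMod
open import Data.Vec as Vec using (Vec)
open import Data.Vec.Relation.Unary.All as All using (All)
import Data.Nat.Divisibility
open import Data.Rational using (ℚ; 0ℚ; 1ℚ; ½; _+_; _-_; _*_; -_; _/_) renaming (_≤_ to _≤ℚ_; _<_ to _<ℚ_)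
import Data.Rational as ℚ
import Data.Rational.Properties as ℚₚ
open import Data.Integer using () renaming (+_ to pos)
open import Data.Bool using (Bool; true; false; if_then_else_; _∧_; _∨_; not)
import Data.Bool.Properties as Boolₚ
open import Data.Bool.ListAction using (any)
open import Data.Fin using (Fin; toℕ; fromℕ<; fromℕ; inject₁)
import Data.Fin as Fin
import Data.Fin.Properties as Finₚ
import Data.Fin.Relation.Unary.Top as Top
open import Data.List using (List; []; _∷_; _++_; map; upTo; allFin; tabulate; length)
import Data.List.Properties as Listₚ
open import Data.List.Membership.Propositional using (_∈_)
open import Data.List.Membership.Propositional.Properties using (∈-map⁺; ∈-map⁻; ∈-allFin; ∈-++⁺ˡ; ∈-++⁺ʳ; ∈-upTo⁺; ∈-upTo⁻; ∈-tabulate⁺)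
open import Data.List.Relation.Unary.Any using (here; there)
open import Data.List.Relation.Unary.All as L using ([]; _∷_)
import Data.List.Relation.Unary.All.Properties as Lₚ
open import Data.List.Relation.Unary.AllPairs as AP using (AllPairs; []; _∷_)
import Data.List.Relation.Unary.AllPairs.Properties as APₚ
open import Data.List.Relation.Unary.Unique.Propositional using (Unique)
import Data.List.Relation.Unary.Unique.Propositional.Properties as Uniqueₚ
open import Data.List.Relation.Binary.Permutation.Propositional using (_↭_; refl; prep; swap; trans; ↭-sym; ↭-refl; ↭-trans)
import Data.List.Relation.Binary.Permutation.Propositional.Properties as ↭ₚ
import Algebra.Solver.CommutativeMonoid as CommutativeMonoidSolver
open import Data.List.Relation.Binary.BagAndSetEquality using (∼bag⇒↭)
open import Data.Product using (Σ; _×_; _,_; proj₁; proj₂; ∃)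
open import Data.Sum using (_⊎_; inj₁; inj₂)
open import Data.Empty using (⊥; ⊥-elim)
open import Data.Unit using (⊤; tt)
open import Function using (_∘_; id; mk⇔)
open import Function.Bundles using (_⇔_; _↔_; Inverse; mk↔ₛ′)
open import Function.Construct.Identity using (↔-id)
open import Function.Construct.Composition using (_↔-∘_)
open import Relation.Binary.Definitions using (tri<; tri≈; tri>)
open import Relation.Nullary using (yes; no)
open import Relation.Nullary.Decidable using (dec⇒maybe)
open import Relation.Binary.PropositionalEquality using (_≡_; _≢_; _≗_; refl; sym; cong; cong₂; subst; subst₂; module ≡-Reasoning) renaming (trans to ≡-trans)
open import Tactic.RingSolver using (solve-∀)
open import Data.Nat.Tactic.RingSolver renaming (solve-∀ to ℕ-solve-∀) using ()
open import Tactic.RingSolver.Core.AlmostCommutativeRing using (AlmostCommutativeRing; fromCommutativeRing)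

-- The recursion works because the word never reaches its coefficients. Seen from a rung, everything
-- to the right is one resistor, and the circuit around a polygon has the same length however its
-- subdivision vertices are split; so `g` depends only on the number of polygons, and the word
-- enters only through the offsets. Trace and total of the Green's function cannot be unrolled
-- separately, since each feeds on sums of the rung potential `ψ`. A combination with a running
-- parameter `k` keeps its shape under attaching a polygon; this is `Φ`. The form that results
-- couples every offset to all offsets on its right. Subtracting from `skew` its value on an
-- alternating list leaves a remainder that sees only sums of neighbours. Each completed square
-- borrows from the next polygon; k ≥ 5 gives g ≤ 1/4, which keeps every loan below half of what is
-- available. The outer squares drop out for two different reasons: no vertex lies left of the
-- first, and in the last the product of `g 1` with the vertex count is 1, which makes the
-- coefficient of its offset vanish.

variable
  A A′ : Set

ℚ-ring : AlmostCommutativeRing _ _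
ℚ-ring = fromCommutativeRing ℚₚ.+-*-commutativeRing λ x → dec⇒maybe (0ℚ ℚₚ.≟ x)

-- Finite sums

∑ : List A → (A → ℚ) → ℚ
∑ [] f = 0ℚ
∑ (x ∷ xs) f = f x + ∑ xs f

∑-cong : ∀ (xs : List A) {f h : A → ℚ} → (∀ x → f x ≡ h x) → ∑ xs f ≡ ∑ xs h
∑-cong [] eq = refl
∑-cong (x ∷ xs) eq = cong₂ _+_ (eq x) (∑-cong xs eq)

∑-0 : ∀ (xs : List A) → ∑ xs (λ _ → 0ℚ) ≡ 0ℚ
∑-0 [] = refl
∑-0 (x ∷ xs) = ≡-trans (ℚₚ.+-identityˡ _) (∑-0 xs)

interchange : ∀ a b c d → (a + b) + (c + d) ≡ (a + c) + (b + d)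
interchange = solve-∀ ℚ-ring

∑-+ : ∀ (xs : List A) (f h : A → ℚ) → ∑ xs (λ x → f x + h x) ≡ ∑ xs f + ∑ xs h
∑-+ [] f h = refl
∑-+ (x ∷ xs) f h = ≡-trans (cong (f x + h x +_) (∑-+ xs f h)) (interchange (f x) (h x) (∑ xs f) (∑ xs h))

∑-*ˡ : ∀ (xs : List A) c (f : A → ℚ) → ∑ xs (λ x → c * f x) ≡ c * ∑ xs f
∑-*ˡ [] c f = sym (ℚₚ.*-zeroʳ c)
∑-*ˡ (x ∷ xs) c f = ≡-trans (cong (c * f x +_) (∑-*ˡ xs c f)) (sym (ℚₚ.*-distribˡ-+ c (f x) (∑ xs f)))

∑-++ : ∀ (xs ys : List A) (f : A → ℚ) → ∑ (xs ++ ys) f ≡ ∑ xs f + ∑ ys f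
∑-++ [] ys f = sym (ℚₚ.+-identityˡ _)
∑-++ (x ∷ xs) ys f = ≡-trans (cong (f x +_) (∑-++ xs ys f)) (sym (ℚₚ.+-assoc (f x) (∑ xs f) (∑ ys f)))

∑-map : ∀ (p : A → A′) (xs : List A) (f : A′ → ℚ) → ∑ (map p xs) f ≡ ∑ xs (f ∘ p)
∑-map p [] f = refl
∑-map p (x ∷ xs) f = cong (f (p x) +_) (∑-map p xs f)

∑-↭ : ∀ {xs ys : List A} (f : A → ℚ) → xs ↭ ys → ∑ xs f ≡ ∑ ys f
∑-↭ f refl = refl
∑-↭ f (prep x p) = cong (f x +_) (∑-↭ f p)
∑-↭ f (swap x y p) = ≡-trans (cong (λ z → f x + (f y + z)) (∑-↭ f p)) (exch (f x) (f y) _)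
  where
  exch : ∀ a b c → a + (b + c) ≡ b + (a + c)
  exch = solve-∀ ℚ-ring
∑-↭ f (trans p q) = ≡-trans (∑-↭ f p) (∑-↭ f q)

∑-swap : ∀ (xs : List A) (ys : List A′) (f : A → A′ → ℚ) →
  ∑ xs (λ x → ∑ ys (f x)) ≡ ∑ ys (λ y → ∑ xs (λ x → f x y))
∑-swap [] ys f = sym (∑-0 ys)
∑-swap (x ∷ xs) ys f = ≡-trans (cong (∑ ys (f x) +_) (∑-swap xs ys f)) (sym (∑-+ ys (f x) (λ y → ∑ xs λ x → f x y)))

∑-tabulate : ∀ m (p : Fin m → A) (f : A → ℚ) → ∑ (tabulate p) f ≡ sumFin m (f ∘ p)
∑-tabulate zero p f = refl
∑-tabulate (suc m) p f = cong (f (p Fin.zero) +_) (∑-tabulate m (p ∘ Fin.suc) f)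

sumFin-∑ : ∀ m (f : Fin m → ℚ) → sumFin m f ≡ ∑ (allFin m) f
sumFin-∑ m f = sym (∑-tabulate m id f)

sumFin-cong : ∀ m {f h : Fin m → ℚ} → (∀ x → f x ≡ h x) → sumFin m f ≡ sumFin m h
sumFin-cong zero eq = refl
sumFin-cong (suc m) eq = cong₂ _+_ (eq Fin.zero) (sumFin-cong m (eq ∘ Fin.suc))

sumFin²-∑ : ∀ m (f : Fin m → Fin m → ℚ) →
  sumFin m (λ u → sumFin m (f u)) ≡ ∑ (allFin m) (λ u → ∑ (allFin m) (f u))
sumFin²-∑ m f = ≡-trans (sumFin-cong m λ u → sumFin-∑ m (f u)) (sumFin-∑ m _)

+-self-injective : ∀ {x y} → x + x ≡ y + y → x ≡ y
+-self-injective {x} {y} eq = ≡-trans (halve x) (≡-trans (cong (½ *_) eq) (sym (halve y)))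
  where
  halve : ∀ x → x ≡ ½ * (x + x)
  halve = solve-∀ ℚ-ring

-- Iverson brackets

≡ᵇ-comm : ∀ a b → (a ≡ᵇ b) ≡ (b ≡ᵇ a)
≡ᵇ-comm zero zero = refl
≡ᵇ-comm zero (suc b) = refl
≡ᵇ-comm (suc a) zero = refl
≡ᵇ-comm (suc a) (suc b) = ≡ᵇ-comm a b

≡ᵇ⇒≡ : ∀ a b → (a ≡ᵇ b) ≡ true → a ≡ b
≡ᵇ⇒≡ a b eq = ℕₚ.≡ᵇ⇒≡ a b (subst Data.Bool.T (sym eq) tt)

≡ᵇ-refl : ∀ a → (a ≡ᵇ a) ≡ true
≡ᵇ-refl zero = refl
≡ᵇ-refl (suc a) = ≡ᵇ-refl a

Iverson-∧ : ∀ p q → Defs.[ p ∧ q ] ≡ Defs.[ p ] * Defs.[ q ]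
Iverson-∧ false q = sym (ℚₚ.*-zeroˡ Defs.[ q ])
Iverson-∧ true q = sym (ℚₚ.*-identityˡ Defs.[ q ])

Iverson-injective : ∀ p q → Defs.[ p ] ≡ Defs.[ q ] → p ≡ q
Iverson-injective true true eq = refl
Iverson-injective false false eq = refl
Iverson-injective true false ()
Iverson-injective false true ()

if-Iverson : ∀ p x → (if p then x else 0ℚ) ≡ Defs.[ p ] * x
if-Iverson false x = sym (ℚₚ.*-zeroˡ x)
if-Iverson true x = sym (ℚₚ.*-identityˡ x)

sumFin-δˡ : ∀ m (k : Fin m) (f : Fin m → ℚ) → sumFin m (λ j → Defs.[ toℕ k ≡ᵇ toℕ j ] * f j) ≡ f k
sumFin-δˡ (suc m) Fin.zero f = ≡-trans (cong₂ _+_ (ℚₚ.*-identityˡ (f Fin.zero)) vanish) (ℚₚ.+-identityʳ _)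
  where
  vanish : sumFin m (λ j → 0ℚ * f (Fin.suc j)) ≡ 0ℚ
  vanish = ≡-trans (sumFin-cong m λ j → ℚₚ.*-zeroˡ (f (Fin.suc j))) (≡-trans (sumFin-∑ m _) (∑-0 (allFin m)))
sumFin-δˡ (suc m) (Fin.suc k) f =
  ≡-trans (cong₂ _+_ (ℚₚ.*-zeroˡ (f Fin.zero)) (sumFin-δˡ m k (f ∘ Fin.suc))) (ℚₚ.+-identityˡ _)

∑-δ : ∀ m (k : Fin m) (f : Fin m → ℚ) → ∑ (allFin m) (λ j → Defs.[ toℕ k ≡ᵇ toℕ j ] * f j) ≡ f k
∑-δ m k f = ≡-trans (sym (sumFin-∑ m _)) (sumFin-δˡ m k f)

-- Adjacency and the Laplacian

match : ℕ → ℕ → ℕ × ℕ → Bool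
match i j (a , b) = ((a ≡ᵇ i) ∧ (b ≡ᵇ j)) ∨ ((a ≡ᵇ j) ∧ (b ≡ᵇ i))

any-cong : ∀ {p q : A → Bool} (xs : List A) → (∀ x → p x ≡ q x) → any p xs ≡ any q xs
any-cong [] eq = refl
any-cong (x ∷ xs) eq = cong₂ _∨_ (eq x) (any-cong xs eq)

adj-match : ∀ G i j → adj G i j ≡ not (toℕ i ≡ᵇ toℕ j) ∧ any (match (toℕ i) (toℕ j)) (E G)
adj-match G i j = cong (not (toℕ i ≡ᵇ toℕ j) ∧_) (any-cong (E G) λ { (a , b) → refl })

match-comm : ∀ i j e → match i j e ≡ match j i e
match-comm i j (a , b) = Boolₚ.∨-comm ((a ≡ᵇ i) ∧ (b ≡ᵇ j)) _

adj-sym : ∀ G i j → adj G i j ≡ adj G j i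
adj-sym G i j = ≡-trans (adj-match G i j) (≡-trans
  (cong₂ (λ x y → not x ∧ y) (≡ᵇ-comm (toℕ i) (toℕ j)) (any-cong (E G) (match-comm (toℕ i) (toℕ j))))
  (sym (adj-match G j i)))

laplacian-∑ : ∀ G x i → laplacian G x i ≡ ∑ (allFin (n G)) (λ j → Defs.[ adj G i j ] * (x i - x j))
laplacian-∑ G x i = ≡-trans (sumFin-cong (n G) λ j → if-Iverson (adj G i j) _) (sumFin-∑ (n G) _)

-- Adding the cross terms, weighted by adjacency, to either side leaves only degree terms, which are
-- visibly symmetric in `x` and `y`. The cross terms themselves agree by exchanging the sums and
-- using `adj-sym`.
laplacian-self-adjoint : ∀ G x y →
  ∑ (allFin (n G)) (λ i → y i * laplacian G x i) ≡ ∑ (allFin (n G)) (λ i → x i * laplacian G y i)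
laplacian-self-adjoint G x y = cancel _ _ _ _ (expand x y) (expand y x) swapped middle
  where
  vs = allFin (n G)
  a : Fin (n G) → Fin (n G) → ℚ
  a i j = Defs.[ adj G i j ]
  expand : ∀ x y → ∑ vs (λ i → y i * laplacian G x i) + ∑ vs (λ i → ∑ vs λ j → a i j * (y i * x j))
    ≡ ∑ vs (λ i → ∑ vs λ j → a i j * (y i * x i))
  expand x y = ≡-trans (sym (∑-+ vs (λ i → y i * laplacian G x i) (λ i → ∑ vs λ j → a i j * (y i * x j)))) (∑-cong vs λ i →
    ≡-trans (cong (λ z → y i * z + ∑ vs (λ j → a i j * (y i * x j))) (laplacian-∑ G x i))
    (≡-trans (cong (_+ ∑ vs (λ j → a i j * (y i * x j))) (sym (∑-*ˡ vs (y i) (λ j → a i j * (x i - x j)))))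
    (≡-trans (sym (∑-+ vs (λ j → y i * (a i j * (x i - x j))) (λ j → a i j * (y i * x j)))) (∑-cong vs λ j → ring (y i) (a i j) (x i) (x j)))))
    where
    ring : ∀ y a x x′ → y * (a * (x - x′)) + a * (y * x′) ≡ a * (y * x)
    ring = solve-∀ ℚ-ring
  swapped : ∑ vs (λ i → ∑ vs λ j → a i j * (y i * x j)) ≡ ∑ vs (λ i → ∑ vs λ j → a i j * (x i * y j))
  swapped = ≡-trans (∑-swap vs vs _) (∑-cong vs λ i → ∑-cong vs λ j →
    cong₂ _*_ (cong Defs.[_] (adj-sym G j i)) (ℚₚ.*-comm (y j) (x i)))
  middle : ∑ vs (λ i → ∑ vs λ j → a i j * (y i * x i)) ≡ ∑ vs (λ i → ∑ vs λ j → a i j * (x i * y i))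
  middle = ∑-cong vs λ i → ∑-cong vs λ j → cong (a i j *_) (ℚₚ.*-comm (y i) (x i))
  cancel : ∀ p q {p′ q′} r r′ → p + r ≡ p′ → q + r′ ≡ q′ → r ≡ r′ → p′ ≡ q′ → p ≡ q
  cancel p q r r′ e₁ e₂ refl e₄ = ≡-trans (sub p r) (≡-trans (cong (_- r) (≡-trans e₁ (≡-trans e₄ (sym e₂)))) (sym (sub q r)))
    where
    sub : ∀ p r → p ≡ (p + r) - r
    sub = solve-∀ ℚ-ring

-- Effective resistances and the Kirchhoff index

∑-dipole : ∀ {m} (u v : Fin m) (y : Fin m → ℚ) → ∑ (allFin m) (λ i → y i * (δ i u - δ i v)) ≡ y u - y v
∑-dipole {m} u v y = ≡-trans (∑-cong (allFin m) λ i → ≡-trans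
    (cong₂ (λ p q → y i * (Defs.[ p ] - Defs.[ q ])) (≡ᵇ-comm (toℕ i) (toℕ u)) (≡ᵇ-comm (toℕ i) (toℕ v)))
    (ring (y i) Defs.[ toℕ u ≡ᵇ toℕ i ] Defs.[ toℕ v ≡ᵇ toℕ i ]))
  (≡-trans (∑-+ (allFin m) (λ i → Defs.[ toℕ u ≡ᵇ toℕ i ] * y i) (λ i → Defs.[ toℕ v ≡ᵇ toℕ i ] * (- y i))) (cong₂ _+_ (∑-δ m u y) (≡-trans (∑-δ m v (-_ ∘ y)) refl)))
  where
  ring : ∀ y p q → y * (p - q) ≡ p * y + q * (- y)
  ring = solve-∀ ℚ-ring

-- Reciprocity: both sides are the energy pairing of the two potentials.
IsResistance-unique : ∀ G u v {r r′} → IsResistance G u v r → IsResistance G u v r′ → r ≡ r′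
IsResistance-unique G u v {r} {r′} (x , lx , rx) (y , ly , ry) = begin
  r                                                ≡⟨ rx ⟩
  x u - x v                                        ≡⟨ ∑-dipole u v x ⟨
  ∑ (allFin (n G)) (λ i → x i * (δ i u - δ i v))   ≡⟨ ∑-cong (allFin (n G)) (λ i → cong (x i *_) (ly i)) ⟨
  ∑ (allFin (n G)) (λ i → x i * laplacian G y i)   ≡⟨ laplacian-self-adjoint G y x ⟩
  ∑ (allFin (n G)) (λ i → y i * laplacian G x i)   ≡⟨ ∑-cong (allFin (n G)) (λ i → cong (y i *_) (lx i)) ⟩
  ∑ (allFin (n G)) (λ i → y i * (δ i u - δ i v))   ≡⟨ ∑-dipole u v y ⟩
  y u - y v                                        ≡⟨ ry ⟨
  r′                                               ∎
  where open ≡-Reasoning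

IsResistance-sym : ∀ G u v {r} → IsResistance G u v r → IsResistance G v u r
IsResistance-sym G u v {r} (x , lx , rx) = (-_ ∘ x) , lap , ≡-trans rx (ring₁ (x u) (x v))
  where
  ring₁ : ∀ a b → a - b ≡ - b - - a
  ring₁ = solve-∀ ℚ-ring
  ring₂ : ∀ p a b → p * (- a - - b) ≡ (- 1ℚ) * (p * (a - b))
  ring₂ = solve-∀ ℚ-ring
  ring₃ : ∀ a b → (- 1ℚ) * (a - b) ≡ b - a
  ring₃ = solve-∀ ℚ-ring
  lap : ∀ i → laplacian G (-_ ∘ x) i ≡ δ i v - δ i u
  lap i = ≡-trans (laplacian-∑ G (-_ ∘ x) i) (≡-trans
    (∑-cong (allFin (n G)) λ j → ring₂ Defs.[ adj G i j ] (x i) (x j))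
    (≡-trans (∑-*ˡ (allFin (n G)) (- 1ℚ) (λ j → Defs.[ adj G i j ] * (x i - x j))) (≡-trans
      (cong ((- 1ℚ) *_) (≡-trans (sym (laplacian-∑ G x i)) (lx i))) (ring₃ (δ i u) (δ i v)))))

IsResistance-diag : ∀ G u {r} → IsResistance G u u r → r ≡ 0ℚ
IsResistance-diag G u (x , lx , rx) = ≡-trans rx (ℚₚ.+-inverseʳ (x u))

unique-∈ : ∀ {x : A} {xs} → Unique xs → (p q : x ∈ xs) → p ≡ q
unique-∈ u (here refl) (here refl) = refl
unique-∈ (a ∷ u) (here refl) (there q) = ⊥-elim (L.lookup a q refl)
unique-∈ (a ∷ u) (there p) (here refl) = ⊥-elim (L.lookup a p refl)
unique-∈ (a ∷ u) (there p) (there q) = cong there (unique-∈ u p q)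

-- Both lists are duplicate-free and contain every element, so each membership type has exactly one
-- proof. Equality as bags is then immediate, and bag equality yields a permutation.
↔-allFin : ∀ {m m′} (f : Fin m ↔ Fin m′) → map (Inverse.to f) (allFin m) ↭ allFin m′
↔-allFin {m} {m′} f = ∼bag⇒↭ λ {j} → mk↔ₛ′
    (λ _ → ∈-allFin j) (λ _ → subst (_∈ map to (allFin m)) (strictlyInverseˡ j) (∈-map⁺ to (∈-allFin (from j))))
    (λ p → unique-∈ (Uniqueₚ.allFin⁺ m′) _ p)
    (λ p → unique-∈ (Uniqueₚ.map⁺ to-injective (Uniqueₚ.allFin⁺ m)) _ p)
  where
  open Inverse f using (to; from; strictlyInverseˡ; strictlyInverseʳ)
  to-injective : ∀ {i j} → to i ≡ to j → i ≡ j
  to-injective {i} {j} eq = ≡-trans (sym (strictlyInverseʳ i)) (≡-trans (cong from eq) (strictlyInverseʳ j))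

IsResistance-≅ : ∀ G H ((f , _) : G ≅ H) u v {r} →
  IsResistance H (Inverse.to f u) (Inverse.to f v) r → IsResistance G u v r
IsResistance-≅ G H (f , adj≡) u v (x , lx , rx) = x ∘ to , lap , rx
  where
  open Inverse f using (to; from; strictlyInverseˡ; strictlyInverseʳ)
  all-↭ : map to (allFin (n G)) ↭ allFin (n H)
  all-↭ = ↔-allFin f
  δ-to : ∀ i k → δ (to i) (to k) ≡ δ i k
  δ-to i k with toℕ i ≡ᵇ toℕ k in e
  ... | true = cong Defs.[_] (≡-trans (cong (λ z → toℕ (to z) ≡ᵇ toℕ (to k)) (Finₚ.toℕ-injective (≡ᵇ⇒≡ _ _ e))) (≡ᵇ-refl (toℕ (to k))))
  ... | false with toℕ (to i) ≡ᵇ toℕ (to k) in e′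
  ...   | false = refl
  ...   | true = ⊥-elim (true≢false (≡-trans (sym (≡-trans (cong (λ z → toℕ z ≡ᵇ toℕ k) i≡k) (≡ᵇ-refl (toℕ k)))) e))
    where
    true≢false : true ≡ false → ⊥
    true≢false ()
    i≡k : i ≡ k
    i≡k = ≡-trans (sym (strictlyInverseʳ i)) (≡-trans (cong from (Finₚ.toℕ-injective (≡ᵇ⇒≡ _ _ e′))) (strictlyInverseʳ k))
  lap : ∀ i → laplacian G (x ∘ to) i ≡ δ i u - δ i v
  lap i = begin
    laplacian G (x ∘ to) i
      ≡⟨ laplacian-∑ G (x ∘ to) i ⟩
    ∑ (allFin (n G)) (λ j → Defs.[ adj G i j ] * (x (to i) - x (to j)))
      ≡⟨ ∑-cong (allFin (n G)) (λ j → cong (λ z → Defs.[ z ] * _) (adj≡ i j)) ⟩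
    ∑ (allFin (n G)) (λ j → Defs.[ adj H (to i) (to j) ] * (x (to i) - x (to j)))
      ≡⟨ ∑-map to (allFin (n G)) _ ⟨
    ∑ (map to (allFin (n G))) (λ j → Defs.[ adj H (to i) j ] * (x (to i) - x j))
      ≡⟨ ∑-↭ _ all-↭ ⟩
    ∑ (allFin (n H)) (λ j → Defs.[ adj H (to i) j ] * (x (to i) - x j))
      ≡⟨ laplacian-∑ H x (to i) ⟨
    laplacian H x (to i)
      ≡⟨ lx (to i) ⟩
    δ (to i) (to u) - δ (to i) (to v)
      ≡⟨ cong₂ _-_ (δ-to i u) (δ-to i v) ⟩
    δ i u - δ i v ∎
    where open ≡-Reasoning

IsResistances : ∀ G → (Fin (n G) → Fin (n G) → ℚ) → Set
IsResistances G Ω = ∀ u v → IsResistance G u v (Ω u v)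

-- Summing over ordered pairs makes the index invariant under relabelling.
double-∑ : ∀ G {Ω} → IsResistances G Ω → let vs = allFin (n G) in
  let K = sumFin (n G) (λ u → sumFin (n G) (λ v → if toℕ u <ᵇ toℕ v then Ω u v else 0ℚ)) in
  K + K ≡ ∑ vs (λ u → ∑ vs (Ω u))
double-∑ G {Ω} res = begin
  K + K
    ≡⟨ cong₂ _+_ (sumFin²-∑ (n G) half) (≡-trans (sumFin²-∑ (n G) half) (∑-swap vs vs half)) ⟩
  ∑ vs (λ u → ∑ vs (half u)) + ∑ vs (λ u → ∑ vs (λ v → half v u))
    ≡⟨ ∑-+ vs (λ u → ∑ vs (half u)) (λ u → ∑ vs (λ v → half v u)) ⟨
  ∑ vs (λ u → ∑ vs (half u) + ∑ vs (λ v → half v u))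
    ≡⟨ ∑-cong vs (λ u → ≡-trans (sym (∑-+ vs (half u) (λ v → half v u))) (∑-cong vs (halves u))) ⟩
  ∑ vs (λ u → ∑ vs (Ω u)) ∎
  where
  open ≡-Reasoning
  vs = allFin (n G)
  half : Fin (n G) → Fin (n G) → ℚ
  half u v = if toℕ u <ᵇ toℕ v then Ω u v else 0ℚ
  K = sumFin (n G) (λ u → sumFin (n G) (half u))
  trichotomy : ∀ a b x y → (a ≡ b → x ≡ 0ℚ) → x ≡ y →
    (if a <ᵇ b then x else 0ℚ) + (if b <ᵇ a then y else 0ℚ) ≡ x
  trichotomy zero zero x y d e = sym (d refl)
  trichotomy zero (suc b) x y d e = ℚₚ.+-identityʳ x
  trichotomy (suc a) zero x y d e = ≡-trans (ℚₚ.+-identityˡ y) (sym e)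
  trichotomy (suc a) (suc b) x y d e = trichotomy a b x y (d ∘ cong suc) e
  halves : ∀ u v → half u v + half v u ≡ Ω u v
  halves u v = trichotomy (toℕ u) (toℕ v) (Ω u v) (Ω v u)
    (λ eq → IsResistance-diag G u (subst (λ z → IsResistance G u z (Ω u v)) (sym (Finₚ.toℕ-injective eq)) (res u v)))
    (IsResistance-unique G u v (res u v) (IsResistance-sym G v u (res v u)))

IsKirchhoff-intro : ∀ G {Ω} → IsResistances G Ω → ∀ K →
  K + K ≡ ∑ (allFin (n G)) (λ u → ∑ (allFin (n G)) (Ω u)) → IsKirchhoff G K
IsKirchhoff-intro G {Ω} res K eq = Ω , res , +-self-injective (≡-trans eq (sym (double-∑ G res)))

IsKirchhoff-elim : ∀ G {K} ((Ω , res , _) : IsKirchhoff G K) →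
  K + K ≡ ∑ (allFin (n G)) (λ u → ∑ (allFin (n G)) (Ω u))
IsKirchhoff-elim G (Ω , res , refl) = double-∑ G res

IsKirchhoff-unique : ∀ G {K K′} → IsKirchhoff G K → IsKirchhoff G K′ → K ≡ K′
IsKirchhoff-unique G k@(Ω , res , _) k′@(Ω′ , res′ , _) = +-self-injective (≡-trans (IsKirchhoff-elim G k) (≡-trans
  (∑-cong (allFin (n G)) λ u → ∑-cong (allFin (n G)) λ v → IsResistance-unique G u v (res u v) (res′ u v))
  (sym (IsKirchhoff-elim G k′))))

IsKirchhoff-≅ : ∀ G H → G ≅ H → ∀ {K} → IsKirchhoff H K → IsKirchhoff G K
IsKirchhoff-≅ G H iso@(f , _) {K} k@(Ω , res , _) =
  IsKirchhoff-intro G {λ u v → Ω (to u) (to v)} (λ u v → IsResistance-≅ G H iso u v (res (to u) (to v))) K (begin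
  K + K
    ≡⟨ IsKirchhoff-elim H k ⟩
  ∑ (allFin (n H)) (λ u → ∑ (allFin (n H)) (Ω u))
    ≡⟨ reindex (λ u → ∑ (allFin (n H)) (Ω u)) ⟩
  ∑ (allFin (n G)) (λ u → ∑ (allFin (n H)) (Ω (to u)))
    ≡⟨ ∑-cong (allFin (n G)) (λ u → reindex (Ω (to u))) ⟩
  ∑ (allFin (n G)) (λ u → ∑ (allFin (n G)) (λ v → Ω (to u) (to v))) ∎)
  where
  open ≡-Reasoning
  open Inverse f using (to)
  reindex : ∀ h → ∑ (allFin (n H)) h ≡ ∑ (allFin (n G)) (h ∘ to)
  reindex h = ≡-trans (sym (∑-↭ h (↔-allFin f))) (∑-map to (allFin (n G)) h)

≅-trans : ∀ G H I → G ≅ H → H ≅ I → G ≅ I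
≅-trans G H I (f , p) (h , q) = h ↔-∘ f , λ i j → ≡-trans (p i j) (q _ _)

-- Combinatorial models of a graph

infix 4 _∉₂_
_∉₂_ : A → A × A → Set
x ∉₂ (a , b) = x ≢ a × x ≢ b

-- Certifies that two edges differ as unordered pairs by naming an endpoint of the first that the
-- second misses. Such a certificate usually reduces to a clash of constructors.
Apart : A × A → A × A → Set
Apart (a , b) e = (a ∉₂ e) ⊎ (b ∉₂ e)

both : (A → A′) → A × A → A′ × A′
both f (a , b) = f a , f b

Disjoint : ℕ × ℕ → ℕ × ℕ → Set
Disjoint e e′ = ∀ i j → match i j e ≡ true → match i j e′ ≡ false

∧-true : ∀ {p q} → p ∧ q ≡ true → p ≡ true × q ≡ true
∧-true {true} {true} refl = refl , refl

match-true : ∀ i j a b → match i j (a , b) ≡ true → (a ≡ i × b ≡ j) ⊎ (a ≡ j × b ≡ i)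
match-true i j a b eq with (a ≡ᵇ i) ∧ (b ≡ᵇ j) in e
... | true = let p , q = ∧-true e in inj₁ (≡ᵇ⇒≡ a i p , ≡ᵇ⇒≡ b j q)
... | false = let p , q = ∧-true eq in inj₂ (≡ᵇ⇒≡ a j p , ≡ᵇ⇒≡ b i q)

Apart⇒Disjoint : ∀ e e′ → Apart e e′ → Disjoint e e′
Apart⇒Disjoint (a , b) (c , d) ap i j m with match i j (c , d) in m′
... | false = refl
... | true = ⊥-elim (clash ap (match-true i j a b m) (match-true i j c d m′))
  where
  clash : Apart (a , b) (c , d) → (a ≡ i × b ≡ j) ⊎ (a ≡ j × b ≡ i) → (c ≡ i × d ≡ j) ⊎ (c ≡ j × d ≡ i) → ⊥
  clash (inj₁ (x , y)) (inj₁ (refl , refl)) (inj₁ (p , q)) = x (sym p)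
  clash (inj₁ (x , y)) (inj₁ (refl , refl)) (inj₂ (p , q)) = y (sym q)
  clash (inj₁ (x , y)) (inj₂ (refl , refl)) (inj₁ (p , q)) = y (sym q)
  clash (inj₁ (x , y)) (inj₂ (refl , refl)) (inj₂ (p , q)) = x (sym p)
  clash (inj₂ (x , y)) (inj₁ (refl , refl)) (inj₁ (p , q)) = y (sym q)
  clash (inj₂ (x , y)) (inj₁ (refl , refl)) (inj₂ (p , q)) = x (sym p)
  clash (inj₂ (x , y)) (inj₂ (refl , refl)) (inj₁ (p , q)) = x (sym p)
  clash (inj₂ (x , y)) (inj₂ (refl , refl)) (inj₂ (p , q)) = y (sym q)

-- `any` collapses repeated edges whereas a sum counts them. With pairwise distinct edges at most
-- one can match, so the disjunction becomes a sum that can be exchanged with other sums.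
any-count : ∀ es → AllPairs Disjoint es → ∀ i j → Defs.[ any (match i j) es ] ≡ ∑ es (λ e → Defs.[ match i j e ])
any-count [] [] i j = refl
any-count (e ∷ es) (d ∷ ds) i j with match i j e in m
... | true = sym (cong (1ℚ +_) (rest es d))
  where
  rest : ∀ es → L.All (Disjoint e) es → ∑ es (λ e → Defs.[ match i j e ]) ≡ 0ℚ
  rest [] [] = refl
  rest (e′ ∷ es) (d ∷ ds) = cong₂ (λ p q → Defs.[ p ] + q) (d i j m) (rest es ds)
... | false = ≡-trans (any-count es ds i j) (sym (ℚₚ.+-identityˡ (∑ es (λ e → Defs.[ match i j e ]))))

any-↭ : ∀ (p : A → Bool) {xs ys} → xs ↭ ys → any p xs ≡ any p ys
any-↭ p refl = refl
any-↭ p (prep x q) = cong (p x ∨_) (any-↭ p q)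
any-↭ p {_ ∷ _ ∷ xs} (swap x y q) = ≡-trans (sym (Boolₚ.∨-assoc (p x) (p y) (any p xs)))
  (≡-trans (cong₂ _∨_ (Boolₚ.∨-comm (p x) (p y)) (any-↭ p q)) (Boolₚ.∨-assoc (p y) (p x) _))
any-↭ p (trans q r) = ≡-trans (any-↭ p q) (any-↭ p r)

≡ᵇ-cong : ∀ {a b c d} → (a ≡ b → c ≡ d) → (c ≡ d → a ≡ b) → (a ≡ᵇ b) ≡ (c ≡ᵇ d)
≡ᵇ-cong {a} {b} {c} {d} f g with a ≡ᵇ b in p | c ≡ᵇ d in q
... | true | true = refl
... | false | false = refl
... | true | false with refl ← f (≡ᵇ⇒≡ a b p) = ≡-trans (sym (≡ᵇ-refl c)) q
... | false | true with refl ← g (≡ᵇ⇒≡ c d q) = ≡-trans (sym p) (≡ᵇ-refl a)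

map-injective-on : ∀ (f : A → A′) {xs} → Unique (map f xs) → ∀ {x y} → x ∈ xs → y ∈ xs → f x ≡ f y → x ≡ y
map-injective-on f u (here refl) (here refl) eq = refl
map-injective-on f (a ∷ u) (here refl) (there q) eq = ⊥-elim (L.lookup a (∈-map⁺ f q) eq)
map-injective-on f (a ∷ u) (there p) (here refl) eq = ⊥-elim (L.lookup a (∈-map⁺ f p) (sym eq))
map-injective-on f (a ∷ u) (there p) (there q) eq = map-injective-on f u p q eq

AllPairs-resp-↭ : ∀ {R : A → A → Set} → (∀ {x y} → R x y → R y x) → ∀ {xs ys} → xs ↭ ys → AllPairs R xs → AllPairs R ys
AllPairs-resp-↭ s refl r = r
AllPairs-resp-↭ s (prep x p) (r ∷ rs) = ↭ₚ.All-resp-↭ p r ∷ AllPairs-resp-↭ s p rs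
AllPairs-resp-↭ s (swap x y p) ((r ∷ rs) ∷ (t ∷ ts)) =
  (s r ∷ ↭ₚ.All-resp-↭ p t) ∷ ↭ₚ.All-resp-↭ p rs ∷ AllPairs-resp-↭ s p ts
AllPairs-resp-↭ s (trans p q) r = AllPairs-resp-↭ s q (AllPairs-resp-↭ s p r)

tabulate-toℕ : ∀ m (f : ℕ → ℕ) → tabulate {n = m} (f ∘ toℕ) ≡ Data.List.applyUpTo f m
tabulate-toℕ zero f = refl
tabulate-toℕ (suc m) f = cong (f 0 ∷_) (tabulate-toℕ m (f ∘ suc))

-- The Dirichlet form of the graph. Laplace equations are stated weakly, as identities in the test
-- function `y`; sums over edges split along a chain, whereas neighbourhoods of rung vertices
-- straddle two polygons.
energy : List (A × A) → (A → ℚ) → (A → ℚ) → ℚ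
energy es x y = ∑ es λ e → (x (proj₁ e) - x (proj₂ e)) * (y (proj₁ e) - y (proj₂ e))

-- Separates the shape of a graph from the numbering of its vertices. All electrical arguments run
-- on `Vertex`; the labels enter only through two permutations and through injectivity, which
-- follows from the first of them.
record Model (G : Graph) : Set₁ where
  field
    Vertex : Set
    vertices : List Vertex
    edges : List (Vertex × Vertex)
    label : Vertex → ℕ
    complete : ∀ v → v ∈ vertices
    vertices-↭ : map label vertices ↭ upTo (n G)
    edges-↭ : map (both label) edges ↭ E G
    edges-apart : AllPairs Apart edges

  label-injective : ∀ {u v} → label u ≡ label v → u ≡ v
  label-injective {u} {v} = map-injective-on label
    (AllPairs-resp-↭ (λ ne → ne ∘ sym) (↭-sym vertices-↭) (Uniqueₚ.upTo⁺ (n G))) (complete u) (complete v)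

  index : Vertex → Fin (n G)
  index v = fromℕ< (∈-upTo⁻ (↭ₚ.∈-resp-↭ vertices-↭ (∈-map⁺ label (complete v))))

  toℕ-index : ∀ v → toℕ (index v) ≡ label v
  toℕ-index v = Finₚ.toℕ-fromℕ< _

  preimage : ∀ i → ∃ λ v → v ∈ vertices × toℕ {n G} i ≡ label v
  preimage i = ∈-map⁻ label (↭ₚ.∈-resp-↭ (↭-sym vertices-↭) (∈-upTo⁺ (Finₚ.toℕ<n i)))

  vertex : Fin (n G) → Vertex
  vertex i = proj₁ (preimage i)

  label-vertex : ∀ i → label (vertex i) ≡ toℕ i
  label-vertex i = sym (proj₂ (proj₂ (preimage i)))

  vertex-index : ∀ v → vertex (index v) ≡ v
  vertex-index v = label-injective (≡-trans (label-vertex (index v)) (toℕ-index v))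

  index-vertex : ∀ i → index (vertex i) ≡ i
  index-vertex i = Finₚ.toℕ-injective (≡-trans (toℕ-index (vertex i)) (label-vertex i))

  index-↭ : map index vertices ↭ allFin (n G)
  index-↭ with ys , eq , p ← ↭ₚ.↭-map-inv toℕ
      (subst₂ _↭_ (≡-trans (Listₚ.map-cong (λ v → sym (toℕ-index v)) vertices) (Listₚ.map-∘ vertices))
        (sym (≡-trans (Listₚ.map-tabulate id toℕ) (tabulate-toℕ (n G) id))) vertices-↭) =
    subst (map index vertices ↭_) (sym (Listₚ.map-injective Finₚ.toℕ-injective eq)) p

  ∑-index : ∀ f → ∑ (allFin (n G)) f ≡ ∑ vertices (f ∘ index)
  ∑-index f = ≡-trans (sym (∑-↭ f index-↭)) (∑-map index vertices f)

  ∑-vertex : ∀ f → ∑ (allFin (n G)) (f ∘ vertex) ≡ ∑ vertices f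
  ∑-vertex f = ≡-trans (∑-index (f ∘ vertex)) (∑-cong vertices λ v → cong f (vertex-index v))

  any-edges : ∀ i j → Defs.[ any (match i j) (E G) ] ≡ ∑ edges (λ e → Defs.[ match i j (both label e) ])
  any-edges i j = ≡-trans (cong Defs.[_] (any-↭ (match i j) (↭-sym edges-↭)))
    (≡-trans (any-count (map (both label) edges) (APₚ.map⁺ (AP.map disjoint edges-apart)) i j)
      (∑-map (both label) edges (λ e → Defs.[ match i j e ])))
    where
    disjoint : ∀ {e e′} → Apart e e′ → Disjoint (both label e) (both label e′)
    disjoint {e} {e′} (inj₁ (p , q)) = Apart⇒Disjoint (both label e) (both label e′) (inj₁ (p ∘ label-injective , q ∘ label-injective))
    disjoint {e} {e′} (inj₂ (p , q)) = Apart⇒Disjoint (both label e) (both label e′) (inj₂ (p ∘ label-injective , q ∘ label-injective))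

  indicator : Vertex → Fin (n G) → ℚ
  indicator a k = Defs.[ label a ≡ᵇ toℕ k ]

  indicator-δ : ∀ a k → indicator a k ≡ δ k (index a)
  indicator-δ a k = cong Defs.[_] (≡-trans (≡ᵇ-comm (label a) (toℕ k)) (cong (toℕ k ≡ᵇ_) (sym (toℕ-index a))))

  laplacian-energy : ∀ x k → laplacian G (x ∘ vertex) k ≡ energy edges x (λ a → indicator a k)
  laplacian-energy x k = begin
    laplacian G (x ∘ vertex) k
      ≡⟨ laplacian-∑ G (x ∘ vertex) k ⟩
    ∑ (allFin (n G)) (λ j → Defs.[ adj G k j ] * (X k - X j))
      ≡⟨ ∑-cong (allFin (n G)) count ⟩
    ∑ (allFin (n G)) (λ j → ∑ edges (λ e → Defs.[ match (toℕ k) (toℕ j) (both label e) ] * (X k - X j)))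
      ≡⟨ ∑-swap (allFin (n G)) edges (λ j e → Defs.[ match (toℕ k) (toℕ j) (both label e) ] * (X k - X j)) ⟩
    ∑ edges (λ e → ∑ (allFin (n G)) (λ j → Defs.[ match (toℕ k) (toℕ j) (both label e) ] * (X k - X j)))
      ≡⟨ ∑-cong edges (λ (a , b) → sift a b) ⟩
    energy edges x (λ a → indicator a k) ∎
    where
    open ≡-Reasoning
    X : Fin (n G) → ℚ
    X = x ∘ vertex
    -- On the diagonal the difference of potentials is zero, so any coefficient may stand before it.
    -- This reconciles `adj`, which excludes loops, with the plain sum over edges.
    X-diff : ∀ j → toℕ k ≡ toℕ j → ∀ p q → p * (X k - X j) ≡ q * (X k - X j)
    X-diff j eq p q with refl ← Finₚ.toℕ-injective eq = zero-diff p q (X k)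
      where
      zero-diff : ∀ p q a → p * (a - a) ≡ q * (a - a)
      zero-diff = solve-∀ ℚ-ring
    count : ∀ j → Defs.[ adj G k j ] * (X k - X j) ≡ ∑ edges (λ e → Defs.[ match (toℕ k) (toℕ j) (both label e) ] * (X k - X j))
    count j = ≡-trans (step (toℕ k ≡ᵇ toℕ j) refl) (≡-trans (ℚₚ.*-comm s (X k - X j))
      (≡-trans (sym (∑-*ˡ edges (X k - X j) (λ e → Defs.[ match (toℕ k) (toℕ j) (both label e) ])))
        (∑-cong edges λ e → ℚₚ.*-comm (X k - X j) Defs.[ match (toℕ k) (toℕ j) (both label e) ])))
      where
      s = ∑ edges (λ e → Defs.[ match (toℕ k) (toℕ j) (both label e) ])
      step : ∀ p → (toℕ k ≡ᵇ toℕ j) ≡ p → Defs.[ adj G k j ] * (X k - X j) ≡ s * (X k - X j)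
      step true eq = X-diff j (≡ᵇ⇒≡ _ _ eq) Defs.[ adj G k j ] s
      step false eq = cong (_* (X k - X j)) (≡-trans (cong Defs.[_] (≡-trans (adj-match G k j)
        (cong (λ p → not p ∧ any (match (toℕ k) (toℕ j)) (E G)) eq))) (any-edges (toℕ k) (toℕ j)))
    at : ∀ a → indicator a k * X k ≡ indicator a k * x a
    at a with label a ≡ᵇ toℕ k in eq
    ... | true = cong (λ v → 1ℚ * x v) (label-injective (≡-trans (label-vertex k) (sym (≡ᵇ⇒≡ _ _ eq))))
    ... | false = ≡-trans (ℚₚ.*-zeroˡ (X k)) (sym (ℚₚ.*-zeroˡ (x a)))
    split : ∀ a b j → Defs.[ match (toℕ k) (toℕ j) (label a , label b) ] * (X k - X j)
      ≡ Defs.[ label b ≡ᵇ toℕ j ] * (indicator a k * (X k - X j)) + Defs.[ label a ≡ᵇ toℕ j ] * (indicator b k * (X k - X j))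
    split a b j with label a ≡ᵇ toℕ k in ak | label b ≡ᵇ toℕ j in bj | label a ≡ᵇ toℕ j in aj | label b ≡ᵇ toℕ k in bk
    -- Both orientations match at once only if k = j. The right side then counts the edge twice,
    -- harmlessly, because the factor vanishes.
    ... | true | true | true | true = ≡-trans (X-diff j (≡-trans (sym (≡ᵇ⇒≡ (label a) _ ak)) (≡ᵇ⇒≡ (label a) _ aj)) 1ℚ (1ℚ + 1ℚ)) (ring (X k - X j))
      where
      ring : ∀ z → (1ℚ + 1ℚ) * z ≡ 1ℚ * (1ℚ * z) + 1ℚ * (1ℚ * z)
      ring = solve-∀ ℚ-ring
    ... | true | true | false | q = ring (X k - X j) Defs.[ q ]
      where
      ring : ∀ z q → 1ℚ * z ≡ 1ℚ * (1ℚ * z) + 0ℚ * (q * z)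
      ring = solve-∀ ℚ-ring
    ... | true | true | true | false = ring (X k - X j)
      where
      ring : ∀ z → 1ℚ * z ≡ 1ℚ * (1ℚ * z) + 1ℚ * (0ℚ * z)
      ring = solve-∀ ℚ-ring
    ... | true | false | p | q = ≡-trans (cong (_* (X k - X j)) (Iverson-∧ p q)) (ring (X k - X j) Defs.[ p ] Defs.[ q ])
      where
      ring : ∀ z p q → p * q * z ≡ 0ℚ * (1ℚ * z) + p * (q * z)
      ring = solve-∀ ℚ-ring
    ... | false | r | p | q = ≡-trans (cong (_* (X k - X j)) (Iverson-∧ p q)) (ring (X k - X j) Defs.[ p ] Defs.[ q ] Defs.[ r ])
      where
      ring : ∀ z p q r → p * q * z ≡ r * (0ℚ * z) + p * (q * z)
      ring = solve-∀ ℚ-ring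
    pick : ∀ a (f : Fin (n G) → ℚ) → ∑ (allFin (n G)) (λ j → Defs.[ label a ≡ᵇ toℕ j ] * f j) ≡ f (index a)
    pick a f = ≡-trans (∑-cong (allFin (n G)) λ j → cong (λ z → Defs.[ z ≡ᵇ toℕ j ] * f j) (sym (toℕ-index a)))
      (∑-δ (n G) (index a) f)
    sift : ∀ a b → ∑ (allFin (n G)) (λ j → Defs.[ match (toℕ k) (toℕ j) (label a , label b) ] * (X k - X j))
      ≡ (x a - x b) * (indicator a k - indicator b k)
    sift a b = begin
      ∑ (allFin (n G)) (λ j → Defs.[ match (toℕ k) (toℕ j) (label a , label b) ] * (X k - X j))
        ≡⟨ ∑-cong (allFin (n G)) (split a b) ⟩
      ∑ (allFin (n G)) (λ j → Defs.[ label b ≡ᵇ toℕ j ] * (ia * (X k - X j)) + Defs.[ label a ≡ᵇ toℕ j ] * (ib * (X k - X j)))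
        ≡⟨ ∑-+ (allFin (n G)) (λ j → Defs.[ label b ≡ᵇ toℕ j ] * (ia * (X k - X j))) (λ j → Defs.[ label a ≡ᵇ toℕ j ] * (ib * (X k - X j))) ⟩
      ∑ (allFin (n G)) (λ j → Defs.[ label b ≡ᵇ toℕ j ] * (ia * (X k - X j))) + ∑ (allFin (n G)) (λ j → Defs.[ label a ≡ᵇ toℕ j ] * (ib * (X k - X j)))
        ≡⟨ cong₂ _+_ (pick b (λ j → ia * (X k - X j))) (pick a (λ j → ib * (X k - X j))) ⟩
      ia * (X k - X (index b)) + ib * (X k - X (index a))
        ≡⟨ cong₂ (λ v w → ia * (X k - x v) + ib * (X k - x w)) (vertex-index b) (vertex-index a) ⟩
      ia * (X k - x b) + ib * (X k - x a)
        ≡⟨ ring₁ ia ib (X k) (x a) (x b) ⟩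
      ia * X k + ib * X k - (ia * x b + ib * x a)
        ≡⟨ cong₂ (λ p q → p + q - (ia * x b + ib * x a)) (at a) (at b) ⟩
      ia * x a + ib * x b - (ia * x b + ib * x a)
        ≡⟨ ring₂ ia ib (x a) (x b) ⟩
      (x a - x b) * (ia - ib) ∎
      where
      ia = indicator a k
      ib = indicator b k
      ring₁ : ∀ i j z a b → i * (z - b) + j * (z - a) ≡ i * z + j * z - (i * b + j * a)
      ring₁ = solve-∀ ℚ-ring
      ring₂ : ∀ i j a b → i * a + j * b - (i * b + j * a) ≡ (a - b) * (i - j)
      ring₂ = solve-∀ ℚ-ring

energy-- : ∀ (es : List (A × A)) (x x′ y : A → ℚ) → energy es (λ a → x a - x′ a) y ≡ energy es x y - energy es x′ y
energy-- [] x x′ y = refl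
energy-- ((a , b) ∷ es) x x′ y = ≡-trans (cong (((x a - x′ a) - (x b - x′ b)) * (y a - y b) +_) (energy-- es x x′ y))
  (ring (x a) (x′ a) (x b) (x′ b) (y a - y b) (energy es x y) (energy es x′ y))
  where
  ring : ∀ p p′ q q′ z e e′ → ((p - p′) - (q - q′)) * z + (e - e′) ≡ ((p - q) * z + e) - ((p′ - q′) * z + e′)
  ring = solve-∀ ℚ-ring

-- The columns of a Green's function all balance the same background charge ν, so that differences of
-- columns are dipole potentials.
module Green {G : Graph} (M : Model G) (Γ : Model.Vertex M → Model.Vertex M → ℚ) (ν : (Model.Vertex M → ℚ) → ℚ)
  (green : ∀ u y → energy (Model.edges M) (Γ u) y ≡ y u - ν y) where
  open Model M

  Ω : Fin (n G) → Fin (n G) → ℚ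
  Ω i j = (Γ (vertex i) (vertex i) - Γ (vertex j) (vertex i)) - (Γ (vertex i) (vertex j) - Γ (vertex j) (vertex j))

  resistances : IsResistances G Ω
  resistances i j = x ∘ vertex , lap , refl
    where
    x : Vertex → ℚ
    x v = Γ (vertex i) v - Γ (vertex j) v
    lap : ∀ k → laplacian G (x ∘ vertex) k ≡ δ k i - δ k j
    lap k = begin
      laplacian G (x ∘ vertex) k                  ≡⟨ laplacian-energy x k ⟩
      energy edges x y                            ≡⟨ energy-- edges (Γ (vertex i)) (Γ (vertex j)) y ⟩
      energy edges (Γ (vertex i)) y - energy edges (Γ (vertex j)) y
        ≡⟨ cong₂ _-_ (green (vertex i) y) (green (vertex j) y) ⟩
      (y (vertex i) - ν y) - (y (vertex j) - ν y) ≡⟨ ring (y (vertex i)) (y (vertex j)) (ν y) ⟩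
      y (vertex i) - y (vertex j)                 ≡⟨ cong₂ _-_ (at i) (at j) ⟩
      δ k i - δ k j ∎
      where
      open ≡-Reasoning
      y : Vertex → ℚ
      y a = indicator a k
      at : ∀ i → y (vertex i) ≡ δ k i
      at i = ≡-trans (indicator-δ (vertex i) k) (cong (δ k) (index-vertex i))
      ring : ∀ a b c → (a - c) - (b - c) ≡ a - b
      ring = solve-∀ ℚ-ring

  -- Each resistance is a sum of two diagonal entries of `Γ` minus two off-diagonal ones. Over
  -- ordered pairs, both diagonal terms sum to N times the trace and, after exchanging sums, both
  -- off-diagonal terms sum to the total of `Γ`; this is twice the claimed value.
  kirchhoff : IsKirchhoff G (∑ vertices (λ _ → 1ℚ) * ∑ vertices (λ u → Γ u u) - ∑ vertices (λ u → ∑ vertices (Γ u)))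
  kirchhoff = IsKirchhoff-intro G resistances _ (sym (begin
    ∑ (allFin (n G)) (λ i → ∑ (allFin (n G)) (Ω i))
      ≡⟨ ∑-vertex (λ u → ∑ (allFin (n G)) (λ j → ω u (vertex j))) ⟩
    ∑ vs (λ u → ∑ (allFin (n G)) (λ j → ω u (vertex j)))
      ≡⟨ ∑-cong vs (λ u → ∑-vertex (ω u)) ⟩
    ∑ vs (λ u → ∑ vs (ω u))
      ≡⟨ ∑-cong vs (λ u → row u) ⟩
    ∑ vs (λ u → (Γ u u * N + T) + (- 1ℚ) * (∑ vs (Γ u) + ∑ vs (λ v → Γ v u)))
      ≡⟨ ∑-+ vs (λ u → Γ u u * N + T) (λ u → (- 1ℚ) * (∑ vs (Γ u) + ∑ vs (λ v → Γ v u))) ⟩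
    ∑ vs (λ u → Γ u u * N + T) + ∑ vs (λ u → (- 1ℚ) * (∑ vs (Γ u) + ∑ vs (λ v → Γ v u)))
      ≡⟨ cong₂ _+_ left right ⟩
    (N * T + T * N) + (- 1ℚ) * (X + X)
      ≡⟨ ring₂ N T X ⟩
    (N * T - X) + (N * T - X) ∎))
    where
    open ≡-Reasoning
    vs = vertices
    ω : Vertex → Vertex → ℚ
    ω u v = (Γ u u - Γ v u) - (Γ u v - Γ v v)
    N = ∑ vs (λ _ → 1ℚ)
    T = ∑ vs (λ u → Γ u u)
    X = ∑ vs (λ u → ∑ vs (Γ u))
    ring₁ : ∀ a b c d → (a - b) - (c - d) ≡ (a * 1ℚ + d) + (- 1ℚ) * (c + b)
    ring₁ = solve-∀ ℚ-ring
    ring₂ : ∀ N T X → (N * T + T * N) + (- 1ℚ) * (X + X) ≡ (N * T - X) + (N * T - X)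
    ring₂ = solve-∀ ℚ-ring
    row : ∀ u → ∑ vs (ω u) ≡ (Γ u u * N + T) + (- 1ℚ) * (∑ vs (Γ u) + ∑ vs (λ v → Γ v u))
    row u = begin
      ∑ vs (ω u)
        ≡⟨ ∑-cong vs (λ v → ring₁ (Γ u u) (Γ v u) (Γ u v) (Γ v v)) ⟩
      ∑ vs (λ v → (Γ u u * 1ℚ + Γ v v) + (- 1ℚ) * (Γ u v + Γ v u))
        ≡⟨ ∑-+ vs (λ v → Γ u u * 1ℚ + Γ v v) (λ v → (- 1ℚ) * (Γ u v + Γ v u)) ⟩
      ∑ vs (λ v → Γ u u * 1ℚ + Γ v v) + ∑ vs (λ v → (- 1ℚ) * (Γ u v + Γ v u))
        ≡⟨ cong₂ _+_ (≡-trans (∑-+ vs (λ v → Γ u u * 1ℚ) (λ v → Γ v v)) (cong (_+ T) (∑-*ˡ vs (Γ u u) (λ _ → 1ℚ))))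
             (≡-trans (∑-*ˡ vs (- 1ℚ) (λ v → Γ u v + Γ v u)) (cong ((- 1ℚ) *_) (∑-+ vs (Γ u) (λ v → Γ v u)))) ⟩
      (Γ u u * N + T) + (- 1ℚ) * (∑ vs (Γ u) + ∑ vs (λ v → Γ v u)) ∎
    left : ∑ vs (λ u → Γ u u * N + T) ≡ N * T + T * N
    left = ≡-trans (∑-+ vs (λ u → Γ u u * N) (λ _ → T)) (cong₂ _+_
      (≡-trans (∑-cong vs λ u → ℚₚ.*-comm (Γ u u) N) (∑-*ˡ vs N (λ u → Γ u u)))
      (≡-trans (∑-cong vs λ u → sym (ℚₚ.*-identityʳ T)) (∑-*ˡ vs T (λ _ → 1ℚ))))
    right : ∑ vs (λ u → (- 1ℚ) * (∑ vs (Γ u) + ∑ vs (λ v → Γ v u))) ≡ (- 1ℚ) * (X + X)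
    right = ≡-trans (∑-*ˡ vs (- 1ℚ) (λ u → ∑ vs (Γ u) + ∑ vs (λ v → Γ v u))) (cong ((- 1ℚ) *_)
      (≡-trans (∑-+ vs (λ u → ∑ vs (Γ u)) (λ u → ∑ vs (λ v → Γ v u))) (cong (X +_) (∑-swap vs vs (λ u v → Γ v u)))))

-- Isomorphisms between graphs with models

module _ {G H : Graph} (M : Model G) (M′ : Model H) where
  private
    module M = Model M
    module M′ = Model M′

  -- The correspondence of edges is expressed by sums of arbitrary symmetric functions, because a
  -- reflection may reverse edges and reorder the list. Testing it on the indicator of one unordered
  -- pair recovers adjacency.
  model-≅ : (φ : M.Vertex → M′.Vertex) (φ⁻¹ : M′.Vertex → M.Vertex) →
    (∀ v → φ⁻¹ (φ v) ≡ v) → (∀ v → φ (φ⁻¹ v) ≡ v) →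
    (∀ (f : M′.Vertex → M′.Vertex → ℚ) → (∀ u v → f u v ≡ f v u) →
      ∑ M.edges (λ e → f (φ (proj₁ e)) (φ (proj₂ e))) ≡ ∑ M′.edges (λ e → f (proj₁ e) (proj₂ e))) →
    G ≅ H
  model-≅ φ φ⁻¹ invʳ invˡ edges≡ = mk↔ₛ′ to from to-from from-to , λ i j →
    ≡-trans (adj-match G i j) (≡-trans (cong₂ (λ p q → not p ∧ q) (not-eq i j) (Iverson-injective _ _ (any-eq i j)))
      (sym (adj-match H (to i) (to j))))
    where
    to : Fin (n G) → Fin (n H)
    to i = M′.index (φ (M.vertex i))
    from : Fin (n H) → Fin (n G)
    from j = M.index (φ⁻¹ (M′.vertex j))
    to-from : ∀ j → to (from j) ≡ j
    to-from j = ≡-trans (cong (M′.index ∘ φ) (M.vertex-index (φ⁻¹ (M′.vertex j))))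
      (≡-trans (cong M′.index (invˡ (M′.vertex j))) (M′.index-vertex j))
    from-to : ∀ i → from (to i) ≡ i
    from-to i = ≡-trans (cong (M.index ∘ φ⁻¹) (M′.vertex-index (φ (M.vertex i))))
      (≡-trans (cong M.index (invʳ (M.vertex i))) (M.index-vertex i))
    label≡ : ∀ a i → (M.label a ≡ᵇ toℕ i) ≡ (M′.label (φ a) ≡ᵇ toℕ (to i))
    label≡ a i = ≡ᵇ-cong
      (λ eq → ≡-trans (cong (M′.label ∘ φ) (M.label-injective (≡-trans eq (sym (M.label-vertex i)))))
        (sym (M′.toℕ-index (φ (M.vertex i)))))
      (λ eq → ≡-trans (cong M.label (≡-trans (sym (invʳ a)) (≡-trans
        (cong φ⁻¹ (M′.label-injective (≡-trans eq (M′.toℕ-index (φ (M.vertex i)))))) (invʳ (M.vertex i))))) (M.label-vertex i))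
    not-eq : ∀ i j → (toℕ i ≡ᵇ toℕ j) ≡ (toℕ (to i) ≡ᵇ toℕ (to j))
    not-eq i j = ≡-trans (cong (_≡ᵇ toℕ j) (sym (M.label-vertex i)))
      (≡-trans (label≡ (M.vertex i) j) (cong (_≡ᵇ toℕ (to j)) (sym (M′.toℕ-index (φ (M.vertex i))))))
    any-eq : ∀ i j → Defs.[ any (match (toℕ i) (toℕ j)) (E G) ] ≡ Defs.[ any (match (toℕ (to i)) (toℕ (to j))) (E H) ]
    any-eq i j = begin
      Defs.[ any (match (toℕ i) (toℕ j)) (E G) ]
        ≡⟨ M.any-edges (toℕ i) (toℕ j) ⟩
      ∑ M.edges (λ e → Defs.[ match (toℕ i) (toℕ j) (both M.label e) ])
        ≡⟨ ∑-cong M.edges (λ (a , b) → cong Defs.[_] (cong₂ _∨_ (cong₂ _∧_ (label≡ a i) (label≡ b j)) (cong₂ _∧_ (label≡ a j) (label≡ b i)))) ⟩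
      ∑ M.edges (λ e → f (φ (proj₁ e)) (φ (proj₂ e)))
        ≡⟨ edges≡ f (λ u v → cong Defs.[_] (≡-trans (Boolₚ.∨-comm ((M′.label u ≡ᵇ toℕ (to i)) ∧ (M′.label v ≡ᵇ toℕ (to j))) _)
             (cong₂ _∨_ (Boolₚ.∧-comm (M′.label u ≡ᵇ toℕ (to j)) _) (Boolₚ.∧-comm (M′.label u ≡ᵇ toℕ (to i)) _)))) ⟩
      ∑ M′.edges (λ e → f (proj₁ e) (proj₂ e))
        ≡⟨ M′.any-edges (toℕ (to i)) (toℕ (to j)) ⟨
      Defs.[ any (match (toℕ (to i)) (toℕ (to j))) (E H) ] ∎
      where
      open ≡-Reasoning
      f : M′.Vertex → M′.Vertex → ℚ
      f a b = Defs.[ match (toℕ (to i)) (toℕ (to j)) (M′.label a , M′.label b) ]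

-- The structured model of a chain

Squares : Set
Squares = List (ℕ × ℕ)

-- top 0 and bot 0 are the ends t_j, s_j of the left rung of a square; the constructors t₀, s₀ are the
-- ends of the last rung.
data V : Squares → Set where
  t₀ s₀ : V []
  top : ∀ {a b sq} → Fin (suc a) → V ((a , b) ∷ sq)
  bot : ∀ {a b sq} → Fin (suc b) → V ((a , b) ∷ sq)
  rest : ∀ {a b sq} → V sq → V ((a , b) ∷ sq)

leftT leftS : ∀ sq → V sq
leftT [] = t₀
leftT (_ ∷ _) = top Fin.zero
leftS [] = s₀
leftS (_ ∷ _) = bot Fin.zero

path : A → ∀ a → (Fin a → A) → A → List (A × A)
path v zero f w = (v , w) ∷ []
path v (suc a) f w = (v , f Fin.zero) ∷ path (f Fin.zero) a (f ∘ Fin.suc) w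

verticesOf : ∀ sq → List (V sq)
verticesOf [] = t₀ ∷ s₀ ∷ []
verticesOf ((a , b) ∷ sq) = tabulate top ++ tabulate bot ++ map rest (verticesOf sq)

topPath botPath : ∀ a b sq → List (V ((a , b) ∷ sq) × V ((a , b) ∷ sq))
topPath a b sq = path (top Fin.zero) a (top ∘ Fin.suc) (rest (leftT sq))
botPath a b sq = path (bot Fin.zero) b (bot ∘ Fin.suc) (rest (leftS sq))

edgesOf : ∀ sq → List (V sq × V sq)
edgesOf [] = (t₀ , s₀) ∷ []
edgesOf ((a , b) ∷ sq) =
  (top Fin.zero , bot Fin.zero) ∷ topPath a b sq ++ botPath a b sq ++ map (both rest) (edgesOf sq)

∈-verticesOf : ∀ sq (v : V sq) → v ∈ verticesOf sq
∈-verticesOf [] t₀ = here refl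
∈-verticesOf [] s₀ = there (here refl)
∈-verticesOf ((a , b) ∷ sq) (top x) = ∈-++⁺ˡ (∈-tabulate⁺ {f = top} x)
∈-verticesOf ((a , b) ∷ sq) (bot y) = ∈-++⁺ʳ (tabulate top) (∈-++⁺ˡ (∈-tabulate⁺ {f = bot} y))
∈-verticesOf ((a , b) ∷ sq) (rest v) = ∈-++⁺ʳ (tabulate top) (∈-++⁺ʳ (tabulate bot) (∈-map⁺ rest (∈-verticesOf sq v)))

path-All : ∀ (Q : A × A → Set) v a (f : Fin a → A) w →
  (∀ y → Q (v , y)) → (∀ i y → Q (f i , y)) → L.All Q (path v a f w)
path-All Q v zero f w p q = p w ∷ []
path-All Q v (suc a) f w p q = p (f Fin.zero) ∷ path-All Q (f Fin.zero) a (f ∘ Fin.suc) w (q Fin.zero) (q ∘ Fin.suc)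

path-avoids : ∀ {u : A} v a (f : Fin a → A) w → u ≢ v → (∀ i → u ≢ f i) → u ≢ w → L.All (u ∉₂_) (path v a f w)
path-avoids v zero f w p q r = (p , r) ∷ []
path-avoids v (suc a) f w p q r = (p , q Fin.zero) ∷ path-avoids (f Fin.zero) a (f ∘ Fin.suc) w (q Fin.zero) (q ∘ Fin.suc) r

path-apart : ∀ v a (f : Fin a → A) w → (∀ i → v ≢ f i) → v ≢ w → (∀ {i j} → f i ≡ f j → i ≡ j) → (∀ i → f i ≢ w) →
  AllPairs Apart (path v a f w)
path-apart v zero f w p q r s = [] ∷ []
path-apart v (suc a) f w p q r s =
  L.map inj₁ (path-avoids (f Fin.zero) a (f ∘ Fin.suc) w (p Fin.zero) (p ∘ Fin.suc) q) ∷
  path-apart (f Fin.zero) a (f ∘ Fin.suc) w (λ i eq → 0≢suc (r eq)) (s Fin.zero) (Finₚ.suc-injective ∘ r) (s ∘ Fin.suc)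
  where
  0≢suc : ∀ {m} {i : Fin m} → Fin.zero ≢ Fin.suc i
  0≢suc ()

-- Every edge has an endpoint that no later edge meets. For path edges it is the source; the rung
-- uses `bot 0` against the top path and `top 0` against all the rest.
edges-apartOf : ∀ sq → AllPairs Apart (edgesOf sq)
edges-apartOf [] = [] ∷ []
edges-apartOf ((a , b) ∷ sq) =
  Lₚ.++⁺ (L.map inj₂ (path-avoids (top Fin.zero) a (top ∘ Fin.suc) (rest (leftT sq)) (λ ()) (λ _ ()) (λ ())))
    (Lₚ.++⁺ (L.map inj₁ (path-avoids (bot Fin.zero) b (bot ∘ Fin.suc) (rest (leftS sq)) (λ ()) (λ _ ()) (λ ())))
      (Lₚ.map⁺ (L.universal (λ e → inj₁ ((λ ()) , (λ ()))) (edgesOf sq)))) ∷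
  APₚ.++⁺ (path-apart (top Fin.zero) a (top ∘ Fin.suc) (rest (leftT sq)) (λ i ()) (λ ()) (λ { refl → refl }) (λ i ()))
    (APₚ.++⁺ (path-apart (bot Fin.zero) b (bot ∘ Fin.suc) (rest (leftS sq)) (λ i ()) (λ ()) (λ { refl → refl }) (λ i ()))
      (APₚ.map⁺ (AP.map apart-rest (edges-apartOf sq)))
      (path-All (λ e → L.All (Apart e) (map (both rest) (edgesOf sq))) _ b _ _ (λ y → from-bot) (λ _ y → from-bot)))
    (path-All (λ e → L.All (Apart e) (botPath a b sq ++ map (both rest) (edgesOf sq))) _ a _ _ (λ y → from-top) (λ _ y → from-top))
  where
  apart-rest : ∀ {e e′ : V sq × V sq} → Apart e e′ → Apart (both (rest {a} {b}) e) (both rest e′)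
  apart-rest (inj₁ (p , q)) = inj₁ ((λ { refl → p refl }) , (λ { refl → q refl }))
  apart-rest (inj₂ (p , q)) = inj₂ ((λ { refl → p refl }) , (λ { refl → q refl }))
  from-bot : ∀ {i y} → L.All (Apart (bot {a} {b} {sq} i , y)) (map (both rest) (edgesOf sq))
  from-bot = Lₚ.map⁺ (L.universal (λ e → inj₁ ((λ ()) , (λ ()))) (edgesOf sq))
  from-top : ∀ {i y} → L.All (Apart (top {a} {b} {sq} i , y)) (botPath a b sq ++ map (both rest) (edgesOf sq))
  from-top = Lₚ.++⁺ (L.map inj₁ (path-avoids (bot Fin.zero) b (bot ∘ Fin.suc) (rest (leftS sq)) (λ ()) (λ _ ()) (λ ())))
    (Lₚ.map⁺ (L.universal (λ e → inj₁ ((λ ()) , (λ ()))) (edgesOf sq)))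

-- Vertex labels

range : ℕ → ℕ → List ℕ
range i zero = []
range i (suc m) = i ∷ range (suc i) m

range-++ : ∀ i m m′ → range i (m ℕ.+ m′) ≡ range i m ++ range (i ℕ.+ m) m′
range-++ i zero m′ = cong (λ z → range z m′) (sym (ℕₚ.+-identityʳ i))
range-++ i (suc m) m′ = cong (i ∷_) (≡-trans (range-++ (suc i) m m′) (cong (λ z → range (suc i) m ++ range z m′) (sym (ℕₚ.+-suc i m))))

suc-shift : ∀ {m} {f : Fin (suc m) → ℕ} {i} → (∀ j → f j ≡ i ℕ.+ toℕ j) → ∀ j → f (Fin.suc j) ≡ suc i ℕ.+ toℕ j
suc-shift {i = i} eq j = ≡-trans (eq (Fin.suc j)) (ℕₚ.+-suc i (toℕ j))

tabulate-range : ∀ {m} (f : Fin m → ℕ) i → (∀ j → f j ≡ i ℕ.+ toℕ j) → tabulate f ≡ range i m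
tabulate-range {zero} f i eq = refl
tabulate-range {suc m} f i eq = cong₂ _∷_ (≡-trans (eq Fin.zero) (ℕₚ.+-identityʳ i))
  (tabulate-range (f ∘ Fin.suc) (suc i) (suc-shift {f = f} eq))

upTo-range : ∀ m → upTo m ≡ range 0 m
upTo-range m = ≡-trans (sym (tabulate-toℕ m id)) (tabulate-range toℕ 0 λ j → refl)

map-path : ∀ (l : A → ℕ) v a (f : Fin a → A) w base → (∀ j → l (f j) ≡ base ℕ.+ toℕ j) →
  map (both l) (path v a f w) ≡ pathE (l v) (l w) base a
map-path l v zero f w base eq = refl
map-path l v (suc a) f w base eq = cong₂ _∷_ (cong (l v ,_) eq₀)
  (≡-trans (map-path l (f Fin.zero) a (f ∘ Fin.suc) w (suc base) (suc-shift {f = l ∘ f} eq))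
    (cong (λ z → pathE z (l w) (suc base) a) eq₀))
  where
  eq₀ : l (f Fin.zero) ≡ base
  eq₀ = ≡-trans (eq Fin.zero) (ℕₚ.+-identityʳ base)

subdivisions : Squares → ℕ
subdivisions [] = 0
subdivisions ((a , b) ∷ sq) = a ℕ.+ (b ℕ.+ subdivisions sq)

module _ (h : ℕ) where
  labelOf : ℕ → ℕ → ∀ sq → V sq → ℕ
  labelOf i base [] t₀ = tV h i
  labelOf i base [] s₀ = sV h i
  labelOf i base ((a , b) ∷ sq) (top Fin.zero) = tV h i
  labelOf i base ((a , b) ∷ sq) (top (Fin.suc x)) = base ℕ.+ toℕ x
  labelOf i base ((a , b) ∷ sq) (bot Fin.zero) = sV h i
  labelOf i base ((a , b) ∷ sq) (bot (Fin.suc y)) = base ℕ.+ a ℕ.+ toℕ y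
  labelOf i base ((a , b) ∷ sq) (rest v) = labelOf (suc i) (base ℕ.+ a ℕ.+ b) sq v

  label-leftT : ∀ i base sq → labelOf i base sq (leftT sq) ≡ tV h i
  label-leftT i base [] = refl
  label-leftT i base (_ ∷ _) = refl

  label-leftS : ∀ i base sq → labelOf i base sq (leftS sq) ≡ sV h i
  label-leftS i base [] = refl
  label-leftS i base (_ ∷ _) = refl

  labels-↭ : ∀ i base sq → map (labelOf i base sq) (verticesOf sq)
    ↭ range i (suc (length sq)) ++ range (sV h i) (suc (length sq)) ++ range base (subdivisions sq)
  labels-↭ i base [] = ↭-refl
  labels-↭ i base ((a , b) ∷ sq) = subst₂ _↭_ (sym lhs) (sym rhs)
    (↭-trans (prep i (↭ₚ.++⁺ˡ (range base a) (prep (sV h i) (↭ₚ.++⁺ˡ (range (base ℕ.+ a) b) ih))))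
      (solve 7 (λ i s x y p q r → (i ⊕ (x ⊕ (s ⊕ (y ⊕ (p ⊕ (q ⊕ r)))))) ⊜ ((i ⊕ p) ⊕ ((s ⊕ q) ⊕ (x ⊕ (y ⊕ r))))) ↭-refl
        (i ∷ []) (sV h i ∷ []) (range base a) (range (base ℕ.+ a) b)
        (range (suc i) l) (range (suc (sV h i)) l) (range (base ℕ.+ a ℕ.+ b) (subdivisions sq))))
    where
    open CommutativeMonoidSolver (↭ₚ.++-commutativeMonoid {A = ℕ})
    l = suc (length sq)
    lab = labelOf i base ((a , b) ∷ sq)
    rest-labels = map (labelOf (suc i) (base ℕ.+ a ℕ.+ b) sq) (verticesOf sq)
    ih : rest-labels ↭ range (suc i) l ++ range (suc (sV h i)) l ++ range (base ℕ.+ a ℕ.+ b) (subdivisions sq)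
    ih = subst (λ z → rest-labels ↭ range (suc i) l ++ range (suc z) l ++ range (base ℕ.+ a ℕ.+ b) (subdivisions sq))
      (ℕₚ.+-suc h i) (labels-↭ (suc i) (base ℕ.+ a ℕ.+ b) sq)
    lhs : map lab (verticesOf ((a , b) ∷ sq)) ≡ (i ∷ range base a) ++ (sV h i ∷ range (base ℕ.+ a) b) ++ rest-labels
    lhs = ≡-trans (Listₚ.map-++ lab (tabulate top) _) (cong₂ _++_
      (≡-trans (Listₚ.map-tabulate top lab) (cong (i ∷_) (tabulate-range _ base λ j → refl)))
      (≡-trans (Listₚ.map-++ lab (tabulate bot) _) (cong₂ _++_
        (≡-trans (Listₚ.map-tabulate bot lab) (cong (sV h i ∷_) (tabulate-range _ (base ℕ.+ a) λ j → refl)))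
        (sym (Listₚ.map-∘ (verticesOf sq))))))
    rhs : range i (suc l) ++ range (sV h i) (suc l) ++ range base (subdivisions ((a , b) ∷ sq))
      ≡ (i ∷ range (suc i) l) ++ (sV h i ∷ range (suc (sV h i)) l)
        ++ range base a ++ range (base ℕ.+ a) b ++ range (base ℕ.+ a ℕ.+ b) (subdivisions sq)
    rhs = cong (λ z → range i (suc l) ++ range (sV h i) (suc l) ++ z)
      (≡-trans (range-++ base a _) (cong (range base a ++_) (range-++ (base ℕ.+ a) b _)))

  rung : ℕ → ℕ × ℕ
  rung j = tV h j , sV h j

  -- `rungsE` lists the rungs from right to left, the model meets them from left to right.
  rungsE-↭ : ∀ j → rungsE h j ↭ map rung (range 0 (suc j))
  rungsE-↭ zero = ↭-refl
  rungsE-↭ (suc j) = ↭-trans (prep (rung (suc j)) (rungsE-↭ j))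
    (subst (rung (suc j) ∷ map rung (range 0 (suc j)) ↭_) (sym eq)
      (↭ₚ.++-comm (rung (suc j) ∷ []) (map rung (range 0 (suc j)))))
    where
    eq : map rung (range 0 (suc (suc j))) ≡ map rung (range 0 (suc j)) ++ rung (suc j) ∷ []
    eq = ≡-trans (cong (λ z → map rung (range 0 z)) (ℕₚ.+-comm 1 (suc j)))
      (≡-trans (cong (map rung) (range-++ 0 (suc j) 1)) (Listₚ.map-++ rung (range 0 (suc j)) (suc j ∷ [])))

  labelled-edges-↭ : ∀ i base sq → map (both (labelOf i base sq)) (edgesOf sq)
    ↭ map rung (range i (suc (length sq))) ++ squaresE h i base sq
  labelled-edges-↭ i base [] = ↭-refl
  labelled-edges-↭ i base ((a , b) ∷ sq) = subst (_↭ map rung (range i (suc (suc (length sq)))) ++ tp ++ bp ++ squaresE h (suc i) (base ℕ.+ a ℕ.+ b) sq) (sym lhs)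
    (↭-trans (prep (rung i) (↭ₚ.++⁺ˡ tp (↭ₚ.++⁺ˡ bp (labelled-edges-↭ (suc i) (base ℕ.+ a ℕ.+ b) sq))))
      (solve 5 (λ r x y p q → (r ⊕ (x ⊕ (y ⊕ (p ⊕ q)))) ⊜ ((r ⊕ p) ⊕ (x ⊕ (y ⊕ q)))) ↭-refl
        (rung i ∷ []) tp bp (map rung (range (suc i) (suc (length sq)))) (squaresE h (suc i) (base ℕ.+ a ℕ.+ b) sq)))
    where
    open CommutativeMonoidSolver (↭ₚ.++-commutativeMonoid {A = ℕ × ℕ})
    lab = labelOf i base ((a , b) ∷ sq)
    tp = pathE (tV h i) (tV h (suc i)) base a
    bp = pathE (sV h i) (sV h (suc i)) (base ℕ.+ a) b
    lhs : map (both lab) (edgesOf ((a , b) ∷ sq))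
      ≡ rung i ∷ tp ++ bp ++ map (both (labelOf (suc i) (base ℕ.+ a ℕ.+ b) sq)) (edgesOf sq)
    lhs = cong (rung i ∷_) (≡-trans (Listₚ.map-++ (both lab) (topPath a b sq) _) (cong₂ _++_
      (≡-trans (map-path lab (top Fin.zero) a (top ∘ Fin.suc) (rest (leftT sq)) base λ j → refl)
        (cong (λ z → pathE (tV h i) z base a) (label-leftT (suc i) (base ℕ.+ a ℕ.+ b) sq)))
      (≡-trans (Listₚ.map-++ (both lab) (botPath a b sq) _) (cong₂ _++_
        (≡-trans (map-path lab (bot Fin.zero) b (bot ∘ Fin.suc) (rest (leftS sq)) (base ℕ.+ a) λ j → refl)
          (cong (λ z → pathE (sV h i) z (base ℕ.+ a) b) (label-leftS (suc i) (base ℕ.+ a ℕ.+ b) sq)))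
        (sym (Listₚ.map-∘ (edgesOf sq)))))))

Balanced : ℕ → Squares → Set
Balanced c = L.All λ (a , b) → a ℕ.+ b ≡ c

subdivisions-Balanced : ∀ {c sq} → Balanced c sq → subdivisions sq ≡ length sq ℕ.* c
subdivisions-Balanced [] = refl
subdivisions-Balanced {c} {(a , b) ∷ sq} (eq ∷ bal) =
  ≡-trans (sym (ℕₚ.+-assoc a b _)) (cong₂ ℕ._+_ eq (subdivisions-Balanced bal))

-- Chosen so that `P (4 + c) h w` is definitionally the chain of its list of squares; results proved
-- here apply to `P` without transport.
chainOf : ℕ → ℕ → Squares → Graph
chainOf c h sq = graph (h ℕ.* (2 ℕ.+ c) ℕ.+ 2) (rungsE h h ++ squaresE h 0 (2 ℕ.* h ℕ.+ 2) sq)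

chain-vertices-↭ : ∀ c h sq → length sq ≡ h → Balanced c sq →
  map (labelOf h 0 (2 ℕ.* h ℕ.+ 2) sq) (verticesOf sq) ↭ upTo (h ℕ.* (2 ℕ.+ c) ℕ.+ 2)
chain-vertices-↭ c h sq refl bal =
  subst (map (labelOf h 0 (2 ℕ.* h ℕ.+ 2) sq) (verticesOf sq) ↭_) (sym ranges) (labels-↭ h 0 (2 ℕ.* h ℕ.+ 2) sq)
  where
  open ≡-Reasoning
  count : h ℕ.* (2 ℕ.+ c) ℕ.+ 2 ≡ suc h ℕ.+ (suc h ℕ.+ subdivisions sq)
  count = begin
    h ℕ.* (2 ℕ.+ c) ℕ.+ 2                    ≡⟨ ring h c ⟩
    suc h ℕ.+ (suc h ℕ.+ h ℕ.* c)            ≡⟨ cong (λ z → suc h ℕ.+ (suc h ℕ.+ z)) (subdivisions-Balanced bal) ⟨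
    suc h ℕ.+ (suc h ℕ.+ subdivisions sq)    ∎
    where
    ring : ∀ h c → h ℕ.* (2 ℕ.+ c) ℕ.+ 2 ≡ suc h ℕ.+ (suc h ℕ.+ h ℕ.* c)
    ring = ℕ-solve-∀
  base : ∀ h → suc h ℕ.+ suc h ≡ 2 ℕ.* h ℕ.+ 2
  base = ℕ-solve-∀
  ranges : upTo (h ℕ.* (2 ℕ.+ c) ℕ.+ 2)
    ≡ range 0 (suc h) ++ range (sV h 0) (suc h) ++ range (2 ℕ.* h ℕ.+ 2) (subdivisions sq)
  ranges = begin
    upTo (h ℕ.* (2 ℕ.+ c) ℕ.+ 2)
      ≡⟨ upTo-range _ ⟩
    range 0 (h ℕ.* (2 ℕ.+ c) ℕ.+ 2)
      ≡⟨ cong (range 0) count ⟩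
    range 0 (suc h ℕ.+ (suc h ℕ.+ subdivisions sq))
      ≡⟨ range-++ 0 (suc h) _ ⟩
    range 0 (suc h) ++ range (suc h) (suc h ℕ.+ subdivisions sq)
      ≡⟨ cong (range 0 (suc h) ++_) (range-++ (suc h) (suc h) _) ⟩
    range 0 (suc h) ++ range (suc h) (suc h) ++ range (suc h ℕ.+ suc h) (subdivisions sq)
      ≡⟨ cong₂ (λ p q → range 0 (suc h) ++ range (suc p) (suc h) ++ range q (subdivisions sq)) (sym (ℕₚ.+-identityʳ h)) (base h) ⟩
    range 0 (suc h) ++ range (sV h 0) (suc h) ++ range (2 ℕ.* h ℕ.+ 2) (subdivisions sq) ∎

chain-edges-↭ : ∀ h sq → length sq ≡ h →
  map (both (labelOf h 0 (2 ℕ.* h ℕ.+ 2) sq)) (edgesOf sq) ↭ rungsE h h ++ squaresE h 0 (2 ℕ.* h ℕ.+ 2) sq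
chain-edges-↭ h sq refl = ↭-trans (labelled-edges-↭ h 0 (2 ℕ.* h ℕ.+ 2) sq) (↭ₚ.++⁺ʳ _ (↭-sym (rungsE-↭ h h)))

chainModel : ∀ c h sq → length sq ≡ h → Balanced c sq → Model (chainOf c h sq)
chainModel c h sq len bal = record
  { Vertex = V sq
  ; vertices = verticesOf sq
  ; edges = edgesOf sq
  ; label = labelOf h 0 (2 ℕ.* h ℕ.+ 2) sq
  ; complete = ∈-verticesOf sq
  ; vertices-↭ = chain-vertices-↭ c h sq len bal
  ; edges-↭ = chain-edges-↭ h sq len
  ; edges-apart = edges-apartOf sq
  }

-- Potentials on a chain

-- Defined by recursion so that `ι (suc m)` unfolds to `1ℚ + ι m`. Solver identities written with
-- `1ℚ + a` then fit goals about side lengths as they stand.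
ι : ℕ → ℚ
ι zero = 0ℚ
ι (suc m) = 1ℚ + ι m

ι-+ : ∀ m m′ → ι (m ℕ.+ m′) ≡ ι m + ι m′
ι-+ zero m′ = sym (ℚₚ.+-identityˡ (ι m′))
ι-+ (suc m) m′ = ≡-trans (cong (λ z → 1ℚ + z) (ι-+ m m′)) (sym (ℚₚ.+-assoc 1ℚ (ι m) (ι m′)))

-- The ring solver proves only unconditional identities. A consequence of E = F is obtained by
-- supplying the cofactor `k` of E - F.
modulo : ∀ {x y E F} k → E ≡ F → x ≡ y + k * (E - F) → x ≡ y
modulo {x} {y} {E} k refl eq = ≡-trans eq (ring y k E)
  where
  ring : ∀ y k E → y + k * (E - E) ≡ y
  ring = solve-∀ ℚ-ring

energy-+* : ∀ (es : List (A × A)) (x x′ y : A → ℚ) k → energy es (λ a → x a + k * x′ a) y ≡ energy es x y + k * energy es x′ y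
energy-+* [] x x′ y k = ≡-trans (sym (ℚₚ.*-zeroʳ k)) (sym (ℚₚ.+-identityˡ (k * 0ℚ)))
energy-+* ((a , b) ∷ es) x x′ y k = ≡-trans (cong (((x a + k * x′ a) - (x b + k * x′ b)) * (y a - y b) +_) (energy-+* es x x′ y k))
  (ring (x a) (x′ a) (x b) (x′ b) (y a - y b) (energy es x y) (energy es x′ y) k)
  where
  ring : ∀ p p′ q q′ z e e′ k → ((p + k * p′) - (q + k * q′)) * z + (e + k * e′) ≡ ((p - q) * z + e) + k * ((p′ - q′) * z + e′)
  ring = solve-∀ ℚ-ring

energy-const : ∀ (es : List (A × A)) k (y : A → ℚ) → energy es (λ _ → k) y ≡ 0ℚ
energy-const [] k y = refl
energy-const (e ∷ es) k y = ≡-trans (cong₂ _+_ (zeros k (y (proj₁ e) - y (proj₂ e))) (energy-const es k y)) refl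
  where
  zeros : ∀ k z → (k - k) * z ≡ 0ℚ
  zeros = solve-∀ ℚ-ring

path-linear : ∀ a (f : Fin (suc a) → A) w (x y : A → ℚ) α γ → (∀ j → x (f j) ≡ α - γ * ι (toℕ j)) → x w ≡ α - γ * ι (suc a) →
  energy (path (f Fin.zero) a (f ∘ Fin.suc) w) x y ≡ γ * (y (f Fin.zero) - y w)
path-linear zero f w x y α γ e e′ = ≡-trans (cong₂ (λ p q → (p - q) * (y (f Fin.zero) - y w) + 0ℚ) (e Fin.zero) e′) (ring α γ (y (f Fin.zero) - y w))
  where
  ring : ∀ α γ z → ((α - γ * 0ℚ) - (α - γ * (1ℚ + 0ℚ))) * z + 0ℚ ≡ γ * z
  ring = solve-∀ ℚ-ring
path-linear (suc a) f w x y α γ e e′ = ≡-trans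
  (cong₂ _+_ (cong₂ (λ p q → (p - q) * (y (f Fin.zero) - y (f (Fin.suc Fin.zero)))) (e Fin.zero) (e (Fin.suc Fin.zero)))
    (path-linear a (f ∘ Fin.suc) w x y (α - γ) γ (λ j → ≡-trans (e (Fin.suc j)) (shift α γ (ι (toℕ j)))) (≡-trans e′ (shift α γ (ι (suc a))))))
  (ring α γ (y (f Fin.zero)) (y (f (Fin.suc Fin.zero))) (y w))
  where
  shift : ∀ α γ i → α - γ * (1ℚ + i) ≡ (α - γ) - γ * i
  shift = solve-∀ ℚ-ring
  ring : ∀ α γ u v w → ((α - γ * 0ℚ) - (α - γ * (1ℚ + 0ℚ))) * (u - v) + γ * (v - w) ≡ γ * (u - w)
  ring = solve-∀ ℚ-ring

-- The potential climbs with slope one up to position `z` and is flat afterwards: a unit current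
-- flowing from `f z` back to the start of the path.
path-min : ∀ a (f : Fin (suc a) → A) w (x y : A → ℚ) α z → (∀ j → x (f j) ≡ α + ι (toℕ j ℕ.⊓ toℕ z)) → x w ≡ α + ι (toℕ z) →
  energy (path (f Fin.zero) a (f ∘ Fin.suc) w) x y ≡ y (f z) - y (f Fin.zero)
path-min a f w x y α Fin.zero e e′ = ≡-trans
  (path-linear a f w x y α 0ℚ (λ j → ≡-trans (e j) (≡-trans (cong (λ z → α + ι z) (ℕₚ.⊓-zeroʳ (toℕ j))) (flat α (ι (toℕ j)))))
    (≡-trans e′ (flat α (ι (suc a)))))
  (ring (y (f Fin.zero)) (y w))
  where
  flat : ∀ α i → α + 0ℚ ≡ α - 0ℚ * i
  flat = solve-∀ ℚ-ring
  ring : ∀ u w → 0ℚ * (u - w) ≡ u - u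
  ring = solve-∀ ℚ-ring
path-min (suc a) f w x y α (Fin.suc z) e e′ = ≡-trans
  (cong₂ _+_ (cong₂ (λ p q → (p - q) * (y (f Fin.zero) - y (f (Fin.suc Fin.zero)))) (e Fin.zero) (e (Fin.suc Fin.zero)))
    (path-min a (f ∘ Fin.suc) w x y (α + 1ℚ) z (λ j → ≡-trans (e (Fin.suc j)) (shift α (ι (toℕ j ℕ.⊓ toℕ z)))) (≡-trans e′ (shift α (ι (toℕ z))))))
  (ring α (y (f Fin.zero)) (y (f (Fin.suc Fin.zero))) (y (f (Fin.suc z))))
  where
  shift : ∀ α i → α + (1ℚ + i) ≡ (α + 1ℚ) + i
  shift = solve-∀ ℚ-ring
  ring : ∀ α u v w → ((α + 0ℚ) - (α + (1ℚ + 0ℚ))) * (u - v) + (w - v) ≡ w - u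
  ring = solve-∀ ℚ-ring

∑-edges-∷ : ∀ a b sq (F : V ((a , b) ∷ sq) × V ((a , b) ∷ sq) → ℚ) → ∑ (edgesOf ((a , b) ∷ sq)) F ≡
  F (top Fin.zero , bot Fin.zero) + (∑ (topPath a b sq) F + (∑ (botPath a b sq) F + ∑ (edgesOf sq) (F ∘ both rest)))
∑-edges-∷ a b sq F = cong (F (top Fin.zero , bot Fin.zero) +_)
  (≡-trans (∑-++ (topPath a b sq) _ F) (cong (∑ (topPath a b sq) F +_)
    (≡-trans (∑-++ (botPath a b sq) _ F) (cong (∑ (botPath a b sq) F +_) (∑-map (both rest) (edgesOf sq) F)))))

offset : ℕ → ℕ → ℚ
offset a b = ½ * (ι b - ι a)

offsetsOf : Squares → List ℚ
offsetsOf = map (λ (a , b) → offset a b)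

-- The background charge of the Green's function: half a unit is drawn at each end of the left rung.
-- This symmetric choice makes the two sides of a polygon play equal roles.
ν : ∀ sq → (V sq → ℚ) → ℚ
ν sq y = ½ * (y (leftT sq) + y (leftS sq))

κ : ℕ → ℚ
κ c = ι (4 ℕ.+ c)

-- 1 − g r is the resistance between the two ends of the left rung of a chain of r polygons.
module Potentials (c : ℕ) (g : ℕ → ℚ) (g-zero : g 0 ≡ 0ℚ) (g-suc : ∀ r → g (suc r) * (κ c - g r) ≡ 1ℚ) where

  -- The potential of a unit current entering at the top and leaving at the bottom of the left rung,
  -- with opposite values at these ends. The rung carries 1 - g and the polygon g, hence the slope
  -- along both paths. On the rest it is g times the same potential there, moved by the offset,
  -- since unequal paths shift the midpoint of the next rung.
  ψ : ∀ sq → V sq → ℚ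
  ψ [] t₀ = ½
  ψ [] s₀ = - ½
  ψ (_ ∷ sq) (top x) = ½ - g (suc (length sq)) * (ι (toℕ x) + ½)
  ψ (_ ∷ sq) (bot y) = g (suc (length sq)) * (ι (toℕ y) + ½) - ½
  ψ ((a , b) ∷ sq) (rest v) = g (suc (length sq)) * (ψ sq v + offset a b)

  -- Γ u is grounded so that its values at the ends of the left rung are opposite; the part χ u · ψ carries
  -- the current through that rung.
  χ : ∀ {a b} sq → V ((a , b) ∷ sq) → ℚ
  χ sq (top x) = ι (toℕ x) + ½
  χ sq (bot y) = - (ι (toℕ y) + ½)
  χ {a} {b} sq (rest u) = - (ψ sq u + offset a b)

  mutual
    Γ : ∀ sq → V sq → V sq → ℚ
    Γ [] u v = ψ [] u * ψ [] v
    Γ ((a , b) ∷ sq) u v = β sq u v + χ sq u * ψ ((a , b) ∷ sq) v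

    -- A charge on a path runs straight back to the near end of the left rung; a charge in the rest
    -- returns half along each path. The voltage this puts across the left rung is wrong, and
    -- `χ · ψ` repairs it. In the last clause a single constant glues both paths to the rest,
    -- because the offset absorbs their difference in length.
    β : ∀ {a b} sq → V ((a , b) ∷ sq) → V ((a , b) ∷ sq) → ℚ
    β sq (top x) (top x′) = - (½ * ι (toℕ x)) + ι (toℕ x′ ℕ.⊓ toℕ x)
    β sq (top x) (bot y) = ½ * ι (toℕ x)
    β sq (top x) (rest v) = ½ * ι (toℕ x)
    β sq (bot y) (top x) = ½ * ι (toℕ y)
    β sq (bot y) (bot y′) = - (½ * ι (toℕ y)) + ι (toℕ y′ ℕ.⊓ toℕ y)
    β sq (bot y) (rest v) = ½ * ι (toℕ y)
    β {a} {b} sq (rest u) (top x) = ½ * ι (toℕ x) + ½ * (ψ sq u + offset a b)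
    β {a} {b} sq (rest u) (bot y) = ½ * ι (toℕ y) - ½ * (ψ sq u + offset a b)
    β {a} {b} sq (rest u) (rest v) = Γ sq u v + ½ * (½ * (ι (suc a) + ι (suc b)))

  ψ-leftT : ∀ sq → ψ sq (leftT sq) ≡ ½ - ½ * g (length sq)
  ψ-leftT [] = ≡-trans (ring) (cong (λ z → ½ - ½ * z) (sym g-zero))
    where
    ring : ½ ≡ ½ - ½ * 0ℚ
    ring = refl
  ψ-leftT (_ ∷ sq) = ring (g (suc (length sq)))
    where
    ring : ∀ g → ½ - g * (0ℚ + ½) ≡ ½ - ½ * g
    ring = solve-∀ ℚ-ring

  ψ-leftS : ∀ sq → ψ sq (leftS sq) ≡ ½ * g (length sq) - ½
  ψ-leftS [] = ≡-trans ring (cong (λ z → ½ * z - ½) (sym g-zero))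
    where
    ring : - ½ ≡ ½ * 0ℚ - ½
    ring = refl
  ψ-leftS (_ ∷ sq) = ring (g (suc (length sq)))
    where
    ring : ∀ g → g * (0ℚ + ½) - ½ ≡ ½ * g - ½
    ring = solve-∀ ℚ-ring

  -- Reciprocity: the voltage across the left rung caused by a charge at `u` is the potential at `u`
  -- of a unit current through that rung. Symmetric grounding halves it between the two ends. These
  -- are the boundary values to which the next polygon is glued.
  Γ-leftT : ∀ sq u → Γ sq u (leftT sq) ≡ ½ * ψ sq u
  Γ-leftT [] u = ℚₚ.*-comm (ψ [] u) ½
  Γ-leftT (_ ∷ sq) (top x) = ring (ι (toℕ x)) (g (suc (length sq)))
    where
    ring : ∀ i g → (- (½ * i) + 0ℚ) + (i + ½) * (½ - g * (0ℚ + ½)) ≡ ½ * (½ - g * (i + ½))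
    ring = solve-∀ ℚ-ring
  Γ-leftT (_ ∷ sq) (bot y) = ring (ι (toℕ y)) (g (suc (length sq)))
    where
    ring : ∀ i g → ½ * i + (- (i + ½)) * (½ - g * (0ℚ + ½)) ≡ ½ * (g * (i + ½) - ½)
    ring = solve-∀ ℚ-ring
  Γ-leftT ((a , b) ∷ sq) (rest u) = ring (ψ sq u + offset a b) (g (suc (length sq)))
    where
    ring : ∀ x g → (½ * 0ℚ + ½ * x) + (- x) * (½ - g * (0ℚ + ½)) ≡ ½ * (g * x)
    ring = solve-∀ ℚ-ring

  Γ-leftS : ∀ sq u → Γ sq u (leftS sq) ≡ - (½ * ψ sq u)
  Γ-leftS [] u = ring (ψ [] u)
    where
    ring : ∀ x → x * (- ½) ≡ - (½ * x)
    ring = solve-∀ ℚ-ring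
  Γ-leftS (_ ∷ sq) (top x) = ring (ι (toℕ x)) (g (suc (length sq)))
    where
    ring : ∀ i g → ½ * i + (i + ½) * (g * (0ℚ + ½) - ½) ≡ - (½ * (½ - g * (i + ½)))
    ring = solve-∀ ℚ-ring
  Γ-leftS (_ ∷ sq) (bot y) = ring (ι (toℕ y)) (g (suc (length sq)))
    where
    ring : ∀ i g → (- (½ * i) + 0ℚ) + (- (i + ½)) * (g * (0ℚ + ½) - ½) ≡ - (½ * (g * (i + ½) - ½))
    ring = solve-∀ ℚ-ring
  Γ-leftS ((a , b) ∷ sq) (rest u) = ring (ψ sq u + offset a b) (g (suc (length sq)))
    where
    ring : ∀ x g → (½ * 0ℚ - ½ * x) + (- x) * (g * (0ℚ + ½) - ½) ≡ - (½ * (g * x))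
    ring = solve-∀ ℚ-ring

  -- The split of c drops out: only the length of the circuit enters the recurrence.
  g-square : ∀ {a b} → a ℕ.+ b ≡ c → ∀ r → g (suc r) * (ι (suc a) + ι (suc b) + (1ℚ + 1ℚ) - g r) ≡ 1ℚ
  g-square {a} {b} refl r = ≡-trans (cong (λ z → g (suc r) * (z - g r)) (≡-trans (ring (ι a) (ι b))
    (cong (λ z → 1ℚ + (1ℚ + (1ℚ + (1ℚ + z)))) (sym (ι-+ a b))))) (g-suc r)
    where
    ring : ∀ a b → (1ℚ + a) + (1ℚ + b) + (1ℚ + 1ℚ) ≡ 1ℚ + (1ℚ + (1ℚ + (1ℚ + (a + b))))
    ring = solve-∀ ℚ-ring

  ψ-energy : ∀ sq → Balanced c sq → ∀ y → energy (edgesOf sq) (ψ sq) y ≡ y (leftT sq) - y (leftS sq)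
  ψ-energy [] bal y = ring (y t₀) (y s₀)
    where
    ring : ∀ t s → (½ - - ½) * (t - s) + 0ℚ ≡ t - s
    ring = solve-∀ ℚ-ring
  ψ-energy ((a , b) ∷ sq) (eq ∷ bal) y = begin
    energy (edgesOf ((a , b) ∷ sq)) ψ′ y
      ≡⟨ ∑-edges-∷ a b sq (λ e → (ψ′ (proj₁ e) - ψ′ (proj₂ e)) * (y (proj₁ e) - y (proj₂ e))) ⟩
    rung₀ * (T - S) + (energy (topPath a b sq) ψ′ y + (energy (botPath a b sq) ψ′ y + energy (edgesOf sq) (λ v → G * (ψ sq v + offset a b)) (y ∘ rest)))
      ≡⟨ cong (λ z → rung₀ * (T - S) + z) (cong₂ _+_ top-part (cong₂ _+_ bot-part rest-part)) ⟩
    rung₀ * (T - S) + (G * (T - T′) + ((- G) * (S - S′) + (0ℚ + G * (T′ - S′))))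
      ≡⟨ ring₃ G T S T′ S′ ⟩
    T - S ∎
    where
    open ≡-Reasoning
    G = g (suc (length sq))
    G° = g (length sq)
    ψ′ = ψ ((a , b) ∷ sq)
    T = y (top Fin.zero)
    S = y (bot Fin.zero)
    T′ = y (rest (leftT sq))
    S′ = y (rest (leftS sq))
    rung₀ = (½ - G * (0ℚ + ½)) - (G * (0ℚ + ½) - ½)
    ring₁ : ∀ G x → ½ - G * (x + ½) ≡ (½ - ½ * G) - G * x
    ring₁ = solve-∀ ℚ-ring
    ring₂ : ∀ G x → G * (x + ½) - ½ ≡ (½ * G - ½) - (- G) * x
    ring₂ = solve-∀ ℚ-ring
    ring₃ : ∀ G T S T′ S′ → ((½ - G * (0ℚ + ½)) - (G * (0ℚ + ½) - ½)) * (T - S) + (G * (T - T′) + ((- G) * (S - S′) + (0ℚ + G * (T′ - S′)))) ≡ T - S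
    ring₃ = solve-∀ ℚ-ring
    -- The potential at the next rung is given by the rest and also by continuing the path linearly.
    -- That the two agree is exactly the recurrence of `g`, with cofactor 1/2 on top and -1/2 at the
    -- bottom.
    end-T : ψ′ (rest (leftT sq)) ≡ (½ - ½ * G) - G * ι (suc a)
    end-T = ≡-trans (cong (λ z → G * (z + offset a b)) (ψ-leftT sq)) (modulo ½ (g-square {a} {b} eq (length sq)) (ring G G° (ι a) (ι b)))
      where
      ring : ∀ G G° a b → G * ((½ - ½ * G°) + ½ * (b - a)) ≡ ((½ - ½ * G) - G * (1ℚ + a)) + ½ * (G * ((1ℚ + a) + (1ℚ + b) + (1ℚ + 1ℚ) - G°) - 1ℚ)
      ring = solve-∀ ℚ-ring
    end-S : ψ′ (rest (leftS sq)) ≡ (½ * G - ½) - (- G) * ι (suc b)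
    end-S = ≡-trans (cong (λ z → G * (z + offset a b)) (ψ-leftS sq)) (modulo (- ½) (g-square {a} {b} eq (length sq)) (ring G G° (ι a) (ι b)))
      where
      ring : ∀ G G° a b → G * ((½ * G° - ½) + ½ * (b - a)) ≡ ((½ * G - ½) - (- G) * (1ℚ + b)) + (- ½) * (G * ((1ℚ + a) + (1ℚ + b) + (1ℚ + 1ℚ) - G°) - 1ℚ)
      ring = solve-∀ ℚ-ring
    top-part : energy (topPath a b sq) ψ′ y ≡ G * (T - T′)
    top-part = path-linear a top (rest (leftT sq)) ψ′ y (½ - ½ * G) G (λ j → ring₁ G (ι (toℕ j))) end-T
    bot-part : energy (botPath a b sq) ψ′ y ≡ (- G) * (S - S′)
    bot-part = path-linear b bot (rest (leftS sq)) ψ′ y (½ * G - ½) (- G) (λ j → ring₂ G (ι (toℕ j))) end-S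
    rest-part : energy (edgesOf sq) (λ v → G * (ψ sq v + offset a b)) (y ∘ rest) ≡ 0ℚ + G * (T′ - S′)
    rest-part = begin
      energy (edgesOf sq) (λ v → G * (ψ sq v + offset a b)) (y ∘ rest)
        ≡⟨ ∑-cong (edgesOf sq) (λ e → cong (_* (y (rest (proj₁ e)) - y (rest (proj₂ e)))) (ring G (ψ sq (proj₁ e)) (ψ sq (proj₂ e)) (offset a b))) ⟩
      energy (edgesOf sq) (λ v → 0ℚ + G * ψ sq v) (y ∘ rest)
        ≡⟨ energy-+* (edgesOf sq) (λ _ → 0ℚ) (ψ sq) (y ∘ rest) G ⟩
      energy (edgesOf sq) (λ _ → 0ℚ) (y ∘ rest) + G * energy (edgesOf sq) (ψ sq) (y ∘ rest)
        ≡⟨ cong₂ (λ p q → p + G * q) (energy-const (edgesOf sq) 0ℚ (y ∘ rest)) (ψ-energy sq bal (y ∘ rest)) ⟩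
      0ℚ + G * (T′ - S′) ∎
      where
      ring : ∀ G u v d → G * (u + d) - G * (v + d) ≡ (0ℚ + G * u) - (0ℚ + G * v)
      ring = solve-∀ ℚ-ring

  Γ-green : ∀ sq → Balanced c sq → ∀ u y → energy (edgesOf sq) (Γ sq u) y ≡ y u - ν sq y
  Γ-green [] bal t₀ y = ring (y t₀) (y s₀)
    where
    ring : ∀ t s → (½ * ½ - ½ * (- ½)) * (t - s) + 0ℚ ≡ t - ½ * (t + s)
    ring = solve-∀ ℚ-ring
  Γ-green [] bal s₀ y = ring (y t₀) (y s₀)
    where
    ring : ∀ t s → ((- ½) * ½ - (- ½) * (- ½)) * (t - s) + 0ℚ ≡ s - ½ * (t + s)
    ring = solve-∀ ℚ-ring
  Γ-green ((a , b) ∷ sq) (eq ∷ bal) u y = begin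
    energy (edgesOf sq′) (Γ sq′ u) y
      ≡⟨ energy-+* (edgesOf sq′) (β sq u) (ψ sq′) y (χ sq u) ⟩
    energy (edgesOf sq′) (β sq u) y + χ sq u * energy (edgesOf sq′) (ψ sq′) y
      ≡⟨ cong₂ (λ p q → p + χ sq u * q) (≡-trans (∑-edges-∷ a b sq (λ e → (β sq u (proj₁ e) - β sq u (proj₂ e)) * (y (proj₁ e) - y (proj₂ e)))) (β-energy u)) (ψ-energy sq′ (eq ∷ bal) y) ⟩
    (y u - ν sq′ y - χ sq u * (T - S)) + χ sq u * (T - S)
      ≡⟨ ring (y u - ν sq′ y) (χ sq u * (T - S)) ⟩
    y u - ν sq′ y ∎
    where
    open ≡-Reasoning
    sq′ : Squares
    sq′ = (a , b) ∷ sq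
    T = y (top Fin.zero)
    S = y (bot Fin.zero)
    T′ = y (rest (leftT sq))
    S′ = y (rest (leftS sq))
    ring : ∀ p q → (p - q) + q ≡ p
    ring = solve-∀ ℚ-ring
    split : V sq′ → ℚ
    split u = (β sq u (top Fin.zero) - β sq u (bot Fin.zero)) * (T - S)
      + (energy (topPath a b sq) (β sq u) y + (energy (botPath a b sq) (β sq u) y + energy (edgesOf sq) (β sq u ∘ rest) (y ∘ rest)))
    β-energy : ∀ u → split u ≡ y u - ν sq′ y - χ sq u * (T - S)
    β-energy (top x) = ≡-trans
      (cong (λ z → (β {a} {b} sq (top x) (top Fin.zero) - β {a} {b} sq (top x) (bot Fin.zero)) * (T - S) + z)
        (cong₂ _+_
          (path-min a top (rest (leftT sq)) (β sq (top x)) y (- (½ * X)) x (λ j → refl) (end X))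
          (cong₂ _+_
            (path-linear b bot (rest (leftS sq)) (β sq (top x)) y (½ * X) 0ℚ (λ j → flat X (ι (toℕ j))) (flat X (ι (suc b))))
            (energy-const (edgesOf sq) (½ * X) (y ∘ rest)))))
      (final X T S S′ (y (top x)))
      where
      X = ι (toℕ x)
      end : ∀ x → ½ * x ≡ - (½ * x) + x
      end = solve-∀ ℚ-ring
      flat : ∀ x i → ½ * x ≡ ½ * x - 0ℚ * i
      flat = solve-∀ ℚ-ring
      final : ∀ x t s s′ u → ((- (½ * x) + 0ℚ) - ½ * x) * (t - s) + ((u - t) + (0ℚ * (s - s′) + 0ℚ)) ≡ (u - ½ * (t + s)) - (x + ½) * (t - s)
      final = solve-∀ ℚ-ring
    β-energy (bot x) = ≡-trans
      (cong (λ z → (β {a} {b} sq (bot x) (top Fin.zero) - β {a} {b} sq (bot x) (bot Fin.zero)) * (T - S) + z)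
        (cong₂ _+_
          (path-linear a top (rest (leftT sq)) (β sq (bot x)) y (½ * X) 0ℚ (λ j → flat X (ι (toℕ j))) (flat X (ι (suc a))))
          (cong₂ _+_
            (path-min b bot (rest (leftS sq)) (β sq (bot x)) y (- (½ * X)) x (λ j → refl) (end X))
            (energy-const (edgesOf sq) (½ * X) (y ∘ rest)))))
      (final X T S T′ (y (bot x)))
      where
      X = ι (toℕ x)
      end : ∀ x → ½ * x ≡ - (½ * x) + x
      end = solve-∀ ℚ-ring
      flat : ∀ x i → ½ * x ≡ ½ * x - 0ℚ * i
      flat = solve-∀ ℚ-ring
      final : ∀ x t s t′ u → (½ * x - (- (½ * x) + 0ℚ)) * (t - s) + (0ℚ * (t - t′) + ((u - s) + 0ℚ)) ≡ (u - ½ * (t + s)) - (- (x + ½)) * (t - s)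
      final = solve-∀ ℚ-ring
    β-energy (rest v) = ≡-trans
      (cong (λ z → (β {a} {b} sq (rest v) (top Fin.zero) - β {a} {b} sq (rest v) (bot Fin.zero)) * (T - S) + z)
        (cong₂ _+_
          (path-linear a top (rest (leftT sq)) (β {a} {b} sq (rest v)) y (½ * X) (- ½) (λ j → line₁ X (ι (toℕ j)))
            (≡-trans (cong (_+ ½ * (½ * (ι (suc a) + ι (suc b)))) (Γ-leftT sq v)) (end₁ (ψ sq v) (ι a) (ι b))))
          (cong₂ _+_
            (path-linear b bot (rest (leftS sq)) (β {a} {b} sq (rest v)) y (- (½ * X)) (- ½) (λ j → line₂ X (ι (toℕ j)))
              (≡-trans (cong (_+ ½ * (½ * (ι (suc a) + ι (suc b)))) (Γ-leftS sq v)) (end₂ (ψ sq v) (ι a) (ι b))))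
            (≡-trans (energy-+k (edgesOf sq) (½ * (½ * (ι (suc a) + ι (suc b))))) (Γ-green sq bal v (y ∘ rest))))))
      (final X T S T′ S′ (y (rest v)))
      where
      X = ψ sq v + offset a b
      line₁ : ∀ x i → ½ * i + ½ * x ≡ ½ * x - (- ½) * i
      line₁ = solve-∀ ℚ-ring
      line₂ : ∀ x i → ½ * i - ½ * x ≡ - (½ * x) - (- ½) * i
      line₂ = solve-∀ ℚ-ring
      end₁ : ∀ p a b → ½ * p + ½ * (½ * ((1ℚ + a) + (1ℚ + b))) ≡ ½ * (p + ½ * (b - a)) - (- ½) * (1ℚ + a)
      end₁ = solve-∀ ℚ-ring
      end₂ : ∀ p a b → - (½ * p) + ½ * (½ * ((1ℚ + a) + (1ℚ + b))) ≡ - (½ * (p + ½ * (b - a))) - (- ½) * (1ℚ + b)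
      end₂ = solve-∀ ℚ-ring
      energy-+k : ∀ es k → energy es (λ w → Γ sq v w + k) (y ∘ rest) ≡ energy es (Γ sq v) (y ∘ rest)
      energy-+k es k = ∑-cong es λ e → cong (_* (y (rest (proj₁ e)) - y (rest (proj₂ e)))) (shift (Γ sq v (proj₁ e)) (Γ sq v (proj₂ e)) k)
        where
        shift : ∀ p q k → (p + k) - (q + k) ≡ p - q
        shift = solve-∀ ℚ-ring
      final : ∀ x t s t′ s′ u → ((½ * 0ℚ + ½ * x) - (½ * 0ℚ - ½ * x)) * (t - s) + ((- ½) * (t - t′) + ((- ½) * (s - s′) + (u - ½ * (t′ + s′))))
        ≡ (u - ½ * (t + s)) - (- x) * (t - s)
      final = solve-∀ ℚ-ring

-- The Kirchhoff index of a chain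

⅙ : ℚ
⅙ = pos 1 / 6

quadratic : ℚ → ℚ → ℚ → ℚ → ℚ
quadratic p A B C = A * p + B * (½ * (p * (p - 1ℚ))) + C * (⅙ * (p * (p - 1ℚ) * (p + p - 1ℚ)))

sumFin-quadratic : ∀ p A B C → sumFin p (λ x → A + B * ι (toℕ x) + C * (ι (toℕ x) * ι (toℕ x)))
  ≡ quadratic (ι p) A B C
sumFin-quadratic zero A B C = ring A B C
  where
  ring : ∀ A B C → 0ℚ ≡ A * 0ℚ + B * (½ * (0ℚ * (0ℚ - 1ℚ))) + C * (⅙ * (0ℚ * (0ℚ - 1ℚ) * (0ℚ + 0ℚ - 1ℚ)))
  ring = solve-∀ ℚ-ring
sumFin-quadratic (suc p) A B C = ≡-trans
  (cong ((A + B * 0ℚ + C * (0ℚ * 0ℚ)) +_) (≡-trans (sumFin-cong p λ x → shift A B C (ι (toℕ x))) (sumFin-quadratic p (A + B + C) (B + (C + C)) C)))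
  (ring A B C (ι p))
  where
  shift : ∀ A B C x → A + B * (1ℚ + x) + C * ((1ℚ + x) * (1ℚ + x)) ≡ (A + B + C) + (B + (C + C)) * x + C * (x * x)
  shift = solve-∀ ℚ-ring
  ring : ∀ A B C p → (A + B * 0ℚ + C * (0ℚ * 0ℚ)) + ((A + B + C) * p + (B + (C + C)) * (½ * (p * (p - 1ℚ))) + C * (⅙ * (p * (p - 1ℚ) * (p + p - 1ℚ))))
    ≡ A * (1ℚ + p) + B * (½ * ((1ℚ + p) * ((1ℚ + p) - 1ℚ))) + C * (⅙ * ((1ℚ + p) * ((1ℚ + p) - 1ℚ) * ((1ℚ + p) + (1ℚ + p) - 1ℚ)))
  ring = solve-∀ ℚ-ring

sumFin-min : ∀ p (x : Fin p) k → sumFin p (λ j → k + ι (toℕ j ℕ.⊓ toℕ x))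
  ≡ k * ι p + (ι p * ι (toℕ x) - ½ * (ι (toℕ x) * (ι (toℕ x) + 1ℚ)))
sumFin-min p@(suc _) Fin.zero k = ≡-trans
  (sumFin-cong p λ j → ≡-trans (cong (λ z → k + ι z) (ℕₚ.⊓-zeroʳ (toℕ j))) (ring₁ k (ι (toℕ j))))
  (≡-trans (sumFin-quadratic p k 0ℚ 0ℚ) (ring₂ k (ι p)))
  where
  ring₁ : ∀ k j → k + 0ℚ ≡ k + 0ℚ * j + 0ℚ * (j * j)
  ring₁ = solve-∀ ℚ-ring
  ring₂ : ∀ k p → k * p + 0ℚ * (½ * (p * (p - 1ℚ))) + 0ℚ * (⅙ * (p * (p - 1ℚ) * (p + p - 1ℚ))) ≡ k * p + (p * 0ℚ - ½ * (0ℚ * (0ℚ + 1ℚ)))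
  ring₂ = solve-∀ ℚ-ring
sumFin-min (suc p) (Fin.suc x) k = ≡-trans
  (cong ((k + 0ℚ) +_) (≡-trans (sumFin-cong p λ j → shift k (ι (toℕ j ℕ.⊓ toℕ x))) (sumFin-min p x (k + 1ℚ))))
  (ring k (ι p) (ι (toℕ x)))
  where
  shift : ∀ k i → k + (1ℚ + i) ≡ (k + 1ℚ) + i
  shift = solve-∀ ℚ-ring
  ring : ∀ k p x → (k + 0ℚ) + ((k + 1ℚ) * p + (p * x - ½ * (x * (x + 1ℚ)))) ≡ k * (1ℚ + p) + ((1ℚ + p) * (1ℚ + x) - ½ * ((1ℚ + x) * ((1ℚ + x) + 1ℚ)))
  ring = solve-∀ ℚ-ring

∑-combination : ∀ (xs : List A) (F f f′ h : A → ℚ) k l l′ → (∀ u → F u ≡ k * 1ℚ + l * f u + l′ * f′ u + h u) →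
  ∑ xs F ≡ k * ∑ xs (λ _ → 1ℚ) + l * ∑ xs f + l′ * ∑ xs f′ + ∑ xs h
∑-combination xs F f f′ h k l l′ eq = begin
  ∑ xs F
    ≡⟨ ∑-cong xs eq ⟩
  ∑ xs (λ u → k * 1ℚ + l * f u + l′ * f′ u + h u)
    ≡⟨ ∑-+ xs (λ u → k * 1ℚ + l * f u + l′ * f′ u) h ⟩
  ∑ xs (λ u → k * 1ℚ + l * f u + l′ * f′ u) + ∑ xs h
    ≡⟨ cong (_+ ∑ xs h) (∑-+ xs (λ u → k * 1ℚ + l * f u) (λ u → l′ * f′ u)) ⟩
  ∑ xs (λ u → k * 1ℚ + l * f u) + ∑ xs (λ u → l′ * f′ u) + ∑ xs h
    ≡⟨ cong₂ (λ p q → p + q + ∑ xs h) (∑-+ xs (λ _ → k * 1ℚ) (λ u → l * f u)) (∑-*ˡ xs l′ f′) ⟩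
  ∑ xs (λ _ → k * 1ℚ) + ∑ xs (λ u → l * f u) + l′ * ∑ xs f′ + ∑ xs h
    ≡⟨ cong₂ (λ p q → p + q + l′ * ∑ xs f′ + ∑ xs h) (∑-*ˡ xs k (λ _ → 1ℚ)) (∑-*ˡ xs l f) ⟩
  k * ∑ xs (λ _ → 1ℚ) + l * ∑ xs f + l′ * ∑ xs f′ + ∑ xs h ∎
  where open ≡-Reasoning

∑-∷ : ∀ a b sq (f : V ((a , b) ∷ sq) → ℚ) → ∑ (verticesOf ((a , b) ∷ sq)) f
  ≡ sumFin (suc a) (f ∘ top) + (sumFin (suc b) (f ∘ bot) + ∑ (verticesOf sq) (f ∘ rest))
∑-∷ a b sq f = ≡-trans (∑-++ (tabulate top) _ f) (cong₂ _+_ (∑-tabulate (suc a) top f)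
  (≡-trans (∑-++ (tabulate bot) _ f) (cong₂ _+_ (∑-tabulate (suc b) bot f) (∑-map rest (verticesOf sq) f))))

-- The parts of the recursions below that depend only on G, on the number m + 2 of edges of a polygon
-- and on the number n of vertices to its right.
S₂-const : ℚ → ℚ → ℚ
S₂-const G m = ((½ * ½) * m - (½ * ½) * G * (m * m) + (½ * ⅙) * (G * G) * (m * m * m - m))

tr-const : ℚ → ℚ → ℚ → ℚ
tr-const G m k = ((½ * ½) * (m * m) - (½ * ½) * m - (½ * ⅙) * G * (m * m * m - m) + (½ * ½) * (k * m))

tot-const : ℚ → ℚ → ℚ
tot-const m k = ((½ * ½) * (k * k * m) + (½ * ½) * (k * (½ * (m * m) - m)) + ⅙ * (m - (½ * ½) * (m * m * m)) + (½ * ½) * ((k + m) * (½ * (m * m) - m)))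

module Index (c : ℕ) (g : ℕ → ℚ) (g-zero : g 0 ≡ 0ℚ) (g-suc : ∀ r → g (suc r) * (κ c - g r) ≡ 1ℚ) where
  open Potentials c g g-zero g-suc

  -- `χ` is affine in `ψ` on the rest, so attaching a polygon brings in the first two moments of
  -- `ψ`. These five sums are closed under the recursion.
  #V S₁ S₂ tr tot : Squares → ℚ
  #V sq = ∑ (verticesOf sq) (λ _ → 1ℚ)
  S₁ sq = ∑ (verticesOf sq) (ψ sq)
  S₂ sq = ∑ (verticesOf sq) (λ v → ψ sq v * ψ sq v)
  tr sq = ∑ (verticesOf sq) (λ v → Γ sq v v)
  tot sq = ∑ (verticesOf sq) (λ u → ∑ (verticesOf sq) (Γ sq u))

  module Step (a b : ℕ) (sq : Squares) where
    G p q n° n⁺ m d w : ℚ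
    G = g (suc (length sq))
    p = ι (suc a)
    q = ι (suc b)
    m = p + q
    n° = #V sq
    n⁺ = n° + m
    d = offset a b
    -- The word enters `S₂-∷` and `tr-∷` through the same product of d and w, with coefficients G
    -- and -1; this lets the two merge in `Φ`.
    w = G * n⁺ * d - d + (G * S₁ sq + G * S₁ sq)

    sq⁺ : Squares
    sq⁺ = (a , b) ∷ sq

    parts : ∀ (f : V sq⁺ → ℚ) A B C A′ B′ C′ {z} → (∀ x → f (top x) ≡ A + B * ι (toℕ x) + C * (ι (toℕ x) * ι (toℕ x))) →
      (∀ y → f (bot y) ≡ A′ + B′ * ι (toℕ y) + C′ * (ι (toℕ y) * ι (toℕ y))) → ∑ (verticesOf sq) (f ∘ rest) ≡ z →
      ∑ (verticesOf sq⁺) f ≡ quadratic p A B C + (quadratic q A′ B′ C′ + z)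
    parts f A B C A′ B′ C′ e₁ e₂ e₃ = ≡-trans (∑-∷ a b sq f) (cong₂ _+_
      (≡-trans (sumFin-cong (suc a) e₁) (sumFin-quadratic (suc a) A B C))
      (cong₂ _+_ (≡-trans (sumFin-cong (suc b) e₂) (sumFin-quadratic (suc b) A′ B′ C′)) e₃))

    #V-∷ : #V sq⁺ ≡ n⁺
    #V-∷ = ≡-trans (parts (λ _ → 1ℚ) 1ℚ 0ℚ 0ℚ 1ℚ 0ℚ 0ℚ (λ x → r₁ (ι (toℕ x))) (λ y → r₁ (ι (toℕ y))) refl) (ring p q n°)
      where
      r₁ : ∀ x → 1ℚ ≡ 1ℚ + 0ℚ * x + 0ℚ * (x * x)
      r₁ = solve-∀ ℚ-ring
      ring : ∀ p q n → (1ℚ * p + 0ℚ * (½ * (p * (p - 1ℚ))) + 0ℚ * (⅙ * (p * (p - 1ℚ) * (p + p - 1ℚ)))) + ((1ℚ * q + 0ℚ * (½ * (q * (q - 1ℚ))) + 0ℚ * (⅙ * (q * (q - 1ℚ) * (q + q - 1ℚ)))) + n) ≡ n + (p + q)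
      ring = solve-∀ ℚ-ring

    S₁-∷ : S₁ sq⁺ ≡ G * n⁺ * d - d + G * S₁ sq
    S₁-∷ = ≡-trans (parts (ψ sq⁺) (½ - ½ * G) (- G) 0ℚ (½ * G - ½) G 0ℚ (λ x → r₁ G (ι (toℕ x))) (λ y → r₂ G (ι (toℕ y)))
        (≡-trans (∑-combination (verticesOf sq) (ψ sq⁺ ∘ rest) (ψ sq) (ψ sq) (λ _ → 0ℚ) (G * d) G 0ℚ (λ u → r₃ G d (ψ sq u)))
          (cong (λ z → G * d * n° + G * S₁ sq + 0ℚ * S₁ sq + z) (∑-0 (verticesOf sq)))))
      (r₄ G (ι a) (ι b) n° (S₁ sq))
      where
      r₁ : ∀ G x → ½ - G * (x + ½) ≡ (½ - ½ * G) + (- G) * x + 0ℚ * (x * x)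
      r₁ = solve-∀ ℚ-ring
      r₂ : ∀ G x → G * (x + ½) - ½ ≡ (½ * G - ½) + G * x + 0ℚ * (x * x)
      r₂ = solve-∀ ℚ-ring
      r₃ : ∀ G d u → G * (u + d) ≡ G * d * 1ℚ + G * u + 0ℚ * u + 0ℚ
      r₃ = solve-∀ ℚ-ring
      r₄ : ∀ G a b n S → ((½ - ½ * G) * (1ℚ + a) + (- G) * (½ * ((1ℚ + a) * ((1ℚ + a) - 1ℚ))) + 0ℚ * (⅙ * ((1ℚ + a) * ((1ℚ + a) - 1ℚ) * ((1ℚ + a) + (1ℚ + a) - 1ℚ)))) + (((½ * G - ½) * (1ℚ + b) + G * (½ * ((1ℚ + b) * ((1ℚ + b) - 1ℚ))) + 0ℚ * (⅙ * ((1ℚ + b) * ((1ℚ + b) - 1ℚ) * ((1ℚ + b) + (1ℚ + b) - 1ℚ))))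
        + (G * (½ * (b - a)) * n + G * S + 0ℚ * S + 0ℚ))
        ≡ G * (n + ((1ℚ + a) + (1ℚ + b))) * (½ * (b - a)) - (½ * (b - a)) + G * S
      r₄ = solve-∀ ℚ-ring

    S₂-∷ : S₂ sq⁺ ≡ G * G * S₂ sq + G * (d * w) + S₂-const G m
    S₂-∷ = ≡-trans (parts (λ v → ψ sq⁺ v * ψ sq⁺ v) ((½ - ½ * G) * (½ - ½ * G)) (G * G - G) (G * G) ((½ - ½ * G) * (½ - ½ * G)) (G * G - G) (G * G)
        (λ x → r₁ G (ι (toℕ x))) (λ y → r₂ G (ι (toℕ y)))
        (≡-trans (∑-combination (verticesOf sq) (λ v → ψ sq⁺ (rest v) * ψ sq⁺ (rest v)) (ψ sq) (λ v → ψ sq v * ψ sq v) (λ _ → 0ℚ) (G * G * (d * d)) (G * G * (d + d)) (G * G) (λ u → r₃ G d (ψ sq u)))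
          (cong (λ z → G * G * (d * d) * n° + G * G * (d + d) * S₁ sq + G * G * S₂ sq + z) (∑-0 (verticesOf sq)))))
      (r₄ G (ι a) (ι b) n° (S₁ sq) (S₂ sq))
      where
      r₁ : ∀ G x → (½ - G * (x + ½)) * (½ - G * (x + ½)) ≡ (½ - ½ * G) * (½ - ½ * G) + (G * G - G) * x + G * G * (x * x)
      r₁ = solve-∀ ℚ-ring
      r₂ : ∀ G x → (G * (x + ½) - ½) * (G * (x + ½) - ½) ≡ (½ - ½ * G) * (½ - ½ * G) + (G * G - G) * x + G * G * (x * x)
      r₂ = solve-∀ ℚ-ring
      r₃ : ∀ G d u → G * (u + d) * (G * (u + d)) ≡ G * G * (d * d) * 1ℚ + G * G * (d + d) * u + G * G * (u * u) + 0ℚ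
      r₃ = solve-∀ ℚ-ring
      r₄ : ∀ G a b n S S′ → (((½ - ½ * G) * (½ - ½ * G)) * (1ℚ + a) + (G * G - G) * (½ * ((1ℚ + a) * ((1ℚ + a) - 1ℚ))) + (G * G) * (⅙ * ((1ℚ + a) * ((1ℚ + a) - 1ℚ) * ((1ℚ + a) + (1ℚ + a) - 1ℚ)))) + ((((½ - ½ * G) * (½ - ½ * G)) * (1ℚ + b) + (G * G - G) * (½ * ((1ℚ + b) * ((1ℚ + b) - 1ℚ))) + (G * G) * (⅙ * ((1ℚ + b) * ((1ℚ + b) - 1ℚ) * ((1ℚ + b) + (1ℚ + b) - 1ℚ))))
        + (G * G * ((½ * (b - a)) * (½ * (b - a))) * n + G * G * ((½ * (b - a)) + (½ * (b - a))) * S + G * G * S′ + 0ℚ))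
        ≡ G * G * S′ + G * ((½ * (b - a)) * (G * (n + ((1ℚ + a) + (1ℚ + b))) * (½ * (b - a)) - (½ * (b - a)) + (G * S + G * S))) + ((½ * ½) * ((1ℚ + a) + (1ℚ + b)) - (½ * ½) * G * (((1ℚ + a) + (1ℚ + b)) * ((1ℚ + a) + (1ℚ + b))) + (½ * ⅙) * (G * G) * (((1ℚ + a) + (1ℚ + b)) * ((1ℚ + a) + (1ℚ + b)) * ((1ℚ + a) + (1ℚ + b)) - ((1ℚ + a) + (1ℚ + b))))
      r₄ = solve-∀ ℚ-ring

    tr-∷ : tr sq⁺ ≡ tr sq - G * S₂ sq - d * w + tr-const G m n°
    tr-∷ = ≡-trans (parts (λ v → Γ sq⁺ v v) ((½ * ½) - (½ * ½) * G) (1ℚ - G) (- G) ((½ * ½) - (½ * ½) * G) (1ℚ - G) (- G)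
        (λ x → ≡-trans (cong (λ z → - (½ * ι (toℕ x)) + ι z + (ι (toℕ x) + ½) * (½ - G * (ι (toℕ x) + ½))) (ℕₚ.⊓-idem (toℕ x))) (r₁ G (ι (toℕ x))))
        (λ y → ≡-trans (cong (λ z → - (½ * ι (toℕ y)) + ι z + (- (ι (toℕ y) + ½)) * (G * (ι (toℕ y) + ½) - ½)) (ℕₚ.⊓-idem (toℕ y))) (r₂ G (ι (toℕ y))))
        (∑-combination (verticesOf sq) (λ v → Γ sq⁺ (rest v) (rest v)) (ψ sq) (λ v → ψ sq v * ψ sq v) (λ v → Γ sq v v) (½ * (½ * m) - G * (d * d)) (- (G * (d + d))) (- G)
          (λ u → r₃ G d m (ψ sq u) (Γ sq u u))))
      (r₄ G (ι a) (ι b) n° (S₁ sq) (S₂ sq) (tr sq))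
      where
      r₁ : ∀ G x → - (½ * x) + x + (x + ½) * (½ - G * (x + ½)) ≡ ((½ * ½) - (½ * ½) * G) + (1ℚ - G) * x + (- G) * (x * x)
      r₁ = solve-∀ ℚ-ring
      r₂ : ∀ G x → - (½ * x) + x + (- (x + ½)) * (G * (x + ½) - ½) ≡ ((½ * ½) - (½ * ½) * G) + (1ℚ - G) * x + (- G) * (x * x)
      r₂ = solve-∀ ℚ-ring
      r₃ : ∀ G d m u z → (z + ½ * (½ * m)) + (- (u + d)) * (G * (u + d)) ≡ (½ * (½ * m) - G * (d * d)) * 1ℚ + (- (G * (d + d))) * u + (- G) * (u * u) + z
      r₃ = solve-∀ ℚ-ring
      r₄ : ∀ G a b n S S′ t → (((½ * ½) - (½ * ½) * G) * (1ℚ + a) + (1ℚ - G) * (½ * ((1ℚ + a) * ((1ℚ + a) - 1ℚ))) + (- G) * (⅙ * ((1ℚ + a) * ((1ℚ + a) - 1ℚ) * ((1ℚ + a) + (1ℚ + a) - 1ℚ)))) + ((((½ * ½) - (½ * ½) * G) * (1ℚ + b) + (1ℚ - G) * (½ * ((1ℚ + b) * ((1ℚ + b) - 1ℚ))) + (- G) * (⅙ * ((1ℚ + b) * ((1ℚ + b) - 1ℚ) * ((1ℚ + b) + (1ℚ + b) - 1ℚ))))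
        + ((½ * (½ * ((1ℚ + a) + (1ℚ + b))) - G * ((½ * (b - a)) * (½ * (b - a)))) * n + (- (G * ((½ * (b - a)) + (½ * (b - a))))) * S + (- G) * S′ + t))
        ≡ t - G * S′ - (½ * (b - a)) * (G * (n + ((1ℚ + a) + (1ℚ + b))) * (½ * (b - a)) - (½ * (b - a)) + (G * S + G * S)) + ((½ * ½) * (((1ℚ + a) + (1ℚ + b)) * ((1ℚ + a) + (1ℚ + b))) - (½ * ½) * ((1ℚ + a) + (1ℚ + b)) - (½ * ⅙) * G * (((1ℚ + a) + (1ℚ + b)) * ((1ℚ + a) + (1ℚ + b)) * ((1ℚ + a) + (1ℚ + b)) - ((1ℚ + a) + (1ℚ + b))) + (½ * ½) * (n * ((1ℚ + a) + (1ℚ + b))))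
      r₄ = solve-∀ ℚ-ring

    -- Row sums are quadratic in the position along a path, and on the rest they are affine in `ψ`
    -- apart from the old row sum. So the outer summation is again an instance of `parts`.
    row : V sq⁺ → ℚ
    row u = ∑ (verticesOf sq⁺) (Γ sq⁺ u)

    s⁺ : ℚ
    s⁺ = S₁ sq⁺

    row-β : ∀ u → row u ≡ ∑ (verticesOf sq⁺) (β sq u) + χ sq u * s⁺
    row-β u = ≡-trans (∑-+ (verticesOf sq⁺) (β sq u) (λ v → χ sq u * ψ sq⁺ v))
      (cong (∑ (verticesOf sq⁺) (β sq u) +_) (∑-*ˡ (verticesOf sq⁺) (χ sq u) (ψ sq⁺)))

    ∑-const : ∀ k → ∑ (verticesOf sq) (λ _ → k) ≡ k * n°
    ∑-const k = ≡-trans (∑-cong (verticesOf sq) λ _ → sym (ℚₚ.*-identityʳ k)) (∑-*ˡ (verticesOf sq) k (λ _ → 1ℚ))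

    sumFin-const : ∀ m k → sumFin m (λ _ → k) ≡ quadratic (ι m) k 0ℚ 0ℚ
    sumFin-const m k = ≡-trans (sumFin-cong m λ x → r₁ k (ι (toℕ x))) (sumFin-quadratic m k 0ℚ 0ℚ)
      where
      r₁ : ∀ k j → k ≡ k + 0ℚ * j + 0ℚ * (j * j)
      r₁ = solve-∀ ℚ-ring

    row-top : ∀ x → row (top x) ≡ ½ * s⁺ + (½ * p - ½ + ½ * (q + n°) + s⁺) * ι (toℕ x) + (- ½) * (ι (toℕ x) * ι (toℕ x))
    row-top x = ≡-trans (row-β (top x)) (≡-trans (cong (_+ (ι (toℕ x) + ½) * s⁺) (≡-trans (∑-∷ a b sq (β sq (top x)))
        (cong₂ _+_ (sumFin-min (suc a) x (- (½ * ι (toℕ x)))) (cong₂ _+_ (sumFin-const (suc b) (½ * ι (toℕ x))) (∑-const (½ * ι (toℕ x)))))))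
      (ring (ι (toℕ x)) p q n° s⁺))
      where
      ring : ∀ x p q n s → ((- (½ * x)) * p + (p * x - ½ * (x * (x + 1ℚ)))) + (((½ * x) * q + 0ℚ * (½ * (q * (q - 1ℚ))) + 0ℚ * (⅙ * (q * (q - 1ℚ) * (q + q - 1ℚ)))) + ½ * x * n) + (x + ½) * s
        ≡ ½ * s + (½ * p - ½ + ½ * (q + n) + s) * x + (- ½) * (x * x)
      ring = solve-∀ ℚ-ring

    row-bot : ∀ y → row (bot y) ≡ (- (½ * s⁺)) + (½ * q - ½ + ½ * (p + n°) - s⁺) * ι (toℕ y) + (- ½) * (ι (toℕ y) * ι (toℕ y))
    row-bot y = ≡-trans (row-β (bot y)) (≡-trans (cong (_+ (- (ι (toℕ y) + ½)) * s⁺) (≡-trans (∑-∷ a b sq (β sq (bot y)))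
        (cong₂ _+_ (sumFin-const (suc a) (½ * ι (toℕ y))) (cong₂ _+_ (sumFin-min (suc b) y (- (½ * ι (toℕ y)))) (∑-const (½ * ι (toℕ y)))))))
      (ring (ι (toℕ y)) p q n° s⁺))
      where
      ring : ∀ x p q n s → ((½ * x) * p + 0ℚ * (½ * (p * (p - 1ℚ))) + 0ℚ * (⅙ * (p * (p - 1ℚ) * (p + p - 1ℚ)))) + (((- (½ * x)) * q + (q * x - ½ * (x * (x + 1ℚ)))) + ½ * x * n) + (- (x + ½)) * s
        ≡ (- (½ * s)) + (½ * q - ½ + ½ * (p + n) - s) * x + (- ½) * (x * x)
      ring = solve-∀ ℚ-ring

    k° : ℚ
    k° = (½ * ½) * (p * p - p + (q * q - q)) + ½ * (½ * m) * n°

    row-rest : ∀ u → row (rest u) ≡ (k° + (½ * (p - q) - s⁺) * d) * 1ℚ + (½ * (p - q) - s⁺) * ψ sq u + 0ℚ * ψ sq u + ∑ (verticesOf sq) (Γ sq u)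
    row-rest u = ≡-trans (row-β (rest u)) (≡-trans (cong (_+ (- (ψ sq u + d)) * s⁺) (parts (β sq (rest u)) (½ * (ψ sq u + d)) ½ 0ℚ (- (½ * (ψ sq u + d))) ½ 0ℚ
        (λ x → r₁ (ι (toℕ x)) (ψ sq u + d)) (λ y → r₂ (ι (toℕ y)) (ψ sq u + d))
        (≡-trans (∑-+ (verticesOf sq) (Γ sq u) (λ _ → ½ * (½ * m))) (cong (∑ (verticesOf sq) (Γ sq u) +_) (∑-const (½ * (½ * m)))))))
      (r₃ (ψ sq u) d p q n° s⁺ (∑ (verticesOf sq) (Γ sq u))))
      where
      r₁ : ∀ x z → ½ * x + ½ * z ≡ ½ * z + ½ * x + 0ℚ * (x * x)
      r₁ = solve-∀ ℚ-ring
      r₂ : ∀ x z → ½ * x - ½ * z ≡ (- (½ * z)) + ½ * x + 0ℚ * (x * x)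
      r₂ = solve-∀ ℚ-ring
      r₃ : ∀ u d p q n s z → ((½ * (u + d)) * p + ½ * (½ * (p * (p - 1ℚ))) + 0ℚ * (⅙ * (p * (p - 1ℚ) * (p + p - 1ℚ)))) + (((- (½ * (u + d))) * q + ½ * (½ * (q * (q - 1ℚ))) + 0ℚ * (⅙ * (q * (q - 1ℚ) * (q + q - 1ℚ)))) + (z + ½ * (½ * (p + q)) * n)) + (- (u + d)) * s
        ≡ ((½ * ½) * (p * p - p + (q * q - q)) + ½ * (½ * (p + q)) * n + (½ * (p - q) - s) * d) * 1ℚ + (½ * (p - q) - s) * u + 0ℚ * u + z
      r₃ = solve-∀ ℚ-ring

    tot-∷ : tot sq⁺ ≡ tot sq - G * ((S₁ sq + n⁺ * d) * (S₁ sq + n⁺ * d)) + n⁺ * (d * d) + tot-const m n°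
    tot-∷ = ≡-trans (parts row (½ * s⁺) (½ * p - ½ + ½ * (q + n°) + s⁺) (- ½) (- (½ * s⁺)) (½ * q - ½ + ½ * (p + n°) - s⁺) (- ½)
        row-top row-bot (∑-combination (verticesOf sq) (row ∘ rest) (ψ sq) (ψ sq) (λ u → ∑ (verticesOf sq) (Γ sq u))
          (k° + (½ * (p - q) - s⁺) * d) (½ * (p - q) - s⁺) 0ℚ row-rest))
      (≡-trans (cong total S₁-∷) (ring G (ι a) (ι b) n° (S₁ sq) (tot sq)))
      where
      total : ℚ → ℚ
      total s = quadratic p (½ * s) (½ * p - ½ + ½ * (q + n°) + s) (- ½)
        + (quadratic q (- (½ * s)) (½ * q - ½ + ½ * (p + n°) - s) (- ½)
        + ((k° + (½ * (p - q) - s) * d) * n° + (½ * (p - q) - s) * S₁ sq + 0ℚ * S₁ sq + tot sq))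
      ring : ∀ G a b n S t → 
        ((½ * (G * (n + ((1ℚ + a) + (1ℚ + b))) * (½ * (b - a)) - (½ * (b - a)) + G * S)) * (1ℚ + a) + (½ * (1ℚ + a) - ½ + ½ * ((1ℚ + b) + n) + (G * (n + ((1ℚ + a) + (1ℚ + b))) * (½ * (b - a)) - (½ * (b - a)) + G * S)) * (½ * ((1ℚ + a) * ((1ℚ + a) - 1ℚ))) + (- ½) * (⅙ * ((1ℚ + a) * ((1ℚ + a) - 1ℚ) * ((1ℚ + a) + (1ℚ + a) - 1ℚ))))
        + (((- (½ * (G * (n + ((1ℚ + a) + (1ℚ + b))) * (½ * (b - a)) - (½ * (b - a)) + G * S))) * (1ℚ + b) + (½ * (1ℚ + b) - ½ + ½ * ((1ℚ + a) + n) - (G * (n + ((1ℚ + a) + (1ℚ + b))) * (½ * (b - a)) - (½ * (b - a)) + G * S)) * (½ * ((1ℚ + b) * ((1ℚ + b) - 1ℚ))) + (- ½) * (⅙ * ((1ℚ + b) * ((1ℚ + b) - 1ℚ) * ((1ℚ + b) + (1ℚ + b) - 1ℚ))))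
        + ((((½ * ½) * ((1ℚ + a) * (1ℚ + a) - (1ℚ + a) + ((1ℚ + b) * (1ℚ + b) - (1ℚ + b))) + ½ * (½ * ((1ℚ + a) + (1ℚ + b))) * n) + (½ * ((1ℚ + a) - (1ℚ + b)) - (G * (n + ((1ℚ + a) + (1ℚ + b))) * (½ * (b - a)) - (½ * (b - a)) + G * S)) * (½ * (b - a))) * n + (½ * ((1ℚ + a) - (1ℚ + b)) - (G * (n + ((1ℚ + a) + (1ℚ + b))) * (½ * (b - a)) - (½ * (b - a)) + G * S)) * S + 0ℚ * S + t))
        ≡ t - G * ((S + (n + ((1ℚ + a) + (1ℚ + b))) * (½ * (b - a))) * (S + (n + ((1ℚ + a) + (1ℚ + b))) * (½ * (b - a)))) + (n + ((1ℚ + a) + (1ℚ + b))) * ((½ * (b - a)) * (½ * (b - a))) + ((½ * ½) * (n * n * ((1ℚ + a) + (1ℚ + b))) + (½ * ½) * (n * (½ * (((1ℚ + a) + (1ℚ + b)) * ((1ℚ + a) + (1ℚ + b))) - ((1ℚ + a) + (1ℚ + b)))) + ⅙ * (((1ℚ + a) + (1ℚ + b)) - (½ * ½) * (((1ℚ + a) + (1ℚ + b)) * ((1ℚ + a) + (1ℚ + b)) * ((1ℚ + a) + (1ℚ + b)))) + (½ * ½) * ((n + ((1ℚ + a) + (1ℚ + b))) * (½ * (((1ℚ + a) + (1ℚ + b)) * ((1ℚ + a) + (1ℚ + b))) - ((1ℚ + a) + (1ℚ + b)))))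
      ring = solve-∀ ℚ-ring

  -- The recursions unrolled into a quadratic form in the offsets

  vertexCount : ℕ → ℚ
  vertexCount zero = 1ℚ + 1ℚ
  vertexCount (suc r) = vertexCount r + ι (2 ℕ.+ c)

  ρ : ℕ → ℚ
  ρ r = g r * vertexCount r - 1ℚ

  skew : List ℚ → ℚ
  skew [] = 0ℚ
  skew (d ∷ ds) = ρ (suc (length ds)) * d + g (suc (length ds)) * skew ds

  coupling : ℚ → ℚ → ℕ → ℚ
  coupling M k r = M * (1ℚ + k * g r) + k

  next : ℚ → ℕ → ℚ
  next k r = g r + k * (g r * g r)

  -- M is the number of vertices to the left of the current polygon.
  defect : ℚ → ℚ → List ℚ → ℚ
  defect M k [] = 0ℚ
  defect M k (d ∷ ds) = coupling M k r * (d * (ρ r * d + (g r * skew ds + g r * skew ds))) + defect (M + ι (2 ℕ.+ c)) (next k r) ds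
    where r = suc (length ds)

  base : ℚ → ℚ → ℕ → ℚ
  base N k zero = ½ * N - k * (½ * N)
  base N k (suc r) = N * tr-const G (ι (2 ℕ.+ c)) (vertexCount r) - tot-const (ι (2 ℕ.+ c)) (vertexCount r)
    - k * (N * S₂-const G (ι (2 ℕ.+ c))) + base N (next k (suc r)) r
    where G = g (suc r)

  sides : ∀ {a b} → a ℕ.+ b ≡ c → ι (suc a) + ι (suc b) ≡ ι (2 ℕ.+ c)
  sides {a} {b} refl = ≡-trans (ring (ι a) (ι b)) (cong (λ z → 1ℚ + (1ℚ + z)) (sym (ι-+ a b)))
    where
    ring : ∀ a b → (1ℚ + a) + (1ℚ + b) ≡ 1ℚ + (1ℚ + (a + b))
    ring = solve-∀ ℚ-ring

  #V-vertexCount : ∀ sq → Balanced c sq → #V sq ≡ vertexCount (length sq)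
  #V-vertexCount [] bal = refl
  #V-vertexCount ((a , b) ∷ sq) (eq ∷ bal) = ≡-trans (Step.#V-∷ a b sq) (cong₂ _+_ (#V-vertexCount sq bal) (sides {a} {b} eq))

  length-offsets : ∀ sq → length (offsetsOf sq) ≡ length sq
  length-offsets = Listₚ.length-map (λ (a , b) → offset a b)

  S₁-skew : ∀ sq → Balanced c sq → S₁ sq ≡ skew (offsetsOf sq)
  S₁-skew [] bal = refl
  S₁-skew ((a , b) ∷ sq) (eq ∷ bal) rewrite length-offsets sq =
    ≡-trans (Step.S₁-∷ a b sq) (≡-trans (cong₂ (λ x y → G * x * d - d + G * y)
      (cong₂ _+_ (#V-vertexCount sq bal) (sides {a} {b} eq)) (S₁-skew sq bal)) (ring G (vertexCount (suc (length sq))) d (skew (offsetsOf sq))))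
    where
    G = g (suc (length sq))
    d = offset a b
    ring : ∀ G n d s → G * n * d - d + G * s ≡ (G * n - 1ℚ) * d + G * s
    ring = solve-∀ ℚ-ring

  -- The combination that reproduces itself. Attaching a polygon contributes G (N S₂ - S₁²) through
  -- `tr` and `tot`, and k G² times the same bracket through the last term, so k becomes `next k`.
  -- What remains is a constant minus `coupling` times a quadratic expression in d. At k = 0, with N
  -- the number of vertices, it is the Kirchhoff index.
  Φ : ℚ → ℚ → Squares → ℚ
  Φ N k sq = N * tr sq - tot sq - k * (N * S₂ sq - S₁ sq * S₁ sq)

  Φ-defect : ∀ N M k sq → Balanced c sq → M ≡ N - vertexCount (length sq) → Φ N k sq ≡ base N k (length sq) - defect M k (offsetsOf sq)
  Φ-defect N M k [] bal eqM = ring N k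
    where
    ring : ∀ N k → N * (½ * ½ + ((- ½) * (- ½) + 0ℚ)) - ((½ * ½ + (½ * (- ½) + 0ℚ)) + (((- ½) * ½ + ((- ½) * (- ½) + 0ℚ)) + 0ℚ))
      - k * (N * (½ * ½ + ((- ½) * (- ½) + 0ℚ)) - (½ + ((- ½) + 0ℚ)) * (½ + ((- ½) + 0ℚ))) ≡ (½ * N - k * (½ * N)) - 0ℚ
    ring = solve-∀ ℚ-ring
  Φ-defect N M k ((a , b) ∷ sq) (eq ∷ bal) eqM rewrite length-offsets sq = begin
    Φ N k ((a , b) ∷ sq)
      ≡⟨ cong₂ (λ x y → N * x - y - k * (N * S₂ sq⁺ - S₁ sq⁺ * S₁ sq⁺)) tr-∷ tot-∷ ⟩
    N * TR - TOT - k * (N * S₂ sq⁺ - S₁ sq⁺ * S₁ sq⁺)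
      ≡⟨ cong₂ (λ x y → N * TR - TOT - k * (N * x - y * y)) S₂-∷ S₁-∷ ⟩
    N * TR - TOT - k * (N * SS - S * S)
      ≡⟨ step N k G n⁺ d (S₁ sq) (S₂ sq) (tr sq) (tot sq) (tr-const G m n°) (tot-const m n°) (S₂-const G m) ⟩
    (N * tr-const G m n° - tot-const m n° - k * (N * S₂-const G m)) + Φ N k′ sq
      - ((N - n⁺) * (1ℚ + k * G) + k) * (d * ((G * n⁺ - 1ℚ) * d + (G * S₁ sq + G * S₁ sq)))
      ≡⟨ cong (λ z → (N * tr-const G m n° - tot-const m n° - k * (N * S₂-const G m)) + z
           - ((N - n⁺) * (1ℚ + k * G) + k) * (d * ((G * n⁺ - 1ℚ) * d + (G * S₁ sq + G * S₁ sq))))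
           (Φ-defect N (M + μ) k′ sq bal (≡-trans (cong (_+ μ) eqM) (shift N (vertexCount (length sq)) μ))) ⟩
    constants m n° + (base N k′ (length sq) - rest-defect) - ((N - n⁺) * (1ℚ + k * G) + k) * (d * ((G * n⁺ - 1ℚ) * d + (G * S₁ sq + G * S₁ sq)))
      ≡⟨ cong₂ (λ x y → constants x y + (base N k′ (length sq) - rest-defect)
           - ((N - (y + x)) * (1ℚ + k * G) + k) * (d * ((G * (y + x) - 1ℚ) * d + (G * S₁ sq + G * S₁ sq)))) (sides {a} {b} eq) (#V-vertexCount sq bal) ⟩
    constants μ vc + (base N k′ (length sq) - rest-defect)
      - ((N - (vc + μ)) * (1ℚ + k * G) + k) * (d * ((G * (vc + μ) - 1ℚ) * d + (G * S₁ sq + G * S₁ sq)))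
      ≡⟨ cong₂ (λ x y → constants μ vc + (base N k′ (length sq) - rest-defect)
           - (x * (1ℚ + k * G) + k) * (d * ((G * (vc + μ) - 1ℚ) * d + (G * y + G * y)))) (sym eqM) (S₁-skew sq bal) ⟩
    constants μ vc + (base N k′ (length sq) - rest-defect)
      - (M * (1ℚ + k * G) + k) * (d * ((G * (vc + μ) - 1ℚ) * d + (G * skew (offsetsOf sq) + G * skew (offsetsOf sq))))
      ≡⟨ regroup (constants μ vc) (base N k′ (length sq)) rest-defect _ ⟩
    (constants μ vc + base N k′ (length sq))
      - ((M * (1ℚ + k * G) + k) * (d * ((G * (vc + μ) - 1ℚ) * d + (G * skew (offsetsOf sq) + G * skew (offsetsOf sq)))) + rest-defect) ∎
    where
    open ≡-Reasoning
    open Step a b sq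
    μ = ι (2 ℕ.+ c)
    vc = vertexCount (length sq)
    k′ = next k (suc (length sq))
    rest-defect = defect (M + μ) k′ (offsetsOf sq)
    TR = tr sq - G * S₂ sq - d * w + tr-const G m n°
    TOT = tot sq - G * ((S₁ sq + n⁺ * d) * (S₁ sq + n⁺ * d)) + n⁺ * (d * d) + tot-const m n°
    SS = G * G * S₂ sq + G * (d * w) + S₂-const G m
    S = G * n⁺ * d - d + G * S₁ sq
    constants : ℚ → ℚ → ℚ
    constants m n° = N * tr-const G m n° - tot-const m n° - k * (N * S₂-const G m)
    shift : ∀ N v μ → (N - (v + μ)) + μ ≡ N - v
    shift = solve-∀ ℚ-ring
    regroup : ∀ x y z u → x + (y - z) - u ≡ (x + y) - (u + z)
    regroup = solve-∀ ℚ-ring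
    step : ∀ N k G n d S S′ t o ct co cs →
      N * (t - G * S′ - d * (G * n * d - d + (G * S + G * S)) + ct) - (o - G * ((S + n * d) * (S + n * d)) + n * (d * d) + co)
        - k * (N * (G * G * S′ + G * (d * (G * n * d - d + (G * S + G * S))) + cs) - (G * n * d - d + G * S) * (G * n * d - d + G * S))
      ≡ (N * ct - co - k * (N * cs)) + (N * t - o - (G + k * (G * G)) * (N * S′ - S * S))
        - ((N - n) * (1ℚ + k * G) + k) * (d * ((G * n - 1ℚ) * d + (G * S + G * S)))
    step = solve-∀ ℚ-ring

  kirchhoff-chain : ∀ h sq → length sq ≡ h → Balanced c sq →
    IsKirchhoff (chainOf c h sq)
      (base (vertexCount h) 0ℚ h - defect 0ℚ 0ℚ (offsetsOf sq))
  kirchhoff-chain h sq refl bal = subst (IsKirchhoff (chainOf c h sq)) eq kirchhoff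
    where
    open Green (chainModel c h sq refl bal) (Γ sq) (ν sq) (Γ-green sq bal)
    ring : ∀ x y z → x - y ≡ x - y - 0ℚ * z
    ring = solve-∀ ℚ-ring
    eq : #V sq * tr sq - tot sq ≡ base (vertexCount h) 0ℚ h - defect 0ℚ 0ℚ (offsetsOf sq)
    eq = ≡-trans (ring (#V sq * tr sq) (tot sq) (#V sq * S₂ sq - S₁ sq * S₁ sq))
      (≡-trans (cong (λ z → Φ z 0ℚ sq) (#V-vertexCount sq bal))
        (Φ-defect (vertexCount h) 0ℚ 0ℚ sq bal (sym (ℚₚ.+-inverseʳ (vertexCount h)))))

-- The minimum of the defect

0≤+ : ∀ {x y} → 0ℚ ≤ℚ x → 0ℚ ≤ℚ y → 0ℚ ≤ℚ x + y
0≤+ = ℚₚ.+-mono-≤ {0ℚ} {_} {0ℚ}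

0<+ : ∀ {x y} → 0ℚ <ℚ x → 0ℚ ≤ℚ y → 0ℚ <ℚ x + y
0<+ = ℚₚ.+-mono-<-≤ {0ℚ} {_} {0ℚ}

0≤* : ∀ {x y} → 0ℚ ≤ℚ x → 0ℚ ≤ℚ y → 0ℚ ≤ℚ x * y
0≤* {x} {y} p q = subst (_≤ℚ x * y) (ℚₚ.*-zeroʳ x) (ℚₚ.*-monoˡ-≤-nonNeg x {{ℚ.nonNegative p}} q)

0<* : ∀ {x y} → 0ℚ <ℚ x → 0ℚ <ℚ y → 0ℚ <ℚ x * y
0<* {x} {y} p q = subst (_<ℚ x * y) (ℚₚ.*-zeroʳ x) (ℚₚ.*-monoʳ-<-pos x {{ℚ.positive p}} q)

0≤-cancel : ∀ {x y} → 0ℚ <ℚ x → 0ℚ ≤ℚ x * y → 0ℚ ≤ℚ y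
0≤-cancel {x} {y} p q = ℚₚ.*-cancelˡ-≤-pos x {{ℚ.positive p}} (subst (_≤ℚ x * y) (sym (ℚₚ.*-zeroʳ x)) q)

0≡-cancel : ∀ {x y} → 0ℚ <ℚ x → x * y ≡ 0ℚ → y ≡ 0ℚ
0≡-cancel {x} {y} p q = ℚₚ.≤-antisym
  (ℚₚ.*-cancelˡ-≤-pos x {{ℚ.positive p}} (ℚₚ.≤-reflexive (≡-trans q (sym (ℚₚ.*-zeroʳ x)))))
  (0≤-cancel p (ℚₚ.≤-reflexive (sym q)))

0≤-square : ∀ x → 0ℚ ≤ℚ x * x
0≤-square x with ℚₚ.≤-total 0ℚ x
... | inj₁ p = 0≤* p p
... | inj₂ p = subst (0ℚ ≤ℚ_) (ring x) (0≤* (ℚₚ.neg-antimono-≤ p) (ℚₚ.neg-antimono-≤ p))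
  where
  ring : ∀ x → (- x) * (- x) ≡ x * x
  ring = solve-∀ ℚ-ring

square-≡0 : ∀ {x} → x * x ≡ 0ℚ → x ≡ 0ℚ
square-≡0 {x} eq with ℚₚ.<-cmp 0ℚ x
... | tri< p _ _ = 0≡-cancel p eq
... | tri≈ _ p _ = sym p
... | tri> _ _ p = ≡-trans (ring x) (cong -_ (0≡-cancel (ℚₚ.neg-antimono-< p) (≡-trans (ring′ x) eq)))
  where
  ring : ∀ x → x ≡ - (- x)
  ring = solve-∀ ℚ-ring
  ring′ : ∀ x → (- x) * (- x) ≡ x * x
  ring′ = solve-∀ ℚ-ring

0≤-sum≡0 : ∀ {x y} → 0ℚ ≤ℚ x → 0ℚ ≤ℚ y → x + y ≡ 0ℚ → x ≡ 0ℚ × y ≡ 0ℚ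
0≤-sum≡0 {x} {y} p q eq = x≡0 , ≡-trans (sym (ℚₚ.+-identityˡ y)) (≡-trans (cong (_+ y) (sym x≡0)) eq)
  where
  x≡0 : x ≡ 0ℚ
  x≡0 = ℚₚ.≤-antisym (subst (x ≤ℚ_) eq (subst (_≤ℚ x + y) (ℚₚ.+-identityʳ x) (ℚₚ.+-monoʳ-≤ x q))) p

≤⇒0≤- : ∀ {x y} → x ≤ℚ y → 0ℚ ≤ℚ y - x
≤⇒0≤- {x} {y} p = subst (_≤ℚ y - x) (ℚₚ.+-inverseʳ x) (ℚₚ.+-monoˡ-≤ (- x) p)

0≤-⇒≤ : ∀ {x y} → 0ℚ ≤ℚ y - x → x ≤ℚ y
0≤-⇒≤ {x} {y} p = subst₂ _≤ℚ_ (ℚₚ.+-identityˡ x) (ring y x) (ℚₚ.+-monoˡ-≤ x p)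
  where
  ring : ∀ y x → y - x + x ≡ y
  ring = solve-∀ ℚ-ring

-≡0⇒≡ : ∀ {x y} → y - x ≡ 0ℚ → x ≡ y
-≡0⇒≡ {x} {y} p = ≡-trans (sym (ℚₚ.+-identityˡ x)) (≡-trans (cong (_+ x) (sym p)) (ring y x))
  where
  ring : ∀ y x → y - x + x ≡ y
  ring = solve-∀ ℚ-ring

0<⇒0≤ : ∀ {x} → 0ℚ <ℚ x → 0ℚ ≤ℚ x
0<⇒0≤ = ℚₚ.<⇒≤

0≤ι : ∀ m → 0ℚ ≤ℚ ι m
0≤ι zero = ℚₚ.≤-refl
0≤ι (suc m) = 0≤+ {1ℚ} (ℚₚ.nonNegative⁻¹ 1ℚ) (0≤ι m)

¼ : ℚ
¼ = ½ * ½

-- The last entry is left free, since the orientation of the last square does not matter.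
Interior : (ℚ → Set) → List ℚ → Set
Interior Q [] = ⊤
Interior Q (d ∷ []) = ⊤
Interior Q (d ∷ d′ ∷ ds) = Q d × Interior Q (d′ ∷ ds)

Alternating : List ℚ → Set
Alternating [] = ⊤
Alternating (d ∷ []) = ⊤
Alternating (d ∷ d′ ∷ []) = ⊤
Alternating (d ∷ d′ ∷ d″ ∷ ds) = d + d′ ≡ 0ℚ × Alternating (d′ ∷ d″ ∷ ds)

module Minimum (c : ℕ) (g : ℕ → ℚ) (g-zero : g 0 ≡ 0ℚ) (g-suc : ∀ r → g (suc r) * (κ c - g r) ≡ 1ℚ)
  (0<g : ∀ r → 0ℚ <ℚ g (suc r)) (g≤¼ : ∀ r → g r ≤ℚ ¼) where
  open Index c g g-zero g-suc

  m : ℚ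
  m = ι (2 ℕ.+ c)

  0≤g : ∀ r → 0ℚ ≤ℚ g r
  0≤g zero = ℚₚ.≤-reflexive (sym g-zero)
  0≤g (suc r) = 0<⇒0≤ (0<g r)

  0≤¼-g : ∀ r → 0ℚ ≤ℚ ¼ - g r
  0≤¼-g r = ≤⇒0≤- (g≤¼ r)

  0≤vertexCount-2 : ∀ r → 0ℚ ≤ℚ vertexCount r - (1ℚ + 1ℚ)
  0≤vertexCount-2 zero = ℚₚ.≤-refl
  0≤vertexCount-2 (suc r) = subst (0ℚ ≤ℚ_) (ring (vertexCount r) m) (0≤+ (0≤vertexCount-2 r) (0≤ι (2 ℕ.+ c)))
    where
    ring : ∀ v m → (v - (1ℚ + 1ℚ)) + m ≡ (v + m) - (1ℚ + 1ℚ)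
    ring = solve-∀ ℚ-ring

  0<vertexCount : ∀ r → 0ℚ <ℚ vertexCount r
  0<vertexCount r = subst (0ℚ <ℚ_) (ring (vertexCount r)) (0<+ {1ℚ + 1ℚ} (ℚₚ.positive⁻¹ (1ℚ + 1ℚ)) (0≤vertexCount-2 r))
    where
    ring : ∀ v → 1ℚ + 1ℚ + (v - (1ℚ + 1ℚ)) ≡ v
    ring = solve-∀ ℚ-ring

  -- A single cycle has c + 4 vertices and `g 1` is the inverse of this number. Hence the offset of
  -- the last square contributes nothing to `skew`.
  ρ-one : ρ 1 ≡ 0ℚ
  ρ-one = modulo 1ℚ (≡-trans (cong (λ z → g 1 * (κ c - z)) (sym g-zero)) (g-suc 0)) (ring (g 1) (ι c))
    where
    ring : ∀ G c → G * (1ℚ + 1ℚ + (1ℚ + (1ℚ + c))) - 1ℚ ≡ 0ℚ + 1ℚ * (G * ((1ℚ + (1ℚ + (1ℚ + (1ℚ + c)))) - 0ℚ) - 1ℚ)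
    ring = solve-∀ ℚ-ring

  -- The factor two is what `σ-gap` spends: once in the definition of `σ`, once in the gap itself.
  -- The bound g ≤ 1/4 leaves at least half of the vertex count as margin.
  ρ-gap : ∀ r → 0ℚ <ℚ ρ (2 ℕ.+ r) - (g (2 ℕ.+ r) * ρ (suc r) + g (2 ℕ.+ r) * ρ (suc r))
  ρ-gap r = subst (0ℚ <ℚ_) (sym (modulo 1ℚ (g-suc (suc r)) (ring (g (2 ℕ.+ r)) (g (suc r)) v (ι c))))
    (0<* (0<g (suc r)) (subst (0ℚ <ℚ_) (ring′ v (g (suc r)))
      (0<+ (0<* {½} (ℚₚ.positive⁻¹ ½) (0<vertexCount (suc r)))
        (0≤+ (0≤* (0<⇒0≤ (0<+ (0<vertexCount (suc r)) (0<⇒0≤ (0<vertexCount (suc r))))) (0≤¼-g (suc r))) (0≤g (suc r))))))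
    where
    v = vertexCount (suc r)
    ring : ∀ G G′ v c → (G * (v + (1ℚ + (1ℚ + c))) - 1ℚ) - (G * (G′ * v - 1ℚ) + G * (G′ * v - 1ℚ))
      ≡ G * (v - (G′ + G′) * v + G′) + 1ℚ * (G * ((1ℚ + (1ℚ + (1ℚ + (1ℚ + c)))) - G′) - 1ℚ)
    ring = solve-∀ ℚ-ring
    ring′ : ∀ v G → ½ * v + ((v + v) * (½ * ½ - G) + G) ≡ v - (G + G) * v + G
    ring′ = solve-∀ ℚ-ring

  -- The value of skew on an alternating list with head 1.
  σ : ℕ → ℚ
  σ zero = 0ℚ
  σ (suc r) = ρ (suc r) - g (suc r) * σ r

  σ-one : σ 1 ≡ 0ℚ
  σ-one = ≡-trans (cong (λ z → z - g 1 * 0ℚ) ρ-one) (ring (g 1))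
    where
    ring : ∀ g → 0ℚ - g * 0ℚ ≡ 0ℚ
    ring = solve-∀ ℚ-ring

  mutual
    0≤σ : ∀ r → 0ℚ ≤ℚ σ r
    0≤σ zero = ℚₚ.≤-refl
    0≤σ (suc zero) = ℚₚ.≤-reflexive (sym σ-one)
    0≤σ (suc (suc r)) = subst (0ℚ ≤ℚ_) (ring (σ (2 ℕ.+ r)) (g (2 ℕ.+ r) * σ (suc r)))
      (0≤+ (0<⇒0≤ (σ-gap r)) (0≤* (0≤g (2 ℕ.+ r)) (0≤σ (suc r))))
      where
      ring : ∀ x y → (x - y) + y ≡ x
      ring = solve-∀ ℚ-ring

    -- Expanding `σ` twice leaves the gap of `ρ` plus a nonnegative multiple of `σ r`, two steps
    -- back.
    σ-gap : ∀ r → 0ℚ <ℚ σ (2 ℕ.+ r) - g (2 ℕ.+ r) * σ (suc r)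
    σ-gap r = subst (0ℚ <ℚ_) (ring (ρ (2 ℕ.+ r)) (g (2 ℕ.+ r)) (ρ (suc r)) (g (suc r)) (σ r))
      (0<+ (ρ-gap r) (0≤* (0≤* (0≤+ (0≤g (2 ℕ.+ r)) (0≤g (2 ℕ.+ r))) (0≤g (suc r))) (0≤σ r)))
      where
      ring : ∀ R G R′ G′ s → (R - (G * R′ + G * R′)) + (G + G) * G′ * s ≡ (R - G * (R′ - G′ * s)) - G * (R′ - G′ * s)
      ring = solve-∀ ℚ-ring

  0<σ : ∀ r → 0ℚ <ℚ σ (2 ℕ.+ r)
  0<σ r = subst (0ℚ <ℚ_) (ring (σ (2 ℕ.+ r)) (g (2 ℕ.+ r) * σ (suc r)))
    (0<+ (σ-gap r) (0≤* (0≤g (2 ℕ.+ r)) (0≤σ (suc r))))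
    where
    ring : ∀ x y → (x - y) + y ≡ x
    ring = solve-∀ ℚ-ring

  -- The deviation of `skew` from its value on the alternating list with the same head. By `tail-∷`
  -- and `tail-singleton` it depends on the list only through the sums of neighbours.
  tail : List ℚ → ℚ
  tail [] = 0ℚ
  tail (d ∷ ds) = skew (d ∷ ds) - σ (suc (length ds)) * d

  tail-∷ : ∀ d d′ ds → let r = suc (length ds) in tail (d ∷ d′ ∷ ds) ≡ g (suc r) * (tail (d′ ∷ ds) + σ r * (d + d′))
  tail-∷ d d′ ds = ring (ρ (2 ℕ.+ length ds)) d (g (2 ℕ.+ length ds)) (skew (d′ ∷ ds)) (σ (suc (length ds))) d′
    where
    ring : ∀ R d G s σ d′ → (R * d + G * s) - (R - G * σ) * d ≡ G * ((s - σ * d′) + σ * (d + d′))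
    ring = solve-∀ ℚ-ring

  tail-singleton : ∀ d → tail (d ∷ []) ≡ 0ℚ
  tail-singleton d = ring (ρ 1) d (g 1)
    where
    ring : ∀ R d G → (R * d + G * 0ℚ) - (R - G * 0ℚ) * d ≡ 0ℚ
    ring = solve-∀ ℚ-ring

  slack : ℚ → ℚ → ℚ → ℕ → ℚ
  slack M k μ r = coupling M k r - μ

  γ : ℚ → ℚ → ℚ → ℕ → ℚ
  γ M k μ zero = 0ℚ
  γ M k μ (suc r) = slack M k μ (suc r) * σ (suc r) - μ * (g (suc r) * σ r)

  squares : ℚ → ℚ → ℚ → List ℚ → ℚ
  squares M k μ [] = 0ℚ
  squares M k μ (d ∷ ds) = γ M k μ r * (d * d) + squares (M + m) (next k r) (g r * slack M k μ r) ds
    where r = suc (length ds)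

  -- With t the tail of the remaining list, 2 d (t + σ d′) equals 2 (d + d′) t + σ (d + d′)² - σ d²
  -- - (2 d′ t + σ d′²). The first two terms are the crossing, the third is charged to `γ`, and the
  -- last is the debt that the next polygon takes over; so the next μ is `g r * slack`.
  crossings : ℚ → ℚ → ℚ → List ℚ → ℚ
  crossings M k μ [] = 0ℚ
  crossings M k μ (d ∷ []) = 0ℚ
  crossings M k μ (d ∷ d′ ∷ ds) =
    slack M k μ (suc r) * g (suc r) * ((d + d′) * tail (d′ ∷ ds) + (d + d′) * tail (d′ ∷ ds) + σ r * ((d + d′) * (d + d′)))
      + crossings (M + m) (next k (suc r)) (g (suc r) * slack M k μ (suc r)) (d′ ∷ ds)
    where r = suc (length ds)

  -- Completing squares in the sums of neighbouring entries; μ is the multiple of the head's share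
  -- σ d² + 2 d t that the next step absorbs.
  defect-decomposition : ∀ M k μ d ds → let r = suc (length ds) in defect M k (d ∷ ds) ≡
    μ * (σ r * (d * d) + (d * tail (d ∷ ds) + d * tail (d ∷ ds))) + (squares M k μ (d ∷ ds) + crossings M k μ (d ∷ ds))
  defect-decomposition M k μ d [] = ring (coupling M k 1) d (ρ 1) (g 1) μ
    where
    ring : ∀ Q d R G μ → Q * (d * (R * d + (G * 0ℚ + G * 0ℚ))) + 0ℚ ≡
      μ * ((R - G * 0ℚ) * (d * d) + (d * ((R * d + G * 0ℚ) - (R - G * 0ℚ) * d) + d * ((R * d + G * 0ℚ) - (R - G * 0ℚ) * d)))
      + ((((Q - μ) * (R - G * 0ℚ) - μ * (G * 0ℚ)) * (d * d) + 0ℚ) + 0ℚ)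
    ring = solve-∀ ℚ-ring
  defect-decomposition M k μ d (d′ ∷ ds) =
    ≡-trans (cong (λ z → coupling M k r * (d * (ρ r * d + (g r * skew (d′ ∷ ds) + g r * skew (d′ ∷ ds)))) + z)
      (defect-decomposition (M + m) (next k r) (g r * slack M k μ r) d′ ds))
    (ring (coupling M k r) d d′ (ρ r) (g r) (skew (d′ ∷ ds)) (σ (suc (length ds))) μ
      (squares (M + m) (next k r) (g r * slack M k μ r) (d′ ∷ ds)) (crossings (M + m) (next k r) (g r * slack M k μ r) (d′ ∷ ds)))
    where
    r = suc (suc (length ds))
    ring : ∀ Q d e R G s S μ sq cr →
      Q * (d * (R * d + (G * s + G * s))) + (G * (Q - μ) * (S * (e * e) + (e * (s - S * e) + e * (s - S * e))) + (sq + cr)) ≡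
      μ * ((R - G * S) * (d * d) + (d * ((R * d + G * s) - (R - G * S) * d) + d * ((R * d + G * s) - (R - G * S) * d)))
      + ((((Q - μ) * (R - G * S) - μ * (G * S)) * (d * d) + sq)
      + ((Q - μ) * G * ((d + e) * (s - S * e) + (d + e) * (s - S * e) + S * ((d + e) * (d + e))) + cr))
    ring = solve-∀ ℚ-ring

  -- The invariant carried from polygon to polygon. Its core is `gap`: the coupling exceeds twice
  -- the debt μ. Together with `σ-gap` this makes `γ` positive.
  record Admissible (M k μ : ℚ) (r : ℕ) : Set where
    field
      0≤M : 0ℚ ≤ℚ M
      0≤k : 0ℚ ≤ℚ k
      k≤½ : 0ℚ ≤ℚ ½ - k
      0≤μ : 0ℚ ≤ℚ μ
      gap : 0ℚ <ℚ slack M k μ r - μ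

    0<slack : 0ℚ <ℚ slack M k μ r
    0<slack = subst (0ℚ <ℚ_) (ring (slack M k μ r) μ) (0<+ gap 0≤μ)
      where
      ring : ∀ s μ → (s - μ) + μ ≡ s
      ring = solve-∀ ℚ-ring

  module Step⁺ {M k μ : ℚ} {r : ℕ} (adm : Admissible M k μ (suc r)) where
    open Admissible adm

    k⁺ μ⁺ : ℚ
    k⁺ = next k (suc r)
    μ⁺ = g (suc r) * slack M k μ (suc r)

    0≤k⁺ : 0ℚ ≤ℚ k⁺
    0≤k⁺ = 0≤+ (0≤g (suc r)) (0≤* 0≤k (0≤* (0≤g (suc r)) (0≤g (suc r))))

    k⁺≤½ : 0ℚ ≤ℚ ½ - k⁺
    -- At g = 1/4 and k = 1/2 the new k is 9/32, which leaves 7/32; the other summands vanish there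
    -- and are nonnegative below.
    k⁺≤½ = subst (0ℚ ≤ℚ_) (ring (g (suc r)) k)
      (0≤+ {pos 7 / 32} (ℚₚ.nonNegative⁻¹ (pos 7 / 32)) (0≤+ (0≤* {pos 9 / 8} (ℚₚ.nonNegative⁻¹ (pos 9 / 8)) (0≤¼-g (suc r)))
        (0≤+ (0≤* (0≤* {½} (ℚₚ.nonNegative⁻¹ ½) (0≤g (suc r))) (0≤¼-g (suc r))) (0≤* k≤½ (0≤* (0≤g (suc r)) (0≤g (suc r)))))))
      where
      ring : ∀ g k → (pos 7 / 32) + ((pos 9 / 8) * (½ * ½ - g) + (½ * g * (½ * ½ - g) + (½ - k) * (g * g))) ≡ ½ - (g + k * (g * g))
      ring = solve-∀ ℚ-ring

    admissible : ∀ r′ → Admissible (M + m) k⁺ μ⁺ r′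
    admissible r′ = record
      { 0≤M = 0≤+ 0≤M (0≤ι (2 ℕ.+ c))
      ; 0≤k = 0≤k⁺
      ; k≤½ = k⁺≤½
      ; 0≤μ = 0≤* (0≤g (suc r)) (0<⇒0≤ 0<slack)
      -- With g ≤ 1/4 and k ≤ 1/2, twice g times the old coupling is at most 9/16 M + 1/4. The new
      -- coupling is at least M + 2 + c, whence the constants 7/16 and 7/4.
      ; gap = subst (0ℚ <ℚ_) (ring M k μ (g (suc r)) k⁺ (g r′) (ι c))
          (0<+ {pos 7 / 4} (ℚₚ.positive⁻¹ (pos 7 / 4)) (0≤+ (0≤ι c)
          (0≤+ (0≤* {pos 7 / 16} (ℚₚ.nonNegative⁻¹ (pos 7 / 16)) 0≤M)
          (0≤+ (0≤* (0≤* {½} (ℚₚ.nonNegative⁻¹ ½) 0≤M) (0≤* k≤½ (0≤g (suc r))))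
          (0≤+ (0≤* (0≤* {¼} (ℚₚ.nonNegative⁻¹ ¼) 0≤M) (0≤¼-g (suc r)))
          (0≤+ (0≤* {½} (ℚₚ.nonNegative⁻¹ ½) k≤½)
          (0≤+ (0≤* (0≤+ 0≤M (0≤ι (2 ℕ.+ c))) (0≤* 0≤k⁺ (0≤g r′)))
          (0≤+ 0≤k⁺
          (0≤+ (0≤* (0≤+ (0≤g (suc r)) (0≤g (suc r))) 0≤μ)
            (0≤* (0≤+ (0≤¼-g (suc r)) (0≤¼-g (suc r))) 0≤coupling))))))))))
      }
      where
      0≤coupling : 0ℚ ≤ℚ coupling M k (suc r)
      0≤coupling = subst (0ℚ ≤ℚ_) (ring₀ (coupling M k (suc r)) μ) (0≤+ (0<⇒0≤ 0<slack) 0≤μ)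
        where
        ring₀ : ∀ s μ → (s - μ) + μ ≡ s
        ring₀ = solve-∀ ℚ-ring
      -- The slack left after replacing the factors g ≤ ¼ and k ≤ ½ by their bounds.
      ring : ∀ M k μ g k⁺ g′ c →
        (pos 7 / 4) + (c + ((pos 7 / 16) * M + (½ * M * ((½ - k) * g) + (½ * ½ * M * (½ * ½ - g) + (½ * (½ - k)
          + ((M + (1ℚ + (1ℚ + c))) * (k⁺ * g′) + (k⁺ + ((g + g) * μ + ((½ * ½ - g) + (½ * ½ - g)) * (M * (1ℚ + k * g) + k)))))))))
        ≡ ((M + (1ℚ + (1ℚ + c))) * (1ℚ + k⁺ * g′) + k⁺ - g * ((M * (1ℚ + k * g) + k) - μ)) - g * ((M * (1ℚ + k * g) + k) - μ)
      ring = solve-∀ ℚ-ring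

  0<γ : ∀ {M k μ r} → Admissible M k μ (2 ℕ.+ r) → 0ℚ <ℚ γ M k μ (2 ℕ.+ r)
  0<γ {M} {k} {μ} {r} adm = subst (0ℚ <ℚ_) (ring (slack M k μ (2 ℕ.+ r)) μ (σ (2 ℕ.+ r)) (g (2 ℕ.+ r)) (σ (suc r)))
    (0<+ (0<* gap (0<σ r)) (0≤* 0≤μ (0<⇒0≤ (σ-gap r))))
    where
    open Admissible adm
    ring : ∀ s μ S G S′ → (s - μ) * S + μ * (S - G * S′) ≡ s * S - μ * (G * S′)
    ring = solve-∀ ℚ-ring

  -- The crossings contain mixed terms of either sign, so nonnegativity alone does not pass through
  -- the induction. The stronger claim is that they dominate μ t² / σ, cleared of the denominator
  -- because `σ 1` is zero. `strict` carries the equality case along.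
  record Bound (M k μ : ℚ) (ds : List ℚ) : Set where
    field
      0≤C : 0ℚ ≤ℚ crossings M k μ ds
      bound : 0ℚ ≤ℚ σ (length ds) * crossings M k μ ds - μ * (tail ds * tail ds)
      strict : σ (length ds) * crossings M k μ ds - μ * (tail ds * tail ds) ≡ 0ℚ → tail ds ≡ 0ℚ × crossings M k μ ds ≡ 0ℚ
    C = crossings M k μ ds
    t = tail ds

  module Crossings {M k μ : ℚ} (d d′ d″ : ℚ) (ds : List ℚ) (adm : Admissible M k μ (3 ℕ.+ length ds))
    (ih : Bound (M + m) (next k (3 ℕ.+ length ds)) (g (3 ℕ.+ length ds) * slack M k μ (3 ℕ.+ length ds)) (d′ ∷ d″ ∷ ds)) where
    open Admissible adm
    r = suc (length ds)
    G = g (2 ℕ.+ r)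
    Λ = slack M k μ (2 ℕ.+ r)
    S = σ (2 ℕ.+ r)
    S′ = σ (suc r)
    C = crossings M k μ (d ∷ d′ ∷ d″ ∷ ds)
    t = tail (d ∷ d′ ∷ d″ ∷ ds)
    module IH = Bound ih

    0<GS′ : 0ℚ <ℚ G * S′
    0<GS′ = 0<* (0<g (suc r)) (0<σ (length ds))

    -- Multiplying by S′ completes the square: with f = d + d′ and t′ the old tail, S′ (2 f t′ + S′
    -- f²) is (t′ + S′ f)² - t′², and `tail-∷` identifies G (t′ + S′ f) with the new tail. The
    -- leftover -t′² is what the inductive bound pays for.
    C-split : G * S′ * C ≡ Λ * (t * t) + G * (S′ * IH.C - G * Λ * (IH.t * IH.t))
    C-split = ≡-trans (ring G S′ Λ (d + d′) IH.t IH.C) (cong (λ z → Λ * (z * z) + G * (S′ * IH.C - G * Λ * (IH.t * IH.t))) (sym (tail-∷ d d′ (d″ ∷ ds))))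
      where
      ring : ∀ G S Λ f t C → G * S * (Λ * G * (f * t + f * t + S * (f * f)) + C) ≡ Λ * (G * (t + S * f) * (G * (t + S * f))) + G * (S * C - G * Λ * (t * t))
      ring = solve-∀ ℚ-ring

    0≤Λt² : 0ℚ ≤ℚ Λ * (t * t)
    0≤Λt² = 0≤* (0<⇒0≤ 0<slack) (0≤-square t)

    0≤rest : 0ℚ ≤ℚ G * (S′ * IH.C - G * Λ * (IH.t * IH.t))
    0≤rest = 0≤* (0≤g (2 ℕ.+ r)) IH.bound

    -- The margin beyond μ t² has coefficient Λ S - μ G S′, which is `γ` once more. Its positivity
    -- thus serves the diagonal part and the crossings alike.
    split : G * S′ * (S * C - μ * (t * t)) ≡ γ M k μ (2 ℕ.+ r) * (t * t) + S * (G * (S′ * IH.C - G * Λ * (IH.t * IH.t)))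
    split = ≡-trans (ring₁ (G * S′) S C (μ * (t * t))) (≡-trans (cong (λ z → S * z - G * S′ * (μ * (t * t))) C-split)
      (ring₂ S Λ (t * t) (G * (S′ * IH.C - G * Λ * (IH.t * IH.t))) μ (G * S′)))
      where
      ring₁ : ∀ x S C y → x * (S * C - y) ≡ S * (x * C) - x * y
      ring₁ = solve-∀ ℚ-ring
      ring₂ : ∀ S Λ t e μ x → S * (Λ * t + e) - x * (μ * t) ≡ (Λ * S - μ * x) * t + S * e
      ring₂ = solve-∀ ℚ-ring

    0≤γt² : 0ℚ ≤ℚ γ M k μ (2 ℕ.+ r) * (t * t)
    0≤γt² = 0≤* (0<⇒0≤ (0<γ adm)) (0≤-square t)

    result : Bound M k μ (d ∷ d′ ∷ d″ ∷ ds)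
    result = record
      { 0≤C = 0≤-cancel 0<GS′ (subst (0ℚ ≤ℚ_) (sym C-split) (0≤+ 0≤Λt² 0≤rest))
      ; bound = 0≤-cancel 0<GS′ (subst (0ℚ ≤ℚ_) (sym split) (0≤+ 0≤γt² (0≤* (0≤σ (2 ℕ.+ r)) 0≤rest)))
      ; strict = λ eq → let
          γt²≡0 = proj₁ (0≤-sum≡0 0≤γt² (0≤* (0≤σ (2 ℕ.+ r)) 0≤rest) (≡-trans (sym split) (≡-trans (cong (G * S′ *_) eq) (ℚₚ.*-zeroʳ (G * S′)))))
          t≡0 = square-≡0 (0≡-cancel (0<γ adm) γt²≡0)
          in t≡0 , 0≡-cancel (0<σ r) (≡-trans (ring (S * C) μ) (≡-trans (cong (λ z → S * C - μ * (z * z)) (sym t≡0)) eq))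
      }
      where
      ring : ∀ x μ → x ≡ x - μ * (0ℚ * 0ℚ)
      ring = solve-∀ ℚ-ring

    -- Equality kills the new tail and puts the inductive bound at equality, so the old tail
    -- vanishes too. `tail-∷` then leaves only a positive multiple of d + d′.
    vanishing : C ≡ 0ℚ → d + d′ ≡ 0ℚ × IH.C ≡ 0ℚ
    vanishing C≡0 = 0≡-cancel (0<σ (length ds)) Sf≡0 , proj₂ t′C′
      where
      zeros : Λ * (t * t) ≡ 0ℚ × G * (S′ * IH.C - G * Λ * (IH.t * IH.t)) ≡ 0ℚ
      zeros = 0≤-sum≡0 0≤Λt² 0≤rest (≡-trans (sym C-split) (≡-trans (cong (G * S′ *_) C≡0) (ℚₚ.*-zeroʳ (G * S′))))
      t≡0 : t ≡ 0ℚ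
      t≡0 = square-≡0 (0≡-cancel 0<slack (proj₁ zeros))
      t′C′ : IH.t ≡ 0ℚ × IH.C ≡ 0ℚ
      t′C′ = IH.strict (0≡-cancel (0<g (suc r)) (proj₂ zeros))
      Sf≡0 : S′ * (d + d′) ≡ 0ℚ
      Sf≡0 = ≡-trans (sym (ℚₚ.+-identityˡ (S′ * (d + d′)))) (≡-trans (cong (_+ S′ * (d + d′)) (sym (proj₁ t′C′)))
        (0≡-cancel (0<g (suc r)) (≡-trans (sym (tail-∷ d d′ (d″ ∷ ds))) t≡0)))

  -- The final square has `σ 1` = 0 and tail 0, so its crossing with the last inner polygon
  -- disappears whatever the offsets are.
  crossings-pair : ∀ M k μ d d′ → crossings M k μ (d ∷ d′ ∷ []) ≡ 0ℚ
  crossings-pair M k μ d d′ = ≡-trans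
    (cong₂ (λ x y → slack M k μ 2 * g 2 * ((d + d′) * x + (d + d′) * x + y * ((d + d′) * (d + d′))) + 0ℚ) (tail-singleton d′) σ-one)
    (ring (slack M k μ 2 * g 2) (d + d′))
    where
    ring : ∀ x f → x * (f * 0ℚ + f * 0ℚ + 0ℚ * (f * f)) + 0ℚ ≡ 0ℚ
    ring = solve-∀ ℚ-ring

  tail-pair : ∀ d d′ → tail (d ∷ d′ ∷ []) ≡ 0ℚ
  tail-pair d d′ = ≡-trans (tail-∷ d d′ []) (≡-trans (cong₂ (λ x y → g 2 * (x + y * (d + d′))) (tail-singleton d′) σ-one) (ring (g 2) (d + d′)))
    where
    ring : ∀ g f → g * (0ℚ + 0ℚ * f) ≡ 0ℚ
    ring = solve-∀ ℚ-ring

  Bound-zero : ∀ {M k μ ds} → tail ds ≡ 0ℚ → crossings M k μ ds ≡ 0ℚ → Bound M k μ ds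
  Bound-zero {M} {k} {μ} {ds} t≡0 C≡0 = record
    { 0≤C = ℚₚ.≤-reflexive (sym C≡0)
    ; bound = ℚₚ.≤-reflexive (sym (≡-trans (cong₂ (λ x y → σ (length ds) * x - μ * (y * y)) C≡0 t≡0) (ring (σ (length ds)) μ)))
    ; strict = λ _ → t≡0 , C≡0
    }
    where
    ring : ∀ S μ → S * 0ℚ - μ * (0ℚ * 0ℚ) ≡ 0ℚ
    ring = solve-∀ ℚ-ring

  crossings-bound : ∀ {M k μ} d ds → Admissible M k μ (suc (length ds)) → Bound M k μ (d ∷ ds)
  crossings-bound d [] adm = Bound-zero (tail-singleton d) refl
  crossings-bound {M} {k} {μ} d (d′ ∷ []) adm = Bound-zero (tail-pair d d′) (crossings-pair M k μ d d′)
  crossings-bound d (d′ ∷ d″ ∷ ds) adm = Crossings.result d d′ d″ ds adm (crossings-bound d′ (d″ ∷ ds) (Step⁺.admissible adm _))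

  crossings-zero : ∀ {M k μ} d ds → Admissible M k μ (suc (length ds)) → crossings M k μ (d ∷ ds) ≡ 0ℚ → Alternating (d ∷ ds)
  crossings-zero d [] adm eq = tt
  crossings-zero d (d′ ∷ []) adm eq = tt
  crossings-zero d (d′ ∷ d″ ∷ ds) adm eq =
    let adm′ = Step⁺.admissible adm _
        f≡0 , C≡0 = Crossings.vanishing d d′ d″ ds adm (crossings-bound d′ (d″ ∷ ds) adm′) eq
    in f≡0 , crossings-zero d′ (d″ ∷ ds) adm′ C≡0

  alternating-crossings : ∀ M k μ d ds → Alternating (d ∷ ds) → crossings M k μ (d ∷ ds) ≡ 0ℚ
  alternating-crossings M k μ d [] alt = refl
  alternating-crossings M k μ d (d′ ∷ []) alt = crossings-pair M k μ d d′
  alternating-crossings M k μ d (d′ ∷ d″ ∷ ds) (f≡0 , alt) = ≡-trans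
    (cong₂ _+_ (cong (λ f → slack M k μ r * g r * (f * tail (d′ ∷ d″ ∷ ds) + f * tail (d′ ∷ d″ ∷ ds) + σ (2 ℕ.+ length ds) * (f * f))) f≡0)
      (alternating-crossings (M + m) (next k r) (g r * slack M k μ r) d′ (d″ ∷ ds) alt))
    (ring (slack M k μ r * g r) (tail (d′ ∷ d″ ∷ ds)) (σ (2 ℕ.+ length ds)))
    where
    r = 3 ℕ.+ length ds
    ring : ∀ x t S → x * (0ℚ * t + 0ℚ * t + S * (0ℚ * 0ℚ)) + 0ℚ ≡ 0ℚ
    ring = solve-∀ ℚ-ring

  -- The diagonal part against a common lower bound D of the squares

  weight : ℚ → ℚ → ℚ → ℕ → ℚ
  weight M k μ zero = 0ℚ
  weight M k μ (suc r) = γ M k μ (suc r) + weight (M + m) (next k (suc r)) (g (suc r) * slack M k μ (suc r)) r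

  γ-one : ∀ M k μ x → γ M k μ 1 * x ≡ 0ℚ
  γ-one M k μ x = ≡-trans (cong (λ z → (slack M k μ 1 * z - μ * (g 1 * 0ℚ)) * x) σ-one) (ring (slack M k μ 1) μ (g 1) x)
    where
    ring : ∀ s μ g x → (s * 0ℚ - μ * (g * 0ℚ)) * x ≡ 0ℚ
    ring = solve-∀ ℚ-ring

  excess : ℚ → ℚ → ℚ → ℚ → List ℚ → ℚ
  excess D M k μ ds = squares M k μ ds - D * weight M k μ (length ds)

  excess-singleton : ∀ D M k μ d → excess D M k μ (d ∷ []) ≡ 0ℚ
  excess-singleton D M k μ d = ≡-trans
    (ring (γ M k μ 1 * (d * d)) D (γ M k μ 1)) (≡-trans (cong₂ (λ x y → x - D * y) (γ-one M k μ (d * d)) (≡-trans (sym (ℚₚ.*-identityʳ (γ M k μ 1))) (γ-one M k μ 1ℚ))) (ring′ D))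
    where
    ring : ∀ x D y → (x + 0ℚ) - D * (y + 0ℚ) ≡ x - D * y
    ring = solve-∀ ℚ-ring
    ring′ : ∀ D → 0ℚ - D * 0ℚ ≡ 0ℚ
    ring′ = solve-∀ ℚ-ring

  excess-∷ : ∀ D M k μ d d′ ds → let r = 2 ℕ.+ length ds in excess D M k μ (d ∷ d′ ∷ ds) ≡
    γ M k μ r * (d * d - D) + excess D (M + m) (next k r) (g r * slack M k μ r) (d′ ∷ ds)
  excess-∷ D M k μ d d′ ds = ring (γ M k μ r) (d * d) D (squares (M + m) (next k r) (g r * slack M k μ r) (d′ ∷ ds))
    (weight (M + m) (next k r) (g r * slack M k μ r) (length (d′ ∷ ds)))
    where
    r = 2 ℕ.+ length ds
    ring : ∀ y d D s w → (y * d + s) - D * (y + w) ≡ y * (d - D) + (s - D * w)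
    ring = solve-∀ ℚ-ring

  0≤excess : ∀ {D M k μ} d ds → Admissible M k μ (suc (length ds)) → Interior (λ d → D ≤ℚ d * d) (d ∷ ds) → 0ℚ ≤ℚ excess D M k μ (d ∷ ds)
  0≤excess {D} {M} {k} {μ} d [] adm int = ℚₚ.≤-reflexive (sym (excess-singleton D M k μ d))
  0≤excess {D} {M} {k} {μ} d (d′ ∷ ds) adm (p , int) = subst (0ℚ ≤ℚ_) (sym (excess-∷ D M k μ d d′ ds))
    (0≤+ (0≤* (0<⇒0≤ (0<γ adm)) (≤⇒0≤- p)) (0≤excess d′ ds (Step⁺.admissible adm _) int))

  excess-zero : ∀ {D M k μ} d ds → Admissible M k μ (suc (length ds)) → Interior (λ d → D ≤ℚ d * d) (d ∷ ds) →
    excess D M k μ (d ∷ ds) ≡ 0ℚ → Interior (λ d → D ≡ d * d) (d ∷ ds)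
  excess-zero d [] adm int eq = tt
  excess-zero {D} {M} {k} {μ} d (d′ ∷ ds) adm (p , int) eq =
    let adm′ = Step⁺.admissible adm _
        e₁ , e₂ = 0≤-sum≡0 (0≤* (0<⇒0≤ (0<γ adm)) (≤⇒0≤- p)) (0≤excess d′ ds adm′ int) (≡-trans (sym (excess-∷ D M k μ d d′ ds)) eq)
    in -≡0⇒≡ (0≡-cancel (0<γ adm) e₁) , excess-zero d′ ds adm′ int e₂

  interior-excess : ∀ D M k μ d ds → Interior (λ d → D ≡ d * d) (d ∷ ds) → excess D M k μ (d ∷ ds) ≡ 0ℚ
  interior-excess D M k μ d [] int = excess-singleton D M k μ d
  interior-excess D M k μ d (d′ ∷ ds) (refl , int) = ≡-trans (excess-∷ D M k μ d d′ ds)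
    (≡-trans (cong (γ M k μ r * (d * d - d * d) +_) (interior-excess D (M + m) (next k r) (g r * slack M k μ r) d′ ds int)) (ring (γ M k μ r) (d * d)))
    where
    r = 2 ℕ.+ length ds
    ring : ∀ y d → y * (d - d) + 0ℚ ≡ 0ℚ
    ring = solve-∀ ℚ-ring

  module Start (ds : List ℚ) (d : ℚ) where
    r = suc (length ds)
    k₁ = next 0ℚ (suc r)

    admissible₁ : Admissible (0ℚ + m) k₁ 0ℚ r
    admissible₁ = record
      { 0≤M = 0≤+ {0ℚ} ℚₚ.≤-refl (0≤ι (2 ℕ.+ c))
      ; 0≤k = 0≤k
      ; k≤½ = subst (0ℚ ≤ℚ_) (ring (g (suc r))) (0≤+ {¼} (ℚₚ.nonNegative⁻¹ ¼) (0≤¼-g (suc r)))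
      ; 0≤μ = ℚₚ.≤-refl
      ; gap = subst (0ℚ <ℚ_) (ring′ (ι c) (k₁ * g r) k₁)
          (0<+ {1ℚ + 1ℚ} (ℚₚ.positive⁻¹ (1ℚ + 1ℚ)) (0≤+ (0≤ι c) (0≤+ (0≤* (0≤ι (2 ℕ.+ c)) (0≤* 0≤k (0≤g r))) 0≤k)))
      }
      where
      0≤k : 0ℚ ≤ℚ k₁
      0≤k = 0≤+ (0≤g (suc r)) (0≤* {0ℚ} ℚₚ.≤-refl (0≤* (0≤g (suc r)) (0≤g (suc r))))
      ring : ∀ g → ½ * ½ + (½ * ½ - g) ≡ ½ - (g + 0ℚ * (g * g))
      ring = solve-∀ ℚ-ring
      ring′ : ∀ c x k → 1ℚ + 1ℚ + (c + ((1ℚ + (1ℚ + c)) * x + k)) ≡ ((0ℚ + (1ℚ + (1ℚ + c))) * (1ℚ + x) + k - 0ℚ) - 0ℚ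
      ring′ = solve-∀ ℚ-ring

    minimum : ℚ → ℚ
    minimum D = D * weight (0ℚ + m) k₁ 0ℚ r

    -- The first square carries no weight: there are no vertices to its left.
    defect-split : ∀ D e → defect 0ℚ 0ℚ (e ∷ d ∷ ds) ≡ minimum D + (excess D (0ℚ + m) k₁ 0ℚ (d ∷ ds) + crossings (0ℚ + m) k₁ 0ℚ (d ∷ ds))
    defect-split D e = ≡-trans (cong (coupling 0ℚ 0ℚ (suc r) * (e * (ρ (suc r) * e + (g (suc r) * skew (d ∷ ds) + g (suc r) * skew (d ∷ ds)))) +_)
        (defect-decomposition (0ℚ + m) k₁ 0ℚ d ds))
      (ring (g (suc r)) (e * (ρ (suc r) * e + (g (suc r) * skew (d ∷ ds) + g (suc r) * skew (d ∷ ds))))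
        (σ r * (d * d) + (d * tail (d ∷ ds) + d * tail (d ∷ ds))) (squares (0ℚ + m) k₁ 0ℚ (d ∷ ds)) (crossings (0ℚ + m) k₁ 0ℚ (d ∷ ds))
        D (weight (0ℚ + m) k₁ 0ℚ r))
      where
      ring : ∀ G x y s C D w → (0ℚ * (1ℚ + 0ℚ * G) + 0ℚ) * x + (0ℚ * y + (s + C)) ≡ D * w + ((s - D * w) + C)
      ring = solve-∀ ℚ-ring

  -- Sees the list only through its length, so that different words can be compared with one value.
  minimumOf : ℚ → ℕ → ℚ
  minimumOf D zero = 0ℚ
  minimumOf D (suc r) = D * weight (0ℚ + m) (next 0ℚ (2 ℕ.+ r)) 0ℚ (suc r)

  defect-singleton : ∀ e → defect 0ℚ 0ℚ (e ∷ []) ≡ 0ℚ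
  defect-singleton e = ring (g 1) (e * (ρ 1 * e + (g 1 * 0ℚ + g 1 * 0ℚ)))
    where
    ring : ∀ G x → (0ℚ * (1ℚ + 0ℚ * G) + 0ℚ) * x + 0ℚ ≡ 0ℚ
    ring = solve-∀ ℚ-ring

  defect-minimum : ∀ {D} e ds → Interior (λ d → D ≤ℚ d * d) ds → minimumOf D (length ds) ≤ℚ defect 0ℚ 0ℚ (e ∷ ds)
  defect-minimum e [] int = ℚₚ.≤-reflexive (sym (defect-singleton e))
  defect-minimum {D} e (d ∷ ds) int = 0≤-⇒≤ ( subst (0ℚ ≤ℚ_)
    (≡-trans (ring (minimum D) _) (cong (_- minimum D) (sym (defect-split D e))))
    (0≤+ (0≤excess d ds admissible₁ int) (Bound.0≤C (crossings-bound d ds admissible₁))))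
    where
    open Start ds d
    ring : ∀ x y → y ≡ x + y - x
    ring = solve-∀ ℚ-ring

  defect-attained : ∀ {D} e ds → Interior (λ d → D ≡ d * d) ds → Alternating ds →
    defect 0ℚ 0ℚ (e ∷ ds) ≡ minimumOf D (length ds)
  defect-attained e [] int alt = defect-singleton e
  defect-attained {D} e (d ∷ ds) int alt = ≡-trans (defect-split D e) (≡-trans
    (cong₂ (λ x y → minimum D + (x + y)) (interior-excess D (0ℚ + m) k₁ 0ℚ d ds int) (alternating-crossings (0ℚ + m) k₁ 0ℚ d ds alt))
    (ℚₚ.+-identityʳ (minimum D)))
    where open Start ds d

  defect-minimisers : ∀ {D} e ds → Interior (λ d → D ≤ℚ d * d) ds →
    defect 0ℚ 0ℚ (e ∷ ds) ≡ minimumOf D (length ds) → Interior (λ d → D ≡ d * d) ds × Alternating ds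
  defect-minimisers e [] int eq = tt , tt
  defect-minimisers {D} e (d ∷ ds) int eq =
    let e₁ , e₂ = 0≤-sum≡0 (0≤excess d ds admissible₁ int) (Bound.0≤C (crossings-bound d ds admissible₁)) sum≡0
    in excess-zero d ds admissible₁ int e₁ , crossings-zero d ds admissible₁ e₂
    where
    open Start ds d
    x = excess D (0ℚ + m) k₁ 0ℚ (d ∷ ds) + crossings (0ℚ + m) k₁ 0ℚ (d ∷ ds)
    ring : ∀ x y → y ≡ x + y - x
    ring = solve-∀ ℚ-ring
    sum≡0 : x ≡ 0ℚ
    sum≡0 = ≡-trans (ring (minimum D) x) (≡-trans (cong (_- minimum D) (≡-trans (sym (defect-split D e)) eq)) (ℚₚ.+-inverseʳ (minimum D)))

-- Turning a chain upside down

∑-path-map : ∀ (φ : A → A′) v a (f : Fin a → A) w (F : A′ × A′ → ℚ) →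
  ∑ (path v a f w) (F ∘ both φ) ≡ ∑ (path (φ v) a (φ ∘ f) (φ w)) F
∑-path-map φ v zero f w F = refl
∑-path-map φ v (suc a) f w F = cong (F (φ v , φ (f Fin.zero)) +_) (∑-path-map φ (f Fin.zero) a (f ∘ Fin.suc) w F)

∑-path-cong : ∀ v a {f f′ : Fin a → A} {w w′} (F : A × A → ℚ) → f ≗ f′ → w ≡ w′ → ∑ (path v a f w) F ≡ ∑ (path v a f′ w′) F
∑-path-cong v zero F eq refl = refl
∑-path-cong v (suc a) {f} {f′} {w} F eq refl = cong₂ _+_ (cong (λ z → F (v , z)) (eq Fin.zero))
  (≡-trans (cong (λ z → ∑ (path z a (f ∘ Fin.suc) w) F) (eq Fin.zero)) (∑-path-cong (f′ Fin.zero) a F (eq ∘ Fin.suc) refl))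

∑-path-snoc : ∀ v a (f : Fin (suc a) → A) w (F : A × A → ℚ) →
  ∑ (path v (suc a) f w) F ≡ ∑ (path v a (f ∘ inject₁) (f (fromℕ a))) F + F (f (fromℕ a) , w)
∑-path-snoc v zero f w F = ring (F (v , f Fin.zero)) (F (f Fin.zero , w))
  where
  ring : ∀ x y → x + (y + 0ℚ) ≡ (x + 0ℚ) + y
  ring = solve-∀ ℚ-ring
∑-path-snoc v (suc a) f w F = ≡-trans (cong (F (v , f Fin.zero) +_) (∑-path-snoc (f Fin.zero) a (f ∘ Fin.suc) w F))
  (sym (ℚₚ.+-assoc (F (v , f Fin.zero)) (∑ (path (f Fin.zero) a (f ∘ Fin.suc ∘ inject₁) (f (fromℕ (suc a)))) F) (F (f (fromℕ (suc a)) , w))))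

-- The last square is kept: there the reflection is composed with a reflection of the outer path.
data Swapped (e : ℕ) : Squares → Squares → Set where
  end : Swapped e ((suc e , e) ∷ []) ((suc e , e) ∷ [])
  swapped : ∀ {a b sq sq′} → Swapped e sq sq′ → Swapped e ((a , b) ∷ sq) ((b , a) ∷ sq′)

Swapped-sym : ∀ {e sq sq′} → Swapped e sq sq′ → Swapped e sq′ sq
Swapped-sym end = end
Swapped-sym (swapped s) = swapped (Swapped-sym s)

-- The last cycle has 2e + 5 vertices. The reflection exchanging the ends of its left rung fixes the
-- opposite vertex `rest t₀`; the outermost top vertex, which has no partner among the `bot`, goes
-- to `rest s₀`.
flip-last : ∀ {e} {x : Fin (2 ℕ.+ e)} → Top.View x → V ((suc e , e) ∷ [])
flip-last Top.‵fromℕ = rest s₀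
flip-last (Top.‵inject₁ y) = bot y

flip : ∀ {e sq sq′} → Swapped e sq sq′ → V sq → V sq′
flip end (top x) = flip-last (Top.view x)
flip end (bot y) = top (inject₁ y)
flip end (rest t₀) = rest t₀
flip {e} end (rest s₀) = top (fromℕ (suc e))
flip (swapped s) (top x) = bot x
flip (swapped s) (bot y) = top y
flip (swapped s) (rest v) = rest (flip s v)

flip-involutive : ∀ {e sq sq′} (s : Swapped e sq sq′) v → flip (Swapped-sym s) (flip s v) ≡ v
flip-involutive {e} end (top x) with Top.view x
... | Top.‵fromℕ = refl
... | Top.‵inject₁ y = refl
flip-involutive end (bot y) = cong flip-last (Top.view-inject₁ y)
flip-involutive end (rest t₀) = refl
flip-involutive {e} end (rest s₀) = cong flip-last (Top.view-fromℕ (suc e))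
flip-involutive (swapped s) (top x) = refl
flip-involutive (swapped s) (bot y) = refl
flip-involutive (swapped s) (rest v) = cong rest (flip-involutive s v)

Swapped-sym-involutive : ∀ {e sq sq′} (s : Swapped e sq sq′) → Swapped-sym (Swapped-sym s) ≡ s
Swapped-sym-involutive end = refl
Swapped-sym-involutive (swapped s) = cong swapped (Swapped-sym-involutive s)

flip-leftT : ∀ {e sq sq′} (s : Swapped e sq sq′) → flip s (leftT sq) ≡ leftS sq′
flip-leftT end = refl
flip-leftT (swapped s) = refl

flip-leftS : ∀ {e sq sq′} (s : Swapped e sq sq′) → flip s (leftS sq) ≡ leftT sq′
flip-leftS end = refl
flip-leftS (swapped s) = refl

onEdge : (A → A → ℚ) → A × A → ℚ
onEdge f e = f (proj₁ e) (proj₂ e)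

-- In the last square the top path becomes the bottom path followed by the last rung, the last rung
-- becomes the final edge of the top path, and the bottom path becomes what is left of the top one.
-- Some edges are reversed on the way, hence the symmetry of `f`.
flip-edges : ∀ {e sq sq′} (s : Swapped e sq sq′) (f : V sq′ → V sq′ → ℚ) → (∀ u v → f u v ≡ f v u) →
  ∑ (edgesOf sq) (onEdge f ∘ both (flip s)) ≡ ∑ (edgesOf sq′) (onEdge f)
flip-edges {e} end f f-sym = begin
  ∑ (edgesOf sq) (F ∘ both φ)
    ≡⟨ ∑-edges-∷ (suc e) e [] (F ∘ both φ) ⟩
  F (bot Fin.zero , top Fin.zero) + (∑ (topPath (suc e) e []) (F ∘ both φ) + (∑ (botPath (suc e) e []) (F ∘ both φ) + (F (rest t₀ , z) + 0ℚ)))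
    ≡⟨ cong₂ _+_ (f-sym (bot Fin.zero) (top Fin.zero)) (cong₂ _+_ top-part (cong₂ _+_ bot-part (cong (_+ 0ℚ) (f-sym (rest t₀) z)))) ⟩
  F (top Fin.zero , bot Fin.zero) + ((∑ (botPath (suc e) e []) F + F (rest s₀ , rest t₀)) + (∑ shortened F + (F (z , rest t₀) + 0ℚ)))
    ≡⟨ ring (F (top Fin.zero , bot Fin.zero)) (∑ (botPath (suc e) e []) F) (F (rest s₀ , rest t₀)) (∑ shortened F) (F (z , rest t₀)) ⟩
  F (top Fin.zero , bot Fin.zero) + ((∑ shortened F + F (z , rest t₀)) + (∑ (botPath (suc e) e []) F + (F (rest s₀ , rest t₀) + 0ℚ)))
    ≡⟨ cong₂ (λ x y → F (top Fin.zero , bot Fin.zero) + (x + (∑ (botPath (suc e) e []) F + (y + 0ℚ))))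
         (sym (∑-path-snoc (top Fin.zero) e (top ∘ Fin.suc) (rest t₀) F)) (f-sym (rest s₀) (rest t₀)) ⟩
  F (top Fin.zero , bot Fin.zero) + (∑ (topPath (suc e) e []) F + (∑ (botPath (suc e) e []) F + (F (rest t₀ , rest s₀) + 0ℚ)))
    ≡⟨ ∑-edges-∷ (suc e) e [] F ⟨
  ∑ (edgesOf sq) F ∎
  where
  open ≡-Reasoning
  sq : Squares
  sq = (suc e , e) ∷ []
  φ : V sq → V sq
  φ = flip end
  F : V sq × V sq → ℚ
  F = onEdge f
  z : V sq
  z = top (fromℕ (suc e))
  shortened : List (V sq × V sq)
  shortened = path (top Fin.zero) e (top ∘ Fin.suc ∘ inject₁) z
  ring : ∀ r b x t y → r + ((b + x) + (t + (y + 0ℚ))) ≡ r + ((t + y) + (b + (x + 0ℚ)))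
  ring = solve-∀ ℚ-ring
  φ-inject₁ : ∀ y → φ (top (inject₁ y)) ≡ bot y
  φ-inject₁ y = cong flip-last (Top.view-inject₁ y)
  φ-fromℕ : φ z ≡ rest s₀
  φ-fromℕ = cong flip-last (Top.view-fromℕ (suc e))
  top-part : ∑ (topPath (suc e) e []) (F ∘ both φ) ≡ ∑ (botPath (suc e) e []) F + F (rest s₀ , rest t₀)
  top-part = ≡-trans (∑-path-map φ (top Fin.zero) (suc e) (top ∘ Fin.suc) (rest t₀) F)
    (≡-trans (∑-path-snoc (bot Fin.zero) e (φ ∘ top ∘ Fin.suc) (rest t₀) F)
      (cong₂ _+_ (∑-path-cong (bot Fin.zero) e F (φ-inject₁ ∘ Fin.suc) φ-fromℕ) (cong (λ u → F (u , rest t₀)) φ-fromℕ)))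
  bot-part : ∑ (botPath (suc e) e []) (F ∘ both φ) ≡ ∑ shortened F
  bot-part = ∑-path-map φ (bot Fin.zero) e (bot ∘ Fin.suc) (rest s₀) F
flip-edges {e} (swapped {a} {b} {sq} {sq′} s) f f-sym = begin
  ∑ (edgesOf ((a , b) ∷ sq)) (F ∘ both φ)
    ≡⟨ ∑-edges-∷ a b sq (F ∘ both φ) ⟩
  F (bot Fin.zero , top Fin.zero) + (∑ (topPath a b sq) (F ∘ both φ) + (∑ (botPath a b sq) (F ∘ both φ) + ∑ (edgesOf sq) (F ∘ both φ ∘ both rest)))
    ≡⟨ cong₂ _+_ (f-sym (bot Fin.zero) (top Fin.zero)) (cong₂ _+_ top-part (cong₂ _+_ bot-part (flip-edges s (λ u v → f (rest u) (rest v)) (λ u v → f-sym (rest u) (rest v))))) ⟩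
  F (top Fin.zero , bot Fin.zero) + (∑ (botPath b a sq′) F + (∑ (topPath b a sq′) F + ∑ (edgesOf sq′) (F ∘ both rest)))
    ≡⟨ ring (F (top Fin.zero , bot Fin.zero)) (∑ (botPath b a sq′) F) (∑ (topPath b a sq′) F) (∑ (edgesOf sq′) (F ∘ both rest)) ⟩
  F (top Fin.zero , bot Fin.zero) + (∑ (topPath b a sq′) F + (∑ (botPath b a sq′) F + ∑ (edgesOf sq′) (F ∘ both rest)))
    ≡⟨ ∑-edges-∷ b a sq′ F ⟨
  ∑ (edgesOf ((b , a) ∷ sq′)) F ∎
  where
  open ≡-Reasoning
  φ : V ((a , b) ∷ sq) → V ((b , a) ∷ sq′)
  φ = flip (swapped s)
  F : V ((b , a) ∷ sq′) × V ((b , a) ∷ sq′) → ℚ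
  F = onEdge f
  ring : ∀ r x y z → r + (x + (y + z)) ≡ r + (y + (x + z))
  ring = solve-∀ ℚ-ring
  top-part : ∑ (topPath a b sq) (F ∘ both φ) ≡ ∑ (botPath b a sq′) F
  top-part = ≡-trans (∑-path-map φ (top Fin.zero) a (top ∘ Fin.suc) (rest (leftT sq)) F)
    (cong (λ u → ∑ (path (bot Fin.zero) a (bot ∘ Fin.suc) (rest u)) F) (flip-leftT s))
  bot-part : ∑ (botPath a b sq) (F ∘ both φ) ≡ ∑ (topPath b a sq′) F
  bot-part = ≡-trans (∑-path-map φ (bot Fin.zero) b (bot ∘ Fin.suc) (rest (leftS sq)) F)
    (cong (λ u → ∑ (path (top Fin.zero) b (top ∘ Fin.suc) (rest u)) F) (flip-leftS s))

-- In the first square, too, the outer path is reflected once more; this fixes its middle vertex top 0.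
flipChain : ∀ {e sq sq′} → Swapped e sq sq′ → V ((suc e , e) ∷ sq) → V ((suc e , e) ∷ sq′)
flipChain s (top Fin.zero) = top Fin.zero
flipChain s (top (Fin.suc x)) = bot x
flipChain s (bot y) = top (Fin.suc y)
flipChain s (rest v) = rest (flip s v)

flipChain-involutive : ∀ {e sq sq′} (s : Swapped e sq sq′) v → flipChain (Swapped-sym s) (flipChain s v) ≡ v
flipChain-involutive s (top Fin.zero) = refl
flipChain-involutive s (top (Fin.suc x)) = refl
flipChain-involutive s (bot y) = refl
flipChain-involutive s (rest v) = cong rest (flip-involutive s v)

flipChain-edges : ∀ {e sq sq′} (s : Swapped e sq sq′) (f : V ((suc e , e) ∷ sq′) → V ((suc e , e) ∷ sq′) → ℚ) → (∀ u v → f u v ≡ f v u) →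
  ∑ (edgesOf ((suc e , e) ∷ sq)) (onEdge f ∘ both (flipChain s)) ≡ ∑ (edgesOf ((suc e , e) ∷ sq′)) (onEdge f)
flipChain-edges {e} {sq} {sq′} s f f-sym = begin
  ∑ (edgesOf ((suc e , e) ∷ sq)) (F ∘ both φ)
    ≡⟨ ∑-edges-∷ (suc e) e sq (F ∘ both φ) ⟩
  F (top Fin.zero , top (Fin.suc Fin.zero)) + (∑ (topPath (suc e) e sq) (F ∘ both φ) + (∑ (botPath (suc e) e sq) (F ∘ both φ) + ∑ (edgesOf sq) (F ∘ both φ ∘ both rest)))
    ≡⟨ cong (F (top Fin.zero , top (Fin.suc Fin.zero)) +_) (cong₂ _+_ top-part (cong₂ _+_ bot-part (flip-edges s (λ u v → f (rest u) (rest v)) (λ u v → f-sym (rest u) (rest v))))) ⟩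
  F (top Fin.zero , top (Fin.suc Fin.zero)) + ((F (top Fin.zero , bot Fin.zero) + ∑ (botPath (suc e) e sq′) F) + (∑ outer F + ∑ (edgesOf sq′) (F ∘ both rest)))
    ≡⟨ ring (F (top Fin.zero , top (Fin.suc Fin.zero))) (F (top Fin.zero , bot Fin.zero)) (∑ (botPath (suc e) e sq′) F) (∑ outer F) (∑ (edgesOf sq′) (F ∘ both rest)) ⟩
  F (top Fin.zero , bot Fin.zero) + (∑ (topPath (suc e) e sq′) F + (∑ (botPath (suc e) e sq′) F + ∑ (edgesOf sq′) (F ∘ both rest)))
    ≡⟨ ∑-edges-∷ (suc e) e sq′ F ⟨
  ∑ (edgesOf ((suc e , e) ∷ sq′)) F ∎
  where
  open ≡-Reasoning
  φ : V ((suc e , e) ∷ sq) → V ((suc e , e) ∷ sq′)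
  φ = flipChain s
  F : V ((suc e , e) ∷ sq′) × V ((suc e , e) ∷ sq′) → ℚ
  F = onEdge f
  outer : List (V ((suc e , e) ∷ sq′) × V ((suc e , e) ∷ sq′))
  outer = path (top (Fin.suc Fin.zero)) e (top ∘ Fin.suc ∘ Fin.suc) (rest (leftT sq′))
  ring : ∀ x r b o z → x + ((r + b) + (o + z)) ≡ r + ((x + o) + (b + z))
  ring = solve-∀ ℚ-ring
  top-part : ∑ (topPath (suc e) e sq) (F ∘ both φ) ≡ F (top Fin.zero , bot Fin.zero) + ∑ (botPath (suc e) e sq′) F
  top-part = ≡-trans (∑-path-map φ (top Fin.zero) (suc e) (top ∘ Fin.suc) (rest (leftT sq)) F)
    (cong (λ u → ∑ (path (top Fin.zero) (suc e) bot (rest u)) F) (flip-leftT s))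
  bot-part : ∑ (botPath (suc e) e sq) (F ∘ both φ) ≡ ∑ outer F
  bot-part = ≡-trans (∑-path-map φ (bot Fin.zero) e (bot ∘ Fin.suc) (rest (leftS sq)) F)
    (cong (λ u → ∑ (path (top (Fin.suc Fin.zero)) e (top ∘ Fin.suc ∘ Fin.suc) (rest u)) F) (flip-leftS s))

chain-≅ : ∀ {c h e sq sq′} → Swapped e sq sq′ → suc (length sq) ≡ h → suc (length sq′) ≡ h →
  Balanced c ((suc e , e) ∷ sq) → Balanced c ((suc e , e) ∷ sq′) →
  chainOf c h ((suc e , e) ∷ sq) ≅ chainOf c h ((suc e , e) ∷ sq′)
chain-≅ {c} {h} s l l′ bal bal′ = model-≅ (chainModel c h _ l bal) (chainModel c h _ l′ bal′)
  (flipChain s) (flipChain (Swapped-sym s)) (flipChain-involutive s)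
  (λ v → subst (λ z → flipChain z (flipChain (Swapped-sym s) v) ≡ v) (Swapped-sym-involutive s) (flipChain-involutive (Swapped-sym s) v))
  (flipChain-edges s)

-- The conductances g

module Conductance (c : ℕ) where
  Solution : ℚ → Set
  Solution y = Σ ℚ λ x → x * (κ (suc c) - y) ≡ 1ℚ × 0ℚ <ℚ x × x ≤ℚ ¼

  -- Here c + 1 is the number of subdivision vertices, so κ is at least 5. Subtracting at most 1/4
  -- leaves more than 4, and the inverse is positive and again at most 1/4.
  solve : ∀ y → y ≤ℚ ¼ → Solution y
  solve y y≤¼ = x , x-inverse , 0<x , 0≤-⇒≤ (subst (0ℚ ≤ℚ_) (modulo ¼ x-inverse (ring x z)) (0≤* (0<⇒0≤ 0<x) (0≤* {¼} (ℚₚ.nonNegative⁻¹ ¼) 0≤z-4)))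
    where
    z = κ (suc c) - y
    0≤z-4 : 0ℚ ≤ℚ z - (1ℚ + (1ℚ + (1ℚ + 1ℚ)))
    0≤z-4 = subst (0ℚ ≤ℚ_) (ring₀ (ι c) y) (0≤+ (0≤ι c) (0≤+ (≤⇒0≤- y≤¼) (ℚₚ.nonNegative⁻¹ (1ℚ - ¼))))
      where
      ring₀ : ∀ c y → c + ((½ * ½ - y) + (1ℚ - ½ * ½)) ≡ (1ℚ + (1ℚ + (1ℚ + (1ℚ + (1ℚ + c)))) - y) - (1ℚ + (1ℚ + (1ℚ + 1ℚ)))
      ring₀ = solve-∀ ℚ-ring
    0<z : 0ℚ <ℚ z
    0<z = subst (0ℚ <ℚ_) (ring₁ z) (0<+ {1ℚ + (1ℚ + (1ℚ + 1ℚ))} (ℚₚ.positive⁻¹ (1ℚ + (1ℚ + (1ℚ + 1ℚ)))) 0≤z-4)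
      where
      ring₁ : ∀ z → 1ℚ + (1ℚ + (1ℚ + 1ℚ)) + (z - (1ℚ + (1ℚ + (1ℚ + 1ℚ)))) ≡ z
      ring₁ = solve-∀ ℚ-ring
    instance
      z-positive : ℚ.Positive z
      z-positive = ℚ.positive 0<z
      z-nonZero : ℚ.NonZero z
      z-nonZero = ℚₚ.pos⇒nonZero z
    x = ℚ.1/ z
    x-inverse : x * z ≡ 1ℚ
    x-inverse = ℚₚ.*-inverseˡ z
    0<x : 0ℚ <ℚ x
    0<x = ℚₚ.positive⁻¹ x {{ℚₚ.1/pos⇒pos z}}
    ring : ∀ x z → x * (½ * ½ * (z - (1ℚ + (1ℚ + (1ℚ + 1ℚ))))) ≡ (½ * ½ - x) + ½ * ½ * (x * z - 1ℚ)
    ring = solve-∀ ℚ-ring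

  -- The bound travels with the value, because it is what makes the next denominator invertible.
  state : ℕ → Σ ℚ (_≤ℚ ¼)
  state zero = 0ℚ , ℚₚ.nonNegative⁻¹ ¼
  state (suc r) = let x , _ , _ , x≤¼ = solve (proj₁ (state r)) (proj₂ (state r)) in x , x≤¼

  conductance : ℕ → ℚ
  conductance r = proj₁ (state r)

  conductance-suc : ∀ r → conductance (suc r) * (κ (suc c) - conductance r) ≡ 1ℚ
  conductance-suc r = proj₁ (proj₂ (solve (conductance r) (proj₂ (state r))))

  0<conductance : ∀ r → 0ℚ <ℚ conductance (suc r)
  0<conductance r = proj₁ (proj₂ (proj₂ (solve (conductance r) (proj₂ (state r)))))

-- Offsets of a square with a + b = c subdivision vertices

module _ {a b z : ℕ} (b≡ : b ≡ a ℕ.+ suc (z ℕ.+ z)) where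
  -- The offset is z + 1/2. So 1/4 is the least square that odd parity allows, attained only for z =
  -- 0.
  square-offset : offset a b * offset a b - ¼ ≡ ι z * ι z + ι z
  square-offset = ≡-trans (cong (λ y → ½ * (y - ι a) * (½ * (y - ι a)) - ¼)
    (≡-trans (cong ι b≡) (≡-trans (ι-+ a (suc (z ℕ.+ z))) (cong (λ y → ι a + (1ℚ + y)) (ι-+ z z))))) (ring (ι a) (ι z))
    where
    ring : ∀ a z → ½ * ((a + (1ℚ + (z + z))) - a) * (½ * ((a + (1ℚ + (z + z))) - a)) - ½ * ½ ≡ z * z + z
    ring = solve-∀ ℚ-ring

  ¼≤square-offset : ¼ ≤ℚ offset a b * offset a b
  ¼≤square-offset = 0≤-⇒≤ (subst (0ℚ ≤ℚ_) (sym square-offset) (0≤+ (0≤* (0≤ι z) (0≤ι z)) (0≤ι z)))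

  ¼≡square-offset : ¼ ≡ offset a b * offset a b → z ≡ 0
  ¼≡square-offset eq = ι-zero z (proj₂ (0≤-sum≡0 (0≤* (0≤ι z) (0≤ι z)) (0≤ι z) (≡-trans (sym square-offset)
    (≡-trans (cong (_- ¼) (sym eq)) (ℚₚ.+-inverseʳ ¼)))))
    where
    ι-zero : ∀ z → ι z ≡ 0ℚ → z ≡ 0
    ι-zero zero eq = refl
    ι-zero (suc z) eq = ⊥-elim (ℚₚ.<⇒≢ (0<+ {1ℚ} (ℚₚ.positive⁻¹ 1ℚ) (0≤ι z)) (sym eq))

offset-swap : ∀ a b → offset b a * offset b a ≡ offset a b * offset a b
offset-swap a b = ring (ι a) (ι b)
  where
  ring : ∀ a b → ½ * (a - b) * (½ * (a - b)) ≡ ½ * (b - a) * (½ * (b - a))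
  ring = solve-∀ ℚ-ring

offset-diagonal : ∀ {a b} → a ≡ b → offset a b * offset a b ≡ 0ℚ
offset-diagonal {a} refl = ring (ι a)
  where
  ring : ∀ a → ½ * (a - a) * (½ * (a - a)) ≡ 0ℚ
  ring = solve-∀ ℚ-ring

offset-adjacent : ∀ {a b e} → a ≡ e → b ≡ suc e → offset a b * offset a b ≡ ¼
offset-adjacent {a} refl refl = ring (ι a)
  where
  ring : ∀ a → ½ * ((1ℚ + a) - a) * (½ * ((1ℚ + a) - a)) ≡ ½ * ½
  ring = solve-∀ ℚ-ring

-- The witness `z` is the distance of the smaller part from e, the smaller half of the odd total.
OddSplit : ℕ → ℕ → ℕ → Set
OddSplit e a b = ∃ λ z → (a ℕ.+ z ≡ e × b ≡ a ℕ.+ suc (z ℕ.+ z)) ⊎ (b ℕ.+ z ≡ e × a ≡ b ℕ.+ suc (z ℕ.+ z))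

odd-split : ∀ e a b → a ℕ.+ b ≡ suc (e ℕ.+ e) → OddSplit e a b
odd-split e a b eq with a ℕ.≤? e
... | yes a≤e = z , inj₁ (a+z≡e , ℕₚ.+-cancelˡ-≡ a b _ (≡-trans eq (≡-trans (cong (λ w → suc (w ℕ.+ w)) (sym a+z≡e)) (ring a z))))
  where
  z = e ∸ a
  a+z≡e : a ℕ.+ z ≡ e
  a+z≡e = ℕₚ.m+[n∸m]≡n a≤e
  ring : ∀ a z → suc ((a ℕ.+ z) ℕ.+ (a ℕ.+ z)) ≡ a ℕ.+ (a ℕ.+ suc (z ℕ.+ z))
  ring = ℕ-solve-∀
... | no a≰e = z , inj₂ (b+z≡e , ℕₚ.+-cancelʳ-≡ b a _ (≡-trans eq (≡-trans (cong (λ w → suc (w ℕ.+ w)) (sym b+z≡e)) (ring b z))))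
  where
  b≤e : b ≤ e
  b≤e = ℕₚ.+-cancelˡ-≤ (suc e) b e (ℕₚ.≤-trans (ℕₚ.+-monoˡ-≤ b (ℕₚ.≰⇒> a≰e)) (ℕₚ.≤-reflexive eq))
  z = e ∸ b
  b+z≡e : b ℕ.+ z ≡ e
  b+z≡e = ℕₚ.m+[n∸m]≡n b≤e
  ring : ∀ b z → suc ((b ℕ.+ z) ℕ.+ (b ℕ.+ z)) ≡ (b ℕ.+ suc (z ℕ.+ z)) ℕ.+ b
  ring = ℕ-solve-∀

odd-square-bound : ∀ e a b → a ℕ.+ b ≡ suc (e ℕ.+ e) → ¼ ≤ℚ offset a b * offset a b
odd-square-bound e a b eq = from (odd-split e a b eq)
  where
  from : OddSplit e a b → ¼ ≤ℚ offset a b * offset a b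
  from (z , inj₁ (_ , b≡)) = ¼≤square-offset {a} {b} {z} b≡
  from (z , inj₂ (_ , a≡)) = subst (¼ ≤ℚ_) (offset-swap a b) (¼≤square-offset {b} {a} {z} a≡)

odd-square-minimum : ∀ e a b → a ℕ.+ b ≡ suc (e ℕ.+ e) → ¼ ≡ offset a b * offset a b → (a ≡ e) ⊎ (a ≡ suc e)
odd-square-minimum e a b eq sq≡ = from (odd-split e a b eq)
  where
  near : ∀ {a z} → a ℕ.+ z ≡ e → z ≡ 0 → a ≡ e
  near {a} a+z≡e refl = ≡-trans (sym (ℕₚ.+-identityʳ a)) a+z≡e
  far : ∀ {b z} → b ℕ.+ z ≡ e → a ≡ b ℕ.+ suc (z ℕ.+ z) → z ≡ 0 → a ≡ suc e
  far {b} b+z≡e a≡ refl = ≡-trans a≡ (≡-trans (ℕₚ.+-comm b 1) (cong suc (near b+z≡e refl)))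
  from : OddSplit e a b → (a ≡ e) ⊎ (a ≡ suc e)
  from (z , inj₁ (a+z≡e , b≡)) = inj₁ (near a+z≡e (¼≡square-offset {a} {b} {z} b≡ sq≡))
  from (z , inj₂ (b+z≡e , a≡)) = inj₂ (far b+z≡e a≡ (¼≡square-offset {b} {a} {z} a≡ (≡-trans sq≡ (sym (offset-swap a b)))))

ι-injective : ∀ a b → ι a ≡ ι b → a ≡ b
ι-injective zero zero eq = refl
ι-injective zero (suc b) eq = ⊥-elim (ℚₚ.<⇒≢ (0<+ {1ℚ} (ℚₚ.positive⁻¹ 1ℚ) (0≤ι b)) eq)
ι-injective (suc a) zero eq = ⊥-elim (ℚₚ.<⇒≢ (0<+ {1ℚ} (ℚₚ.positive⁻¹ 1ℚ) (0≤ι a)) (sym eq))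
ι-injective (suc a) (suc b) eq = cong suc (ι-injective a b (≡-trans (cancel (ι a)) (≡-trans (cong (_- 1ℚ) eq) (sym (cancel (ι b))))))
  where
  cancel : ∀ x → x ≡ 1ℚ + x - 1ℚ
  cancel = solve-∀ ℚ-ring

even-square-minimum : ∀ e a b → a ℕ.+ b ≡ e ℕ.+ e → 0ℚ ≡ offset a b * offset a b → a ≡ e
even-square-minimum e a b eq sq≡ = half a e (≡-trans (cong (a ℕ.+_) (ι-injective a b (≡-trans (ring (ι b) (ι a)) (≡-trans
    (cong (λ z → ι b - (z + z)) (square-≡0 {offset a b} (sym sq≡))) (ring′ (ι b)))))) eq)
  where
  ring : ∀ b a → a ≡ b - (½ * (b - a) + ½ * (b - a))
  ring = solve-∀ ℚ-ring
  ring′ : ∀ b → b - (0ℚ + 0ℚ) ≡ b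
  ring′ = solve-∀ ℚ-ring
  half : ∀ a e → a ℕ.+ a ≡ e ℕ.+ e → a ≡ e
  half a e eq = ℕₚ.*-cancelʳ-≡ a e 2 (≡-trans (double a) (≡-trans eq (sym (double e))))
    where
    double : ∀ a → a ℕ.* 2 ≡ a ℕ.+ a
    double = ℕ-solve-∀

-- Words

endSquare : ℕ → ℕ × ℕ
endSquare c = ⌈ c /2⌉ , ⌊ c /2⌋

inner : ∀ {h} → ℕ → Vec ℕ h → Squares
inner c w = map (λ a → a , c ∸ a) (Vec.toList w) ++ endSquare c ∷ []

endSquare-balanced : ∀ c → ⌈ c /2⌉ ℕ.+ ⌊ c /2⌋ ≡ c
endSquare-balanced c = ≡-trans (ℕₚ.+-comm ⌈ c /2⌉ ⌊ c /2⌋) (ℕₚ.⌊n/2⌋+⌈n/2⌉≡n c)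

inner-balanced : ∀ {h} c (w : Vec ℕ h) → All (_≤ c) w → Balanced c (inner c w)
inner-balanced c Vec.[] All.[] = endSquare-balanced c ∷ []
inner-balanced c (a Vec.∷ w) (a≤c All.∷ w≤c) = ℕₚ.m+[n∸m]≡n a≤c ∷ inner-balanced c w w≤c

inner-length : ∀ {h} c (w : Vec ℕ h) → length (inner c w) ≡ suc h
inner-length c Vec.[] = refl
inner-length c (a Vec.∷ w) = cong suc (inner-length c w)

⌊n+n/2⌋ : ∀ e → ⌊ e ℕ.+ e /2⌋ ≡ e
⌊n+n/2⌋ zero = refl
⌊n+n/2⌋ (suc e) rewrite ℕₚ.+-suc e e = cong suc (⌊n+n/2⌋ e)

⌊1+n+n/2⌋ : ∀ e → ⌊ suc (e ℕ.+ e) /2⌋ ≡ e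
⌊1+n+n/2⌋ zero = refl
⌊1+n+n/2⌋ (suc e) rewrite ℕₚ.+-suc e e = cong suc (⌊1+n+n/2⌋ e)

parity : ∀ c → ∃ λ e → (c ≡ e ℕ.+ e) ⊎ (c ≡ suc (e ℕ.+ e))
parity zero = 0 , inj₁ refl
parity (suc c) with parity c
... | e , inj₁ refl = e , inj₂ refl
... | e , inj₂ refl = suc e , inj₁ (cong suc (sym (ℕₚ.+-suc e e)))

-- Exchanging the two letters at each step suits induction better than testing the parity of an
-- index, and makes the upside-down word an instance of the same function.
alternate : A → A → ∀ h → Vec A h
alternate p q zero = Vec.[]
alternate p q (suc h) = p Vec.∷ alternate q p h

altSeq-alternate : ∀ k h → altSeq k h ≡ alternate ⌊ (k ∸ 4) /2⌋ ⌈ (k ∸ 4) /2⌉ h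
altSeq-alternate k zero = refl
altSeq-alternate k (suc zero) = refl
altSeq-alternate k (suc (suc h)) = cong (λ w → ⌊ (k ∸ 4) /2⌋ Vec.∷ ⌈ (k ∸ 4) /2⌉ Vec.∷ w) (altSeq-alternate k h)

alternate-replicate : ∀ (p : ℕ) h → alternate p p h ≡ Vec.replicate h p
alternate-replicate p zero = refl
alternate-replicate p (suc h) = cong (p Vec.∷_) (alternate-replicate p h)

alternate-≤ : ∀ {c p q} h → p ≤ c → q ≤ c → All (_≤ c) (alternate p q h)
alternate-≤ zero p≤c q≤c = All.[]
alternate-≤ (suc h) p≤c q≤c = p≤c All.∷ alternate-≤ h q≤c p≤c

alternate-Swapped : ∀ {c e p q} h → p ℕ.+ q ≡ c → endSquare c ≡ (suc e , e) →
  Swapped e (inner c (alternate p q h)) (inner c (alternate q p h))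
alternate-Swapped {c} {e} zero eq end≡ = subst (λ s → Swapped e (s ∷ []) (s ∷ [])) (sym end≡) end
alternate-Swapped {c} {e} {p} {q} (suc h) eq end≡ =
  subst₂ (λ x y → Swapped e ((p , x) ∷ inner c (alternate q p h)) ((q , y) ∷ inner c (alternate p q h)))
    (≡-trans (sym (ℕₚ.m+n∸m≡n p q)) (cong (_∸ p) eq)) (≡-trans (sym (ℕₚ.m+n∸n≡m p q)) (cong (_∸ q) eq))
    (swapped (alternate-Swapped h (≡-trans (ℕₚ.+-comm q p) eq) end≡))

-- Treats both parities at once: p and q are the halves of c, equal when c is even. Only `bound` and
-- `minimal` depend on parity.
module Words (c p q : ℕ) (p+q≡c : p ℕ.+ q ≡ c)
  (bound : ∀ a b → a ℕ.+ b ≡ c → offset p q * offset p q ≤ℚ offset a b * offset a b)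
  (minimal : ∀ a b → a ℕ.+ b ≡ c → offset p q * offset p q ≡ offset a b * offset a b → (a ≡ p) ⊎ (a ≡ q)) where

  D : ℚ
  D = offset p q * offset p q

  c∸p≡q : c ∸ p ≡ q
  c∸p≡q = ≡-trans (cong (_∸ p) (sym p+q≡c)) (ℕₚ.m+n∸m≡n p q)

  c∸q≡p : c ∸ q ≡ p
  c∸q≡p = ≡-trans (cong (_∸ q) (sym p+q≡c)) (ℕₚ.m+n∸n≡m p q)

  interior-bound : ∀ {h} (w : Vec ℕ h) → All (_≤ c) w → Interior (λ d → D ≤ℚ d * d) (offsetsOf (inner c w))
  interior-bound Vec.[] _ = tt
  interior-bound (a Vec.∷ Vec.[]) (a≤c All.∷ _) = bound a (c ∸ a) (ℕₚ.m+[n∸m]≡n a≤c) , tt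
  interior-bound (a Vec.∷ w@(_ Vec.∷ _)) (a≤c All.∷ w≤c) = bound a (c ∸ a) (ℕₚ.m+[n∸m]≡n a≤c) , interior-bound w w≤c

  mutual
    interior-alternate : ∀ h → Interior (λ d → D ≡ d * d) (offsetsOf (inner c (alternate p q h)))
    interior-alternate zero = tt
    interior-alternate (suc zero) = cong (λ b → offset p b * offset p b) (sym c∸p≡q) , tt
    interior-alternate (suc (suc h)) = cong (λ b → offset p b * offset p b) (sym c∸p≡q) , interior-alternate′ (suc h)

    interior-alternate′ : ∀ h → Interior (λ d → D ≡ d * d) (offsetsOf (inner c (alternate q p h)))
    interior-alternate′ zero = tt
    interior-alternate′ (suc zero) = ≡-trans (offset-swap q p) (cong (λ b → offset q b * offset q b) (sym c∸q≡p)) , tt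
    interior-alternate′ (suc (suc h)) = ≡-trans (offset-swap q p) (cong (λ b → offset q b * offset q b) (sym c∸q≡p)) , interior-alternate (suc h)

  offset-+ : offset p (c ∸ p) + offset q (c ∸ q) ≡ 0ℚ
  offset-+ = ≡-trans (cong₂ (λ x y → offset p x + offset q y) c∸p≡q c∸q≡p) (ring (ι p) (ι q))
    where
    ring : ∀ p q → ½ * (q - p) + ½ * (p - q) ≡ 0ℚ
    ring = solve-∀ ℚ-ring

  mutual
    alternating-alternate : ∀ h → Alternating (offsetsOf (inner c (alternate p q h)))
    alternating-alternate zero = tt
    alternating-alternate (suc zero) = tt
    alternating-alternate (suc (suc zero)) = offset-+ , tt
    alternating-alternate (suc (suc (suc h))) = offset-+ , alternating-alternate′ (suc (suc h))

    alternating-alternate′ : ∀ h → Alternating (offsetsOf (inner c (alternate q p h)))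
    alternating-alternate′ zero = tt
    alternating-alternate′ (suc zero) = tt
    alternating-alternate′ (suc (suc zero)) = offset-+′ , tt
    alternating-alternate′ (suc (suc (suc h))) = offset-+′ , alternating-alternate (suc (suc h))

    offset-+′ : offset q (c ∸ q) + offset p (c ∸ p) ≡ 0ℚ
    offset-+′ = ≡-trans (ℚₚ.+-comm (offset q (c ∸ q)) (offset p (c ∸ p))) offset-+

  degenerate : ∀ {a b} → offset a b + offset a b ≡ 0ℚ → a ≡ b
  degenerate {a} {b} eq = ι-injective a b (≡-trans (ring (ι b) (ι a)) (≡-trans (cong (λ z → ι b - z) eq) (ring′ (ι b))))
    where
    ring : ∀ b a → a ≡ b - (½ * (b - a) + ½ * (b - a))
    ring = solve-∀ ℚ-ring
    ring′ : ∀ b → b - 0ℚ ≡ b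
    ring′ = solve-∀ ℚ-ring

  -- If a were p too, two equal offsets would sum to zero. The square would then be split evenly, so
  -- p = q and the claim holds all the same.
  before-p : ∀ {a} → (a ≡ p) ⊎ (a ≡ q) → offset a (c ∸ a) + offset p (c ∸ p) ≡ 0ℚ → a ≡ q
  before-p (inj₁ refl) eq = ≡-trans (degenerate eq) c∸p≡q
  before-p (inj₂ a≡q) eq = a≡q

  before-q : ∀ {a} → (a ≡ p) ⊎ (a ≡ q) → offset a (c ∸ a) + offset q (c ∸ q) ≡ 0ℚ → a ≡ p
  before-q (inj₁ a≡p) eq = a≡p
  before-q (inj₂ refl) eq = ≡-trans (degenerate eq) c∸q≡p

  alternating-∷ : ∀ {h} d d′ (w : Vec ℕ h) → Alternating (d ∷ d′ ∷ offsetsOf (inner c w)) → d + d′ ≡ 0ℚ × Alternating (d′ ∷ offsetsOf (inner c w))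
  alternating-∷ d d′ Vec.[] alt = alt
  alternating-∷ d d′ (_ Vec.∷ _) alt = alt

  IsAlternate : ∀ {h} → Vec ℕ h → Set
  IsAlternate {h} w = (w ≡ alternate p q h) ⊎ (w ≡ alternate q p h)

  IsAlternate-singleton : ∀ {a} → (a ≡ p) ⊎ (a ≡ q) → IsAlternate (a Vec.∷ Vec.[])
  IsAlternate-singleton (inj₁ refl) = inj₁ refl
  IsAlternate-singleton (inj₂ refl) = inj₂ refl

  IsAlternate-∷ : ∀ {h a b} {w : Vec ℕ h} → (a ≡ p) ⊎ (a ≡ q) → offset a (c ∸ a) + offset b (c ∸ b) ≡ 0ℚ →
    IsAlternate (b Vec.∷ w) → IsAlternate (a Vec.∷ b Vec.∷ w)
  IsAlternate-∷ {h} entry sum (inj₁ refl) = inj₂ (cong (Vec._∷ alternate p q (suc h)) (before-p entry sum))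
  IsAlternate-∷ {h} entry sum (inj₂ refl) = inj₁ (cong (Vec._∷ alternate q p (suc h)) (before-q entry sum))

  minimisers : ∀ {h} (w : Vec ℕ h) → All (_≤ c) w → Interior (λ d → D ≡ d * d) (offsetsOf (inner c w)) → Alternating (offsetsOf (inner c w)) →
    IsAlternate w
  minimisers Vec.[] w≤c int alt = inj₁ refl
  minimisers (a Vec.∷ Vec.[]) (a≤c All.∷ _) (eq , _) alt = IsAlternate-singleton (minimal a (c ∸ a) (ℕₚ.m+[n∸m]≡n a≤c) eq)
  minimisers (a Vec.∷ b Vec.∷ w) (a≤c All.∷ w≤c) (eq , int) alt =
    let sum , alt′ = alternating-∷ (offset a (c ∸ a)) (offset b (c ∸ b)) w alt in
    IsAlternate-∷ (minimal a (c ∸ a) (ℕₚ.m+[n∸m]≡n a≤c) eq) sum (minimisers (b Vec.∷ w) w≤c int alt′)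

-- The extremal chains

≅-refl : ∀ G → G ≅ G
≅-refl G = ↔-id (Fin (n G)) , λ i j → refl

module Extremal (c′ h′ : ℕ) where
  c k h : ℕ
  c = suc c′
  k = 4 ℕ.+ c
  h = 2 ℕ.+ h′

  open Conductance c′
  open Index c conductance refl conductance-suc
  open Minimum c conductance refl conductance-suc 0<conductance (proj₂ ∘ state)

  indexOf : Vec ℕ h′ → ℚ
  indexOf w = base (vertexCount h) 0ℚ h - defect 0ℚ 0ℚ (offsetsOf (endSquare c ∷ inner c w))

  chain-balanced : ∀ (w : Vec ℕ h′) → All (_≤ c) w → Balanced c (endSquare c ∷ inner c w)
  chain-balanced w w≤c = endSquare-balanced c ∷ inner-balanced c w w≤c

  kirchhoff-P : ∀ w → All (_≤ c) w → IsKirchhoff (P k h w) (indexOf w)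
  kirchhoff-P w w≤c = kirchhoff-chain h (endSquare c ∷ inner c w) (cong suc (inner-length c w)) (chain-balanced w w≤c)

  p q : ℕ
  p = ⌊ c /2⌋
  q = ⌈ c /2⌉

  p+q≡c : p ℕ.+ q ≡ c
  p+q≡c = ℕₚ.⌊n/2⌋+⌈n/2⌉≡n c

  p≤c : p ≤ c
  p≤c = ℕₚ.⌊n/2⌋≤n c

  q≤c : q ≤ c
  q≤c = ℕₚ.⌈n/2⌉≤n c

  Halves : Set
  Halves = (p ≡ q) ⊎ ∃ λ e → p ≡ e × q ≡ suc e × c ≡ suc (e ℕ.+ e)

  halves : Halves
  halves = from (parity c)
    where
    from : (∃ λ e → (c ≡ e ℕ.+ e) ⊎ (c ≡ suc (e ℕ.+ e))) → Halves
    from (e , inj₁ eq) = inj₁ (≡-trans (≡-trans (cong ⌊_/2⌋ eq) (⌊n+n/2⌋ e)) (sym (≡-trans (cong ⌈_/2⌉ eq) (⌊1+n+n/2⌋ e))))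
    from (e , inj₂ eq) = inj₂ (e , ≡-trans (cong ⌊_/2⌋ eq) (⌊1+n+n/2⌋ e) , ≡-trans (cong ⌈_/2⌉ eq) (cong suc (⌊n+n/2⌋ e)) , eq)

  squares-bound : ∀ a b → a ℕ.+ b ≡ c → offset p q * offset p q ≤ℚ offset a b * offset a b
  squares-bound a b eq = from halves
    where
    from : Halves → offset p q * offset p q ≤ℚ offset a b * offset a b
    from (inj₁ p≡q) = subst (_≤ℚ offset a b * offset a b) (sym (offset-diagonal p≡q)) (0≤-square (offset a b))
    from (inj₂ (e , p≡ , q≡ , c≡)) = subst (_≤ℚ offset a b * offset a b) (sym (offset-adjacent p≡ q≡)) (odd-square-bound e a b (≡-trans eq c≡))

  squares-minimal : ∀ a b → a ℕ.+ b ≡ c → offset p q * offset p q ≡ offset a b * offset a b → (a ≡ p) ⊎ (a ≡ q)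
  squares-minimal a b eq sq≡ = from halves
    where
    from : Halves → (a ≡ p) ⊎ (a ≡ q)
    from (inj₁ p≡q) = inj₁ (even-square-minimum p a b (≡-trans eq (≡-trans (sym p+q≡c) (cong (p ℕ.+_) (sym p≡q)))) (≡-trans (sym (offset-diagonal p≡q)) sq≡))
    from (inj₂ (e , p≡ , q≡ , c≡)) = Data.Sum.map (λ a≡ → ≡-trans a≡ (sym p≡)) (λ a≡ → ≡-trans a≡ (sym q≡))
      (odd-square-minimum e a b (≡-trans eq c≡) (≡-trans (sym (offset-adjacent p≡ q≡)) sq≡))

  open Words c p q p+q≡c squares-bound squares-minimal

  zigzag : Vec ℕ h′
  zigzag = alternate p q h′

  zigzag≤c : All (_≤ c) zigzag
  zigzag≤c = alternate-≤ h′ p≤c q≤c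

  defect-length : ∀ (w : Vec ℕ h′) → length (offsetsOf (inner c w)) ≡ suc h′
  defect-length w = ≡-trans (length-offsets (inner c w)) (inner-length c w)

  optimum : ℚ
  optimum = minimumOf D (suc h′)

  defect-zigzag : defect 0ℚ 0ℚ (offsetsOf (endSquare c ∷ inner c zigzag)) ≡ optimum
  defect-zigzag = ≡-trans (defect-attained (offset q p) (offsetsOf (inner c zigzag)) (interior-alternate h′) (alternating-alternate h′))
    (cong (minimumOf D) (defect-length zigzag))

  index-maximum : ∀ w → All (_≤ c) w → indexOf w ≤ℚ indexOf zigzag
  index-maximum w w≤c = ℚₚ.+-monoʳ-≤ (base (vertexCount h) 0ℚ h) (ℚₚ.neg-antimono-≤
    (subst (_≤ℚ defect 0ℚ 0ℚ (offsetsOf (endSquare c ∷ inner c w))) (≡-trans (cong (minimumOf D) (defect-length w)) (sym defect-zigzag))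
      (defect-minimum (offset q p) (offsetsOf (inner c w)) (interior-bound w w≤c))))

  index-maximisers : ∀ w → All (_≤ c) w → indexOf w ≡ indexOf zigzag → IsAlternate w
  index-maximisers w w≤c eq = let int , alt = defect-minimisers (offset q p) (offsetsOf (inner c w)) (interior-bound w w≤c) defect≡
    in minimisers w w≤c int alt
    where
    ring : ∀ x y → y ≡ x - (x - y)
    ring = solve-∀ ℚ-ring
    x = base (vertexCount h) 0ℚ h
    defect≡ : defect 0ℚ 0ℚ (offsetsOf (endSquare c ∷ inner c w)) ≡ minimumOf D (length (offsetsOf (inner c w)))
    defect≡ = ≡-trans (ring x (defect 0ℚ 0ℚ (offsetsOf (endSquare c ∷ inner c w)))) (≡-trans (cong (λ z → x - z) eq)
      (≡-trans (sym (ring x (defect 0ℚ 0ℚ (offsetsOf (endSquare c ∷ inner c zigzag)))))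
        (≡-trans defect-zigzag (cong (minimumOf D) (sym (defect-length w))))))

  -- For even c the two words coincide. For odd c the end squares are not symmetric under turning
  -- over, which is why the isomorphism also reflects their outer paths.
  zigzag-reflected : P k h (alternate q p h′) ≅ P k h zigzag
  zigzag-reflected = from halves
    where
    from : Halves → P k h (alternate q p h′) ≅ P k h zigzag
    from (inj₁ p≡q) = subst (λ w → P k h w ≅ P k h zigzag) (cong₂ (λ x y → alternate x y h′) p≡q (sym p≡q)) (≅-refl (P k h zigzag))
    from (inj₂ (e , p≡ , q≡ , c≡)) = subst (λ s → chainOf c h (s ∷ inner c (alternate q p h′)) ≅ chainOf c h (s ∷ inner c zigzag)) (sym end≡)
      (chain-≅ (alternate-Swapped h′ (≡-trans (ℕₚ.+-comm q p) p+q≡c) end≡)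
        (cong suc (inner-length c (alternate q p h′))) (cong suc (inner-length c zigzag))
        (balanced (alternate q p h′) (alternate-≤ h′ q≤c p≤c)) (balanced zigzag zigzag≤c))
      where
      end≡ : endSquare c ≡ (suc e , e)
      end≡ = cong₂ _,_ q≡ p≡
      balanced : ∀ (w : Vec ℕ h′) → All (_≤ c) w → Balanced c ((suc e , e) ∷ inner c w)
      balanced w w≤c = subst (λ s → Balanced c (s ∷ inner c w)) end≡ (chain-balanced w w≤c)

  maximiser-≅ : ∀ w → All (_≤ c) w → indexOf w ≡ indexOf zigzag → P k h w ≅ P k h zigzag
  maximiser-≅ w w≤c eq = from (index-maximisers w w≤c eq)
    where
    from : IsAlternate w → P k h w ≅ P k h zigzag
    from (inj₁ refl) = ≅-refl (P k h zigzag)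
    from (inj₂ refl) = zigzag-reflected

  module _ (G : Graph) (w : Vec ℕ h′) (w≤c : All (_≤ c) w) (iso : G ≅ P k h w) where
    kirchhoff-G : IsKirchhoff G (indexOf w)
    kirchhoff-G = IsKirchhoff-≅ G (P k h w) iso (kirchhoff-P w w≤c)

    maximum : ∀ {K K*} → IsKirchhoff G K → IsKirchhoff (P k h zigzag) K* → (K ≤ℚ K*) × ((K ≡ K*) ⇔ (G ≅ P k h zigzag))
    maximum {K} {K*} kG kZ = subst₂ _≤ℚ_ (sym K≡) (sym K*≡) (index-maximum w w≤c) , mk⇔
      (λ eq → ≅-trans G (P k h w) (P k h zigzag) iso (maximiser-≅ w w≤c (≡-trans (sym K≡) (≡-trans eq K*≡))))
      (λ iso′ → IsKirchhoff-unique G kG (IsKirchhoff-≅ G (P k h zigzag) iso′ kZ))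
      where
      K≡ : K ≡ indexOf w
      K≡ = IsKirchhoff-unique G kG kirchhoff-G
      K*≡ : K* ≡ indexOf zigzag
      K*≡ = IsKirchhoff-unique (P k h zigzag) kZ (kirchhoff-P zigzag zigzag≤c)

  linear : k % 2 ≡ 0 → Lchain k h ≡ P k h zigzag
  linear even = cong (P k h) (sym (≡-trans (cong (λ z → alternate p z h′) (sym p≡q)) (≡-trans (alternate-replicate p h′)
    (cong (Vec.replicate h′) p≡c/2))))
    where
    odd-% : ∀ e → suc (e ℕ.+ e) % 2 ≡ 1
    odd-% zero = refl
    odd-% (suc e) = ≡-trans (cong (λ z → suc (suc z) % 2) (ℕₚ.+-suc e e)) (odd-% e)
    p≡q : p ≡ q
    p≡q = from halves
      where
      0≢1 : 0 ≢ 1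
      0≢1 ()
      from : Halves → p ≡ q
      from (inj₁ eq) = eq
      from (inj₂ (e , _ , _ , c≡)) = ⊥-elim (0≢1 (≡-trans (sym even) (≡-trans (cong (_% 2) c≡) (odd-% e))))
    p≡c/2 : p ≡ c ℕ./ 2
    p≡c/2 = sym (half c)
      where
      half : ∀ c → c ℕ./ 2 ≡ ⌊ c /2⌋
      half zero = refl
      half (suc zero) = refl
      half (suc (suc c)) = ≡-trans (DivMod.+-distrib-/-∣ˡ {2} c (Data.Nat.Divisibility.∣-refl)) (cong suc (half c))

theorem1p2 : (k h : ℕ) → 5 ≤ k → 2 ≤ h →
    (G : Graph) (w : Vec ℕ (h ∸ 2)) → All (_≤ k ∸ 4) w → G ≅ P k h w →
    (Σ ℚ (IsKirchhoff G)) ×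
    (Σ ℚ (IsKirchhoff (P k h (altSeq k (h ∸ 2))))) ×
    ((K K* : ℚ) → IsKirchhoff G K → IsKirchhoff (P k h (altSeq k (h ∸ 2))) K* →
      (K ≤ℚ K*) ×
      (k % 2 ≡ 0 → ((K ≡ K*) ⇔ (G ≅ Lchain k h))) ×
      (k % 2 ≡ 1 → ((K ≡ K*) ⇔ (G ≅ Zchain k h))))
theorem1p2 (suc (suc (suc (suc (suc c′))))) (suc (suc h′)) (s≤s (s≤s (s≤s (s≤s (s≤s _))))) (s≤s (s≤s _)) G w w≤c iso =
  -- `Zchain` unfolds to `P` of the same `altSeq` word, so one substitution replaces that word both
  -- in the bound and in the odd equality case.
  subst Claim (sym (altSeq-alternate k h′))
    ((indexOf w , kirchhoff-G G w w≤c iso) , (indexOf zigzag , kirchhoff-P zigzag zigzag≤c) ,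
      λ K K* kG kZ → let bound , equality = maximum G w w≤c iso kG kZ in
        bound , (λ even → subst (λ H → (K ≡ K*) ⇔ (G ≅ H)) (sym (linear even)) equality) , λ _ → equality)
  where
  open Extremal c′ h′
  Claim : Vec ℕ h′ → Set
  Claim z = Σ ℚ (IsKirchhoff G) × Σ ℚ (IsKirchhoff (P k h z)) ×
    ((K K* : ℚ) → IsKirchhoff G K → IsKirchhoff (P k h z) K* →
      (K ≤ℚ K*) × (k % 2 ≡ 0 → ((K ≡ K*) ⇔ (G ≅ Lchain k h))) × (k % 2 ≡ 1 → ((K ≡ K*) ⇔ (G ≅ P k h z))))
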